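{- For every natural number $n$, the set $\mathbf{GLP}^n_0$ is decidable in polynomial time.
   Context: Polymodal formulas are built from propositional variables, $\top,\bot$, $\land,\lor,\lnot,\to$ and modalities $\langle k\rangle$, $k\in\omega$. The logic $\mathbf{GLP}$ is axiomatized by: all axioms of classical propositional calculus; $\langle k\rangle(A\lor B)\to(\langle k\rangle A\lor\langle k\rangle B)$; $\lnot\langle k\rangle\lnot\top$; $\langle k\rangle A\to\langle k\rangle(A\land\lnot\langle k\rangle A)$; $\langle m\rangle A\to\langle k\rangle A$ for $k\le m$; $\langle k\rangle A\to\lnot\langle m\rangle\lnot\langle k\rangle A$ for $k<m$; with rules modus ponens and: from $A\to B$ infer $\langle k\rangle A\to\langle k\rangle B$. For a natural number $n$, $L^n_0$ is the set of formulas built from $\top,\bot,\land,\lor,\to,\lnot$ and modalities $\langle k\rangle$ with $k<n$ (no propositional variables), and $\mathbf{GLP}^n_0$ is the set of $\mathbf{GLP}$-provable formulas in $L^n_0$. -}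

module Defs where

open import Data.Nat using (ℕ; zero; suc; _+_; _*_; _^_; _≤_; _<_)
open import Data.Bool using (Bool; true; false; _∧_; _∨_; not)
open import Data.Fin using (Fin; _↑ˡ_) renaming (zero to fz; suc to fs)
open import Data.List using (List; []; _∷_; _++_; replicate; length; map)
open import Data.Maybe using (Maybe; just; nothing)
open import Data.Product using (_×_; _,_)
open import Data.Sum using (_⊎_; inj₁; inj₂)
open import Relation.Binary.PropositionalEquality using (_≡_)

infixr 5 _⇒_
infixr 6 _∨'_
infixr 7 _∧'_
infix 8 ¬'_
data Fm : Set where
  var  : ℕ → Fm
  ⊤'   : Fm
  ⊥'   : Fm
  _∧'_ : Fm → Fm → Fm
  _∨'_ : Fm → Fm → Fm
  _⇒_  : Fm → Fm → Fm
  ¬'_  : Fm → Fm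
  ◇    : ℕ → Fm → Fm

eval : (Fm → Bool) → Fm → Bool
eval v (var i)  = v (var i)
eval v ⊤'       = true
eval v ⊥'       = false
eval v (A ∧' B) = eval v A ∧ eval v B
eval v (A ∨' B) = eval v A ∨ eval v B
eval v (A ⇒ B)  = not (eval v A) ∨ eval v B
eval v (¬' A)   = not (eval v A)
eval v (◇ k A)  = v (◇ k A)

Taut : Fm → Set
Taut A = (v : Fm → Bool) → eval v A ≡ true

data GLP⊢ : Fm → Set where
  taut  : ∀ {A} → Taut A → GLP⊢ A
  ax-K  : ∀ {k A B} → GLP⊢ (◇ k (A ∨' B) ⇒ (◇ k A ∨' ◇ k B))
  ax-N  : ∀ {k} → GLP⊢ (¬' ◇ k (¬' ⊤'))
  ax-L  : ∀ {k A} → GLP⊢ (◇ k A ⇒ ◇ k (A ∧' ¬' ◇ k A))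
  ax-M  : ∀ {k m A} → k ≤ m → GLP⊢ (◇ m A ⇒ ◇ k A)
  ax-P  : ∀ {k m A} → k < m → GLP⊢ (◇ k A ⇒ ¬' ◇ m (¬' ◇ k A))
  mp    : ∀ {A B} → GLP⊢ A → GLP⊢ (A ⇒ B) → GLP⊢ B
  mono  : ∀ {k A B} → GLP⊢ (A ⇒ B) → GLP⊢ (◇ k A ⇒ ◇ k B)

data InL (n : ℕ) : Fm → Set where
  ⊤ᴸ : InL n ⊤'
  ⊥ᴸ : InL n ⊥'
  ∧ᴸ : ∀ {A B} → InL n A → InL n B → InL n (A ∧' B)
  ∨ᴸ : ∀ {A B} → InL n A → InL n B → InL n (A ∨' B)
  ⇒ᴸ : ∀ {A B} → InL n A → InL n B → InL n (A ⇒ B)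
  ¬ᴸ : ∀ {A} → InL n A → InL n (¬' A)
  ◇ᴸ : ∀ {k A} → k < n → InL n A → InL n (◇ k A)

Σsym : Set
Σsym = Fin 9

s⊤ s⊥ s∧ s∨ s⇒ s¬ s◇ s1 sv : Σsym
s⊤ = fz
s⊥ = fs fz
s∧ = fs (fs fz)
s∨ = fs (fs (fs fz))
s⇒ = fs (fs (fs (fs fz)))
s¬ = fs (fs (fs (fs (fs fz))))
s◇ = fs (fs (fs (fs (fs (fs fz)))))
s1 = fs (fs (fs (fs (fs (fs (fs fz))))))
sv = fs (fs (fs (fs (fs (fs (fs (fs fz)))))))

encode : Fm → List Σsym
encode (var i)  = sv ∷ replicate i s1
encode ⊤'       = s⊤ ∷ []
encode ⊥'       = s⊥ ∷ []
encode (A ∧' B) = s∧ ∷ encode A ++ encode B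
encode (A ∨' B) = s∨ ∷ encode A ++ encode B
encode (A ⇒ B)  = s⇒ ∷ encode A ++ encode B
encode (¬' A)   = s¬ ∷ encode A
encode (◇ k A)  = s◇ ∷ replicate k s1 ++ encode A

-- Deterministic single-tape Turing machines.
-- Tape alphabet Fin (suc (9 + e)): fz is the blank, fs (s ↑ˡ e) is
-- input symbol s.  Transitions either halt with a Boolean answer or
-- write, move and change state.

data Move : Set where
  L R : Move

record TM : Set where
  field
    nQ    : ℕ
    e     : ℕ
    start : Fin nQ
    δ     : Fin nQ → Fin (suc (9 + e)) →
            Bool ⊎ (Fin nQ × Fin (suc (9 + e)) × Move)

module _ (M : TM) where
  open TM M

  Γ : Set
  Γ = Fin (suc (9 + e))

  blank : Γ
  blank = fz

  inSym : Σsym → Γ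
  inSym s = fs (s ↑ˡ e)

  -- configuration: state, cells left of head (nearest first), head cell,
  -- cells right of head
  Config : Set
  Config = Fin nQ × List Γ × Γ × List Γ

  -- move the head; at the left end a left move leaves the head in place
  shift : Move → List Γ → Γ → List Γ → List Γ × Γ × List Γ
  shift L []       h r        = [] , h , r
  shift L (x ∷ l)  h r        = l , x , h ∷ r
  shift R l        h []       = h ∷ l , blank , []
  shift R l        h (x ∷ r)  = h ∷ l , x , r

  initial : List Σsym → Config
  initial []       = start , [] , blank , []
  initial (s ∷ w)  = start , [] , inSym s , map inSym w

  run : ℕ → Config → Maybe Bool
  run zero     c = nothing
  run (suc f) (q , l , h , r) with δ q h
  ... | inj₁ b             = just b
  ... | inj₂ (q' , w , m) with shift m l w r
  ...   | (l' , h' , r')   = run f (q' , l' , h' , r')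

  Accepts? : List Σsym → ℕ → Maybe Bool
  Accepts? w t = run t (initial w)

open import Function.Bundles using (_⇔_)
open import Data.Product using (Σ; ∃)

PolyTimeDecidesGLP : ℕ → Set
PolyTimeDecidesGLP n =
  Σ TM λ M → Σ ℕ λ c → Σ ℕ λ d →
    ∀ A → InL n A →
      Σ Bool λ b →
        (Accepts? M (encode A) (c * (suc (length (encode A))) ^ d) ≡ just b)
        × ((b ≡ true) ⇔ GLP⊢ A)

-- A world of Ignatiev's model is a sequence of ordinals α₀, α₁, … in which αₖ₊₁ is at most the last exponent of
-- αₖ; the modality ◇ k lowers αₖ, keeps the coordinates before it and forgets those after it.  Once the coordinates
-- before k are fixed, a closed formula ◇ k B therefore says that αₖ exceeds a threshold.  The thresholds of the
-- ◇ k-subformulas of B cut the range of αₖ into linearly many cells; in the cell above w the formula B becomes a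
-- formula in the modalities beyond k, whose least point V is found recursively, and the least of the ordinals w ⊹ V
-- that stay in their cell is the threshold of ◇ k B.  The depth of this recursion is the number of modalities, so
-- for a fixed number of modalities the time is polynomial.  Every step is matched by a derivation, so a formula
-- without a least point is refutable in GLP; a formula with one is not, because the model is sound and satisfies
-- the iterated ◇ m ⊤, which imply all formulas that describe thresholds.
--
-- The algorithm is a program in a language of folds over trees, for which polynomial bounds are compositional.
-- Trees are stored as prefix codes, so the input needs no parsing.  Programs run on four stacks, which are four tracks
-- of a single tape.
module Submission where

-- A formula and the description of its least point are not provably equivalent. They can be
-- exchanged only under some `◇ j` with `j ≤ k`, next to a context that the modalities from `k` on
-- cannot change. This is why `Rep` quantifies over stable contexts, and why Löb's axiom enters: it
-- selects a least witness under a diamond. The terms `T` are never interpreted as ordinals;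
-- comparisons between them are derivations, and the model is used only for consistency.
--
-- Polynomial time is endangered in two places. Nested `◇ k` are processed from the inside, so
-- thresholds are built from thresholds; but in each cell all tokens become truth values, hence a
-- recursive call receives a formula no larger than the original one, and a new threshold extends an
-- old one by a single exponent of bounded size. Moreover, a fold whose values grow at every node
-- may have exponential output, so the cost of a fold is bounded only after the sizes of its values
-- have been bounded by other means, if necessary from what the program computes.

open import Data.Bool using (true; false; _∧_; _∨_; not; Bool; if_then_else_)
open import Relation.Binary.PropositionalEquality using (_≡_; refl; _≢_; sym; trans; cong; subst; cong₂; _≗_)
open import Data.Product using (_×_; _,_; ∃-syntax; proj₁; proj₂; Σ)
open import Data.Sum using (_⊎_; inj₁; inj₂; [_,_]′)
open import Data.Unit using (⊤; tt)
open import Data.Empty using (⊥; ⊥-elim)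
open import Data.List.Membership.Propositional using (_∈_)
open import Data.List.Membership.Propositional.Properties using (∈-++⁺ˡ; ∈-++⁺ʳ; ∈-++⁻; ∈-map⁺; ∈-map⁻; ∈-concatMap⁺; ∈-cartesianProduct⁺)
open import Data.List.Relation.Unary.Any using (here; there)
open import Data.Maybe using (Maybe; just; nothing; maybe′)

-- Derived rules of GLP and formulas stable under higher modalities.

module Calculus where

  open import Defs
  open import Data.Nat using (ℕ; suc; _≤_; _<_)
  open import Data.Nat.Properties using (≤-refl; ≤-trans; <⇒≤; n≤1+n)

  infix 4 _⊑_
  _⊑_ : Fm → Fm → Set
  A ⊑ B = GLP⊢ (A ⇒ B)

  -- With its premises moved into the conclusion a propositional rule is a tautology, so each rule
  -- below reduces to a case split on the Boolean values of its letters.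
  ⊑-taut₁ : ∀ {A B C} → (∀ v → (not (eval v A) ∨ eval v B) ≡ true → eval v C ≡ true) → A ⊑ B → GLP⊢ C
  ⊑-taut₁ {A} {B} {C} f p = mp p (taut λ v → go (not (eval v A) ∨ eval v B) (eval v C) (f v))
    where
    go : ∀ a c → (a ≡ true → c ≡ true) → (not a ∨ c) ≡ true
    go false c h = refl
    go true  c h = h refl

  ⊑-taut₂ : ∀ {A B A' B' C} →
    (∀ v → (not (eval v A) ∨ eval v B) ≡ true → (not (eval v A') ∨ eval v B') ≡ true → eval v C ≡ true) →
    A ⊑ B → A' ⊑ B' → GLP⊢ C
  ⊑-taut₂ {A} {B} {A'} {B'} {C} f p q =
    mp q (mp p (taut λ v → go (not (eval v A) ∨ eval v B) (not (eval v A') ∨ eval v B') (eval v C) (f v)))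
    where
    go : ∀ a b c → (a ≡ true → b ≡ true → c ≡ true) → (not a ∨ (not b ∨ c)) ≡ true
    go false b     c h = refl
    go true  false c h = refl
    go true  true  c h = h refl refl

  ⊑-refl : ∀ {A} → A ⊑ A
  ⊑-refl {A} = taut λ v → go (eval v A)
    where
    go : ∀ a → (not a ∨ a) ≡ true
    go false = refl
    go true  = refl

  ⊑-trans : ∀ {A B C} → A ⊑ B → B ⊑ C → A ⊑ C
  ⊑-trans {A} {B} {C} = ⊑-taut₂ λ v → go (eval v A) (eval v B) (eval v C)
    where
    go : ∀ a b c → (not a ∨ b) ≡ true → (not b ∨ c) ≡ true → (not a ∨ c) ≡ true
    go false b c p q = refl
    go true true c p q = q

  infixr 4 _⊙_
  _⊙_ : ∀ {A B C} → A ⊑ B → B ⊑ C → A ⊑ C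
  _⊙_ = ⊑-trans

  ∧-l : ∀ {A B} → A ∧' B ⊑ A
  ∧-l {A} {B} = taut λ v → go (eval v A) (eval v B)
    where
    go : ∀ a b → (not (a ∧ b) ∨ a) ≡ true
    go false b = refl
    go true false = refl
    go true true = refl

  ∧-r : ∀ {A B} → A ∧' B ⊑ B
  ∧-r {A} {B} = taut λ v → go (eval v A) (eval v B)
    where
    go : ∀ a b → (not (a ∧ b) ∨ b) ≡ true
    go false b = refl
    go true false = refl
    go true true = refl

  ∧-i : ∀ {A B C} → C ⊑ A → C ⊑ B → C ⊑ A ∧' B
  ∧-i {A} {B} {C} = ⊑-taut₂ λ v → go (eval v A) (eval v B) (eval v C)
    where
    go : ∀ a b c → (not c ∨ a) ≡ true → (not c ∨ b) ≡ true → (not c ∨ (a ∧ b)) ≡ true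
    go a b false p q = refl
    go true b true p q = q

  ∨-l : ∀ {A B} → A ⊑ A ∨' B
  ∨-l {A} {B} = taut λ v → go (eval v A) (eval v B)
    where
    go : ∀ a b → (not a ∨ (a ∨ b)) ≡ true
    go false b = refl
    go true b = refl

  ∨-r : ∀ {A B} → B ⊑ A ∨' B
  ∨-r {A} {B} = taut λ v → go (eval v A) (eval v B)
    where
    go : ∀ a b → (not b ∨ (a ∨ b)) ≡ true
    go a false = refl
    go true true = refl
    go false true = refl

  ∨-e : ∀ {A B C} → A ⊑ C → B ⊑ C → A ∨' B ⊑ C
  ∨-e {A} {B} {C} = ⊑-taut₂ λ v → go (eval v A) (eval v B) (eval v C)
    where
    go : ∀ a b c → (not a ∨ c) ≡ true → (not b ∨ c) ≡ true → (not (a ∨ b) ∨ c) ≡ true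
    go a b true p q with a ∨ b
    ... | true = refl
    ... | false = refl
    go false false false p q = refl

  ⊤-i : ∀ {A} → A ⊑ ⊤'
  ⊤-i {A} = taut λ v → go (eval v A)
    where
    go : ∀ a → (not a ∨ true) ≡ true
    go false = refl
    go true = refl

  ⊥-e : ∀ {A} → ⊥' ⊑ A
  ⊥-e = taut λ v → refl

  ⊢-wk : ∀ {A C} → GLP⊢ A → C ⊑ A
  ⊢-wk {A} {C} p = mp p (taut λ v → go (eval v A) (eval v C))
    where
    go : ∀ a c → (not a ∨ (not c ∨ a)) ≡ true
    go false c = refl
    go true false = refl
    go true true = refl

  ¬-i : ∀ {A C} → C ∧' A ⊑ ⊥' → C ⊑ ¬' A
  ¬-i {A} {C} = ⊑-taut₁ λ v → go (eval v A) (eval v C)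
    where
    go : ∀ a c → (not (c ∧ a) ∨ false) ≡ true → (not c ∨ not a) ≡ true
    go a false p = refl
    go false true p = refl

  ¬-e : ∀ {A C B} → C ⊑ A → C ⊑ ¬' A → C ⊑ B
  ¬-e {A} {C} {B} = ⊑-taut₂ λ v → go (eval v A) (eval v C) (eval v B)
    where
    go : ∀ a c b → (not c ∨ a) ≡ true → (not c ∨ not a) ≡ true → (not c ∨ b) ≡ true
    go a false b p q = refl
    go true true b p ()
    go false true b () q

  ⊢¬⇒⊑ : ∀ {A} → GLP⊢ (¬' A) → A ⊑ ⊥'
  ⊢¬⇒⊑ {A} p = mp p (taut λ v → go (eval v A))
    where
    go : ∀ a → (not (not a) ∨ (not a ∨ false)) ≡ true
    go false = refl
    go true = refl

  ⊑⇒⊢¬ : ∀ {A} → A ⊑ ⊥' → GLP⊢ (¬' A)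
  ⊑⇒⊢¬ {A} = ⊑-taut₁ λ v → go (eval v A)
    where
    go : ∀ a → (not a ∨ false) ≡ true → not a ≡ true
    go false p = refl

  ¬¬-e : ∀ {A} → ¬' ¬' A ⊑ A
  ¬¬-e {A} = taut λ v → go (eval v A)
    where
    go : ∀ a → (not (not (not a)) ∨ a) ≡ true
    go false = refl
    go true = refl

  ⊑-lem : ∀ {A C B} → C ∧' A ⊑ B → C ∧' ¬' A ⊑ B → C ⊑ B
  ⊑-lem {A} {C} {B} = ⊑-taut₂ λ v → go (eval v A) (eval v C) (eval v B)
    where
    go : ∀ a c b → (not (c ∧ a) ∨ b) ≡ true → (not (c ∧ not a) ∨ b) ≡ true → (not c ∨ b) ≡ true
    go a false b p q = refl
    go false true b p q = q
    go true true b p q = p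

  ⊑-curry : ∀ {A B C} → C ∧' A ⊑ B → C ⊑ (A ⇒ B)
  ⊑-curry {A} {B} {C} = ⊑-taut₁ λ v → go (eval v A) (eval v B) (eval v C)
    where
    go : ∀ a b c → (not (c ∧ a) ∨ b) ≡ true → (not c ∨ (not a ∨ b)) ≡ true
    go a b false p = refl
    go a b true p = p

  ∧-mono : ∀ {A A' B B'} → A ⊑ A' → B ⊑ B' → A ∧' B ⊑ A' ∧' B'
  ∧-mono p q = ∧-i (∧-l ⊙ p) (∧-r ⊙ q)

  ∧-comm : ∀ {A B} → A ∧' B ⊑ B ∧' A
  ∧-comm = ∧-i ∧-r ∧-l

  ∨-case : ∀ {A B C D} → C ⊑ A ∨' B → C ∧' A ⊑ D → C ∧' B ⊑ D → C ⊑ D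
  ∨-case {A} {B} {C} {D} p q r =
    ∧-i ⊑-refl p ⊙ (⊑-lem {A} (∧-i (∧-l ⊙ ∧-l) ∧-r ⊙ q)
      (∧-i (∧-l ⊙ ∧-l) ((∧-i (∧-l ⊙ ∧-r) ∧-r) ⊙ disj) ⊙ r))
    where
    disj : (A ∨' B) ∧' ¬' A ⊑ B
    disj = taut λ v → go (eval v A) (eval v B)
      where
      go : ∀ a b → (not ((a ∨ b) ∧ not a) ∨ b) ≡ true
      go false false = refl
      go false true = refl
      go true b = refl

  ◇-∨ : ∀ {k A B C} → A ⊑ B ∨' C → ◇ k A ⊑ ◇ k B ∨' ◇ k C
  ◇-∨ p = mono p ⊙ ax-K

  ◇-⊥ : ∀ {k A} → A ⊑ ⊥' → ◇ k A ⊑ ⊥'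
  ◇-⊥ p = mono (p ⊙ ⊥-e) ⊙ ⊢¬⇒⊑ ax-N

  -- Löb's axiom for `A ∨' ◇ k A` gives a witness that sees no further witness of this disjunction.
  -- Such a witness cannot satisfy `◇ k A`, so it satisfies `A`.
  ◇-trans : ∀ {k A} → ◇ k (◇ k A) ⊑ ◇ k A
  ◇-trans {k} {A} = mono ∨-r ⊙ ax-L ⊙ mono
    (∨-case {A} {◇ k A} ∧-l ∧-r (¬-e (∧-r ⊙ mono ∨-l) (∧-l ⊙ ∧-r)))

  ◇-absorb : ∀ {j k A} → j ≤ k → ◇ j (◇ k A) ⊑ ◇ j A
  ◇-absorb j≤k = mono (ax-M j≤k) ⊙ ◇-trans

  -- Satisfied by the Boolean combinations of formulas ◇ i A with i < k.
  record Stable (k : ℕ) (B : Fm) : Set where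
    constructor stable
    field
      up : ∀ {m} → k ≤ m → B ∧' ◇ m (¬' B) ⊑ ⊥'
      dn : ∀ {m} → k ≤ m → ◇ m B ⊑ B
  open Stable public

  stable-suc : ∀ {k B} → Stable k B → Stable (suc k) B
  stable-suc s = stable (λ le → up s (≤-trans (n≤1+n _) le)) (λ le → dn s (≤-trans (n≤1+n _) le))

  stable-¬ : ∀ {k B} → Stable k B → Stable k (¬' B)
  stable-¬ s = stable
    (λ le → ¬-e (∧-r ⊙ mono ¬¬-e ⊙ dn s le) ∧-l)
    (λ le → ¬-i (∧-comm ⊙ up s le))

  stable-⊤ : ∀ {k} → Stable k ⊤'
  stable-⊤ = stable (λ le → ∧-r ⊙ ⊢¬⇒⊑ ax-N) (λ le → ⊤-i)

  stable-∧ : ∀ {k A B} → Stable k A → Stable k B → Stable k (A ∧' B)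
  stable-∧ {k} {A} {B} s t = stable
    (λ {m} le → ∨-case {◇ m (¬' A)} {◇ m (¬' B)} (∧-r ⊙ ◇-∨ deM)
      (∧-i (∧-l ⊙ ∧-l ⊙ ∧-l) ∧-r ⊙ up s le) (∧-i (∧-l ⊙ ∧-l ⊙ ∧-r) ∧-r ⊙ up t le))
    (λ le → ∧-i (mono ∧-l ⊙ dn s le) (mono ∧-r ⊙ dn t le))
    where
    deM : ¬' (A ∧' B) ⊑ ¬' A ∨' ¬' B
    deM = taut λ v → go (eval v A) (eval v B)
      where
      go : ∀ a b → (not (not (a ∧ b)) ∨ (not a ∨ not b)) ≡ true
      go false b = refl
      go true false = refl
      go true true = refl

  stable-◇ : ∀ {i k A} → i < k → Stable k (◇ i A)
  stable-◇ i<k = stable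
    (λ le → ¬-e ∧-r (∧-l ⊙ ax-P (≤-trans i<k le)))
    (λ le → ax-M (≤-trans (<⇒≤ i<k) le) ⊙ ◇-trans)

  -- If `B` failed at the witness of `C`, then `◇ m (¬' B)` would hold and contradict the stability
  -- of `B`. Stable contexts thus pass under higher modalities.
  stable-in : ∀ {k m B C} → Stable k B → k ≤ m → B ∧' ◇ m C ⊑ ◇ m (B ∧' C)
  stable-in {k} {m} {B} {C} s le =
    ∨-case {◇ m (B ∧' C)} {◇ m (¬' B)} (∧-r ⊙ ◇-∨ split) ∧-r
      (∧-i (∧-l ⊙ ∧-l) ∧-r ⊙ up s le ⊙ ⊥-e)
    where
    split : C ⊑ (B ∧' C) ∨' ¬' B
    split = taut λ v → go (eval v B) (eval v C)
      where
      go : ∀ b c → (not c ∨ ((b ∧ c) ∨ not b)) ≡ true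
      go false false = refl
      go false true = refl
      go true false = refl
      go true true = refl

  -- A witness of `U` either refutes `◇ k U` already, or Löb's axiom gives a last witness further
  -- on, where `B` still holds by stability; `◇ j` absorbs the extra `◇ k`. This selects a least
  -- point without leaving the context.
  stable-löb : ∀ {j k B U} → Stable k B → j ≤ k → ◇ j (B ∧' U) ⊑ ◇ j (B ∧' (U ∧' ¬' ◇ k U))
  stable-löb {j} {k} {B} {U} s j≤k =
    ◇-∨ (⊑-lem {◇ k U}
          (∧-i (∧-l ⊙ ∧-l) (∧-r ⊙ ax-L) ⊙ stable-in s ≤-refl ⊙ ∨-r)
          (∧-i (∧-l ⊙ ∧-l) (∧-i (∧-l ⊙ ∧-r) ∧-r) ⊙ ∨-l))
    ⊙ ∨-e ⊑-refl (◇-absorb j≤k)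

-- Cantor normal forms below ε₀ and their well-foundedness.

module Ordinals where

  open import Induction.WellFounded using (Acc; acc)

  -- Sums of powers of ω with the first exponent first; NF selects the Cantor normal forms below ε₀.
  infixr 6 ω^_+_
  data Ord : Set where
    𝟎     : Ord
    ω^_+_ : Ord → Ord → Ord

  infix 4 _≺_ _≼_
  data _≺_ : Ord → Ord → Set where
    ≺-𝟎    : ∀ {x a} → 𝟎 ≺ ω^ x + a
    ≺-head : ∀ {x y a b} → x ≺ y → ω^ x + a ≺ ω^ y + b
    ≺-tail : ∀ {x a b} → a ≺ b → ω^ x + a ≺ ω^ x + b

  _≼_ : Ord → Ord → Set
  a ≼ b = a ≺ b ⊎ a ≡ b

  ≺-trans : ∀ {a b c} → a ≺ b → b ≺ c → a ≺ c
  ≺-trans ≺-𝟎 (≺-head q) = ≺-𝟎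
  ≺-trans ≺-𝟎 (≺-tail q) = ≺-𝟎
  ≺-trans (≺-head p) (≺-head q) = ≺-head (≺-trans p q)
  ≺-trans (≺-head p) (≺-tail q) = ≺-head p
  ≺-trans (≺-tail p) (≺-head q) = ≺-head q
  ≺-trans (≺-tail p) (≺-tail q) = ≺-tail (≺-trans p q)

  ≺-≼-trans : ∀ {a b c} → a ≺ b → b ≼ c → a ≺ c
  ≺-≼-trans p (inj₁ q) = ≺-trans p q
  ≺-≼-trans p (inj₂ refl) = p

  ≼-≺-trans : ∀ {a b c} → a ≼ b → b ≺ c → a ≺ c
  ≼-≺-trans (inj₁ p) q = ≺-trans p q
  ≼-≺-trans (inj₂ refl) q = q

  ≼-trans : ∀ {a b c} → a ≼ b → b ≼ c → a ≼ c
  ≼-trans (inj₁ p) q = inj₁ (≺-≼-trans p q)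
  ≼-trans (inj₂ refl) q = q

  ≼-or-≻ : ∀ a b → a ≼ b ⊎ b ≺ a
  ≼-or-≻ 𝟎 𝟎 = inj₁ (inj₂ refl)
  ≼-or-≻ 𝟎 (ω^ y + b) = inj₁ (inj₁ ≺-𝟎)
  ≼-or-≻ (ω^ x + a) 𝟎 = inj₂ ≺-𝟎
  ≼-or-≻ (ω^ x + a) (ω^ y + b) with ≼-or-≻ x y
  ... | inj₁ (inj₁ x≺y) = inj₁ (inj₁ (≺-head x≺y))
  ... | inj₂ y≺x = inj₂ (≺-head y≺x)
  ... | inj₁ (inj₂ refl) with ≼-or-≻ a b
  ...   | inj₁ (inj₁ a≺b) = inj₁ (inj₁ (≺-tail a≺b))
  ...   | inj₁ (inj₂ refl) = inj₁ (inj₂ refl)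
  ...   | inj₂ b≺a = inj₂ (≺-tail b≺a)

  𝟎≼ : ∀ {a} → 𝟎 ≼ a
  𝟎≼ {𝟎} = inj₂ refl
  𝟎≼ {ω^ _ + _} = inj₁ ≺-𝟎

  HeadBelow : (Ord → Set) → Ord → Set
  HeadBelow P 𝟎 = ⊤
  HeadBelow P (ω^ x + _) = P x

  data NF : Ord → Set where
    nf-𝟎 : NF 𝟎
    nf-ω : ∀ {x a} → NF x → NF a → HeadBelow (_≼ x) a → NF (ω^ x + a)

  -- Normal forms matter: in the raw order, prefixing the summand `ω^ 𝟎` to `ω^ (ω^ 𝟎 + 𝟎) + 𝟎`
  -- again and again descends forever.
  _≺ᴺ_ : Ord → Ord → Set
  a ≺ᴺ b = NF a × a ≺ b

  weaken-head : ∀ {x y} b → HeadBelow (_≼ y) b → y ≺ x → HeadBelow (_≺ x) b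
  weaken-head 𝟎 _ _ = tt
  weaken-head (ω^ z + b) z≼y y≺x = ≼-≺-trans z≼y y≺x

  -- In a normal form with head exponent below `x` all exponents are below `x`, so the hypothesis
  -- adds its summands one at a time, starting from `𝟎`.
  acc-below : ∀ {x} → (∀ {y a} → NF y → y ≺ x → Acc _≺ᴺ_ a → Acc _≺ᴺ_ (ω^ y + a)) →
    ∀ b → NF b → HeadBelow (_≺ x) b → Acc _≺ᴺ_ b
  acc-below ih 𝟎 _ _ = acc λ { (_ , ()) }
  acc-below ih (ω^ z + b) (nf-ω nz nb hb) z≺x = ih nz z≺x (acc-below ih b nb (weaken-head b hb z≺x))

  acc-tail : ∀ {x} → (∀ {y a} → NF y → y ≺ x → Acc _≺ᴺ_ a → Acc _≺ᴺ_ (ω^ y + a)) →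
    ∀ {a} → Acc _≺ᴺ_ a → Acc _≺ᴺ_ (ω^ x + a)
  acc-tail {x} ih {a} (acc ra) = acc smaller
    where
    smaller : ∀ {b} → b ≺ᴺ (ω^ x + a) → Acc _≺ᴺ_ b
    smaller (nf-𝟎 , _) = acc λ { (_ , ()) }
    smaller (nf-ω {a = b} ny nb hb , ≺-head y≺x) = ih ny y≺x (acc-below ih b nb (weaken-head b hb y≺x))
    smaller (nf-ω _ nb _ , ≺-tail b≺a) = acc-tail ih (ra (nb , b≺a))

  -- A nested induction, on the exponent outside and, for a fixed exponent, on the tail inside.
  acc-ω : ∀ {x} → Acc _≺ᴺ_ x → ∀ {a} → Acc _≺ᴺ_ a → Acc _≺ᴺ_ (ω^ x + a)
  acc-ω (acc rx) = acc-tail λ ny y≺x → acc-ω (rx (ny , y≺x))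

  ≺ᴺ-wf : ∀ {a} → NF a → Acc _≺ᴺ_ a
  ≺ᴺ-wf nf-𝟎 = acc λ { (_ , ()) }
  ≺ᴺ-wf (nf-ω nx na _) = acc-ω (≺ᴺ-wf nx) (≺ᴺ-wf na)

  ℓ : Ord → Ord
  ℓ 𝟎 = 𝟎
  ℓ (ω^ x + 𝟎) = x
  ℓ (ω^ x + a@(ω^ _ + _)) = ℓ a

  -- The least ordinal above a whose last exponent is at least x.
  nxt : Ord → Ord → Ord
  nxt 𝟎 x = ω^ x + 𝟎
  nxt (ω^ z + a) x with ≼-or-≻ x z
  ... | inj₁ _ = ω^ z + nxt a x
  ... | inj₂ _ = ω^ x + 𝟎

  ≺-nxt : ∀ a x → a ≺ nxt a x
  ≺-nxt 𝟎 x = ≺-𝟎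
  ≺-nxt (ω^ z + a) x with ≼-or-≻ x z
  ... | inj₁ _ = ≺-tail (≺-nxt a x)
  ... | inj₂ z≺x = ≺-head z≺x

  nxt-nf : ∀ {a x} → NF a → NF x → NF (nxt a x)
  nxt-nf nf-𝟎 nx = nf-ω nx nf-𝟎 tt
  nxt-nf {ω^ z + a} {x} (nf-ω nz na ha) nx with ≼-or-≻ x z
  ... | inj₁ x≼z = nf-ω nz (nxt-nf na nx) (head a ha)
    where
    head : ∀ a → HeadBelow (_≼ z) a → HeadBelow (_≼ z) (nxt a x)
    head 𝟎 _ = x≼z
    head (ω^ y + a) y≼z with ≼-or-≻ x y
    ... | inj₁ _ = y≼z
    ... | inj₂ _ = x≼z
  ... | inj₂ _ = nf-ω nx nf-𝟎 tt

  ℓ-nxt : ∀ a x → ℓ (nxt a x) ≡ x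
  ℓ-nxt 𝟎 x = refl
  ℓ-nxt (ω^ z + a) x with ≼-or-≻ x z
  ... | inj₂ _ = refl
  ... | inj₁ _ with nxt a x | ℓ-nxt a x | ≺-nxt a x
  ...   | ω^ _ + _ | eq | _ = eq
  ...   | 𝟎 | _ | ()

  ℓ≼head : ∀ {x a} → NF (ω^ x + a) → ℓ (ω^ x + a) ≼ x
  ℓ≼head {a = 𝟎} _ = inj₂ refl
  ℓ≼head {a = ω^ _ + _} (nf-ω _ na h) = ≼-trans (ℓ≼head na) h

  -- Every exponent of the normal form `b` is at least `ℓ b`, hence greater than `x`. So where `a`
  -- first falls below `b`, inserting a summand with exponent `x` still stays below `b`.
  nxt-≺ : ∀ {a b x} → NF b → a ≺ b → x ≺ ℓ b → nxt a x ≺ b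
  nxt-≺ nb ≺-𝟎 x≺ = ≺-head (≺-≼-trans x≺ (ℓ≼head nb))
  nxt-≺ {ω^ z + a} {x = x} nb (≺-head z≺y) x≺ with ≼-or-≻ x z
  ... | inj₁ _ = ≺-head z≺y
  ... | inj₂ _ = ≺-head (≺-≼-trans x≺ (ℓ≼head nb))
  nxt-≺ {ω^ z + a} {ω^ .z + b@(ω^ _ + _)} {x} (nf-ω nz nb h) (≺-tail a≺b) x≺ with ≼-or-≻ x z
  ... | inj₁ _ = ≺-tail (nxt-≺ nb a≺b x≺)
  ... | inj₂ _ = ≺-head (≺-≼-trans x≺ (ℓ≼head (nf-ω nz nb h)))

-- Soundness of GLP in Ignatiev's model and consistency of iterated diamonds.

module IgnatievModel where

  open import Defs hiding (L; R)
  open Calculus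
  open Ordinals
  open import Data.Nat using (ℕ; zero; suc; _+_; _≤_; _<_; s≤s; _≟_)
  open import Data.Nat.Properties using (≤-refl; ≤-reflexive; ≤-trans; <⇒≤; m≤n⇒m<n∨m≡n; <-cmp; <⇒≢; m≤n⇒m≤1+n)
  open import Relation.Binary using (tri<; tri≈; tri>)
  open import Data.List using (List; []; _∷_; _++_)
  open import Induction.WellFounded using (Acc; acc)
  open import Relation.Nullary using (¬_; Dec; yes; no)

  -- Worlds of Ignatiev's model.
  record Valid (x : ℕ → Ord) : Set where
    constructor valid
    field
      nf   : ∀ i → NF (x i)
      desc : ∀ i → x (suc i) ≼ ℓ (x i)
  open Valid

  Sees : ℕ → (x y : ℕ → Ord) → Set
  Sees k x y = (∀ {i} → i < k → y i ≡ x i) × y k ≺ x k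

  -- ◇ and ∨ are read classically through double negation.
  infix 4 _⊩_
  _⊩_ : (ℕ → Ord) → Fm → Set
  x ⊩ var i  = ⊤
  x ⊩ ⊤'     = ⊤
  x ⊩ ⊥'     = ⊥
  x ⊩ A ∧' B = x ⊩ A × x ⊩ B
  x ⊩ A ∨' B = ¬ (¬ x ⊩ A × ¬ x ⊩ B)
  x ⊩ A ⇒ B  = x ⊩ A → x ⊩ B
  x ⊩ ¬' A   = ¬ x ⊩ A
  x ⊩ ◇ k A  = ¬ (∀ y → Valid y → Sees k x y → ¬ y ⊩ A)

  ⊩-stable : ∀ {x} A → ¬ ¬ x ⊩ A → x ⊩ A
  ⊩-stable (var i)  h = tt
  ⊩-stable ⊤'       h = tt
  ⊩-stable ⊥'       h = h λ ()
  ⊩-stable (A ∧' B) h = ⊩-stable A (λ n → h λ p → n (proj₁ p)) , ⊩-stable B (λ n → h λ p → n (proj₂ p))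
  ⊩-stable (A ∨' B) h = λ p → h λ n → n p
  ⊩-stable (A ⇒ B)  h = λ a → ⊩-stable B (λ n → h λ f → n (f a))
  ⊩-stable (¬' A)   h = λ a → h λ n → n a
  ⊩-stable (◇ k A)  h = λ p → h λ n → n p

  -- Comparing tags first leaves only the diagonal cases of the equality test, instead of one case
  -- for each pair of constructors.
  tag : Fm → ℕ
  tag (var i)  = 0
  tag ⊤'       = 1
  tag ⊥'       = 2
  tag (A ∧' B) = 3
  tag (A ∨' B) = 4
  tag (A ⇒ B)  = 5
  tag (¬' A)   = 6
  tag (◇ k A)  = 7

  infix 4 _≟ᶠ_
  _≟ᶠ_ : (A B : Fm) → Dec (A ≡ B)
  ≟-tag : (A B : Fm) → tag A ≡ tag B → Dec (A ≡ B)
  A ≟ᶠ B with tag A ≟ tag B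
  ... | yes p = ≟-tag A B p
  ... | no n  = no λ { refl → n refl }
  ≟-tag (var i) (var j) refl with i ≟ j
  ... | yes refl = yes refl
  ... | no n = no λ { refl → n refl }
  ≟-tag ⊤' ⊤' refl = yes refl
  ≟-tag ⊥' ⊥' refl = yes refl
  ≟-tag (A ∧' B) (C ∧' D) refl with A ≟ᶠ C | B ≟ᶠ D
  ... | yes refl | yes refl = yes refl
  ... | no n | _ = no λ { refl → n refl }
  ... | _ | no n = no λ { refl → n refl }
  ≟-tag (A ∨' B) (C ∨' D) refl with A ≟ᶠ C | B ≟ᶠ D
  ... | yes refl | yes refl = yes refl
  ... | no n | _ = no λ { refl → n refl }
  ... | _ | no n = no λ { refl → n refl }
  ≟-tag (A ⇒ B) (C ⇒ D) refl with A ≟ᶠ C | B ≟ᶠ D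
  ... | yes refl | yes refl = yes refl
  ... | no n | _ = no λ { refl → n refl }
  ... | _ | no n = no λ { refl → n refl }
  ≟-tag (¬' A) (¬' B) refl with A ≟ᶠ B
  ... | yes refl = yes refl
  ... | no n = no λ { refl → n refl }
  ≟-tag (◇ i A) (◇ j B) refl with i ≟ j | A ≟ᶠ B
  ... | yes refl | yes refl = yes refl
  ... | no n | _ = no λ { refl → n refl }
  ... | _ | no n = no λ { refl → n refl }

  Reflects : (ℕ → Ord) → (Fm → Bool) → Fm → Set
  Reflects x v A = (v A ≡ true → x ⊩ A) × (v A ≡ false → ¬ x ⊩ A)

  atoms : Fm → List Fm
  atoms (var i)  = var i ∷ []
  atoms ⊤'       = []
  atoms ⊥'       = []
  atoms (A ∧' B) = atoms A ++ atoms B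
  atoms (A ∨' B) = atoms A ++ atoms B
  atoms (A ⇒ B)  = atoms A ++ atoms B
  atoms (¬' A)   = atoms A
  atoms (◇ k A)  = ◇ k A ∷ []

  -- `Taut` speaks of Boolean valuations, while forcing is not decidable. For the finitely many
  -- atoms of one formula it can be decided under a double negation, which `⊩-stable` removes
  -- afterwards.
  valuation-exists : ∀ x L → ¬ ¬ (∃[ v ] (∀ {A} → A ∈ L → Reflects x v A))
  valuation-exists x [] h = h ((λ _ → true) , λ ())
  valuation-exists x (A ∷ L) h = valuation-exists x L λ (v , r) →
    no-dec (λ a → h (upd v true , λ {B} m → upd-reflects v true ((λ _ → a) , λ ()) r B m))
           (λ n → h (upd v false , λ {B} m → upd-reflects v false ((λ ()) , λ _ → n) r B m))
    where
    no-dec : ¬ x ⊩ A → ¬ ¬ x ⊩ A → ⊥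
    no-dec p q = q p
    upd : (Fm → Bool) → Bool → Fm → Bool
    upd v b B with A ≟ᶠ B
    ... | yes _ = b
    ... | no _  = v B
    upd-reflects : ∀ v b → (b ≡ true → x ⊩ A) × (b ≡ false → ¬ x ⊩ A) →
      (∀ {B} → B ∈ L → Reflects x v B) → ∀ B → B ∈ A ∷ L → Reflects x (upd v b) B
    upd-reflects v b ok r B m with A ≟ᶠ B
    ... | yes refl = ok
    upd-reflects v b ok r B (here refl) | no n = ⊥-elim (n refl)
    upd-reflects v b ok r B (there m)   | no n = r m

  eval-reflects : ∀ {x} v A → (∀ {B} → B ∈ atoms A → Reflects x v B) →
    (eval v A ≡ true → x ⊩ A) × (eval v A ≡ false → ¬ x ⊩ A)
  eval-reflects v (var i) r = r (here refl)
  eval-reflects v ⊤' r = (λ _ → tt) , λ ()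
  eval-reflects v ⊥' r = (λ ()) , λ _ ()
  eval-reflects v (A ∧' B) r with eval v A | eval v B
    | eval-reflects v A (λ m → r (∈-++⁺ˡ m)) | eval-reflects v B (λ m → r (∈-++⁺ʳ (atoms A) m))
  ... | true  | true  | a , _ | b , _ = (λ _ → a refl , b refl) , λ ()
  ... | true  | false | _ | _ , b = (λ ()) , λ _ p → b refl (proj₂ p)
  ... | false | _     | _ , a | _ = (λ ()) , λ _ p → a refl (proj₁ p)
  eval-reflects v (A ∨' B) r with eval v A | eval v B
    | eval-reflects v A (λ m → r (∈-++⁺ˡ m)) | eval-reflects v B (λ m → r (∈-++⁺ʳ (atoms A) m))
  ... | true  | _     | a , _ | _ = (λ _ p → proj₁ p (a refl)) , λ ()
  ... | false | true  | _ | b , _ = (λ _ p → proj₂ p (b refl)) , λ ()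
  ... | false | false | _ , a | _ , b = (λ ()) , λ _ p → p (a refl , b refl)
  eval-reflects v (A ⇒ B) r with eval v A | eval v B
    | eval-reflects v A (λ m → r (∈-++⁺ˡ m)) | eval-reflects v B (λ m → r (∈-++⁺ʳ (atoms A) m))
  ... | false | _     | _ , a | _ = (λ _ p → ⊥-elim (a refl p)) , λ ()
  ... | true  | true  | _ | b , _ = (λ _ _ → b refl) , λ ()
  ... | true  | false | a , _ | _ , b = (λ ()) , λ _ f → b refl (f (a refl))
  eval-reflects v (¬' A) r with eval v A | eval-reflects v A r
  ... | true  | a , _ = (λ ()) , λ _ n → n (a refl)
  ... | false | _ , a = (λ _ → a refl) , λ ()
  eval-reflects v (◇ k A) r = r (here refl)

  ⊩-taut : ∀ {x A} → Taut A → x ⊩ A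
  ⊩-taut {x} {A} t = ⊩-stable A λ n → valuation-exists x (atoms A) λ (v , r) →
    n (proj₁ (eval-reflects v A r) (t v))

  infixl 9 _[_↦_]
  _[_↦_] : (ℕ → Ord) → ℕ → Ord → ℕ → Ord
  (x [ k ↦ γ ]) i with i ≟ k
  ... | yes _ = γ
  ... | no _  = x i

  upd-at : ∀ x k γ → (x [ k ↦ γ ]) k ≡ γ
  upd-at x k γ with k ≟ k
  ... | yes _ = refl
  ... | no n  = ⊥-elim (n refl)

  upd-other : ∀ x k γ {i} → i ≢ k → (x [ k ↦ γ ]) i ≡ x i
  upd-other x k γ {i} i≢k with i ≟ k
  ... | yes p = ⊥-elim (i≢k p)
  ... | no _  = refl

  upd-valid : ∀ {x k γ} → Valid x → NF γ → (∀ {i} → suc i ≡ k → γ ≼ ℓ (x i)) → x (suc k) ≼ ℓ γ →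
    Valid (x [ k ↦ γ ])
  upd-valid {x} {k} {γ} vx nγ γ≼ ≼γ = valid nf' desc'
    where
    nf' : ∀ i → NF ((x [ k ↦ γ ]) i)
    nf' i with i ≟ k
    ... | yes _ = nγ
    ... | no _  = nf vx i
    desc' : ∀ i → (x [ k ↦ γ ]) (suc i) ≼ ℓ ((x [ k ↦ γ ]) i)
    desc' i with suc i ≟ k | i ≟ k
    ... | yes refl | yes ()
    ... | yes e | no _ = γ≼ e
    ... | no _ | yes refl = ≼γ
    ... | no _ | no _ = desc vx i

  record Near (k : ℕ) (o α : Ord) (x y : ℕ → Ord) : Set where
    field
      val   : Valid y
      below : ∀ {i} → i < k → y i ≡ x i
      low   : o ≺ y k
      high  : y k ≼ α
  open Near

  SameTail : ℕ → (y z : ℕ → Ord) → Set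
  SameTail k y z = ∀ {i} → k < i → y i ≡ z i

  near-mono : ∀ {k o o' α x y} → o' ≼ o → Near k o α x y → Near k o' α x y
  near-mono le n = record { val = val n ; below = below n ; low = ≼-≺-trans le (low n) ; high = high n }

  -- Near worlds agree with `x` before `k`, so `y` and `z` differ at coordinate `k` alone.
  ⊩-Inv : (k : ℕ) (x : ℕ → Ord) (o : Ord) → Fm → Set
  ⊩-Inv k x o A = ∀ y z → Near k o (x k) x y → Near k o (x k) x z → SameTail k y z → y ⊩ A → z ⊩ A

  ⊩-inv-mono : ∀ {k x o o' A} → o' ≼ o → ⊩-Inv k x o' A → ⊩-Inv k x o A
  ⊩-inv-mono le i y z ny nz = i y z (near-mono le ny) (near-mono le nz)

  same-sym : ∀ {k y z} → SameTail k y z → SameTail k z y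
  same-sym s lt = sym (s lt)

  Stabilises : (k : ℕ) (x : ℕ → Ord) → Fm → Set
  Stabilises k x A = ∃[ o ] (NF o × o ≺ x k × ⊩-Inv k x o A)

  join : ∀ {k x A B C} → (∀ {o} → ⊩-Inv k x o A → ⊩-Inv k x o B → ⊩-Inv k x o C) →
    Stabilises k x A → Stabilises k x B → Stabilises k x C
  join {A = A} {B} f (o , n , lt , i) (o' , n' , lt' , i') with ≼-or-≻ o o'
  ... | inj₁ le = o' , n' , lt' , f (⊩-inv-mono {A = A} le i) i'
  ... | inj₂ gt = o , n , lt , f i (⊩-inv-mono {A = B} (inj₁ gt) i')

  -- Ignatiev's frame validates ◇ (suc k) A ⇒ ◇ k A, not for arbitrary valuations, but because truth of closed
  -- formulas is locally constant immediately below a nonzero coordinate k.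
  ⊩-locally-constant : ∀ k x A → 𝟎 ≺ x k → ¬ ¬ Stabilises k x A
  ⊩-locally-constant k x (var i) pos h = h (𝟎 , nf-𝟎 , pos , λ _ _ _ _ _ p → p)
  ⊩-locally-constant k x ⊤' pos h = h (𝟎 , nf-𝟎 , pos , λ _ _ _ _ _ p → p)
  ⊩-locally-constant k x ⊥' pos h = h (𝟎 , nf-𝟎 , pos , λ _ _ _ _ _ p → p)
  ⊩-locally-constant k x (A ∧' B) pos h =
    ⊩-locally-constant k x A pos λ a → ⊩-locally-constant k x B pos λ b →
    h (join {A = A} {B} {A ∧' B}
      (λ f g y z ny nz s (p , q) → f y z ny nz s p , g y z ny nz s q) a b)
  ⊩-locally-constant k x (A ∨' B) pos h =
    ⊩-locally-constant k x A pos λ a → ⊩-locally-constant k x B pos λ b →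
    h (join {A = A} {B} {A ∨' B}
      (λ f g y z ny nz s p (m , n) → p ((λ a → m (f y z ny nz s a)) , λ b → n (g y z ny nz s b))) a b)
  ⊩-locally-constant k x (A ⇒ B) pos h =
    ⊩-locally-constant k x A pos λ a → ⊩-locally-constant k x B pos λ b →
    h (join {A = A} {B} {A ⇒ B}
      (λ f g y z ny nz s p a → g y z ny nz s (p (f z y nz ny (same-sym s) a))) a b)
  ⊩-locally-constant k x (¬' A) pos h =
    ⊩-locally-constant k x A pos λ (o , on , lt , f) →
    h (o , on , lt , λ y z ny nz s n a → n (f z y nz ny (same-sym s) a))
  ⊩-locally-constant k x (◇ j A) pos h with <-cmp j k
  -- Such a diamond looks only at coordinates before `k`, which all near worlds share.
  ... | tri< j<k _ _ = h (𝟎 , nf-𝟎 , pos , λ y z ny nz s n f → n λ w vw (ag , lt) → f w vw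
          ( (λ i<j → let i<k = ≤-trans i<j (<⇒≤ j<k) in trans (ag i<j) (trans (below ny i<k) (sym (below nz i<k))))
          , subst (w j ≺_) (trans (below ny j<k) (sym (below nz j<k))) lt))
  -- If `◇ k A` holds at `x`, coordinate `k` of a witness serves as the bound, and every near world
  -- sees this witness. Otherwise no near world sees one, since `x` would see it too.
  ... | tri≈ _ refl _ = em
    (λ t → t λ w vw (ag , lt) u → h (w k , nf vw k , lt , λ y z ny nz s _ f →
        f w vw ((λ i<k → trans (ag i<k) (sym (below nz i<k))) , low nz) u))
    (λ n → h (𝟎 , nf-𝟎 , pos , λ y z ny nz s t f → t λ w vw (ag , lt) u → n λ g →
        g w vw ((λ i<k → trans (ag i<k) (below ny i<k)) , ≺-≼-trans lt (high ny)) u))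
    where
    em : ¬ (x ⊩ ◇ k A) → ¬ ¬ (x ⊩ ◇ k A) → ⊥
    em a b = b a
  -- A witness seen by `y` has coordinate `k` in common with `y`. Resetting it to that of `z` gives
  -- another near world, so the invariance of `A` makes it a witness for `z`.
  ... | tri> _ _ k<j = ⊩-locally-constant k x A pos λ (o , on , lt , f) →
    h (o , on , lt , λ y z ny nz s t g → t λ w vw (ag , w≺) u →
      let w' = w [ k ↦ z k ]
          wk : w k ≡ y k
          wk = ag k<j
          nw : Near k o (x k) x w
          nw = record { val = vw ; below = λ i<k → trans (ag (≤-trans i<k (<⇒≤ k<j))) (below ny i<k)
                      ; low = subst (o ≺_) (sym wk) (low ny) ; high = subst (_≼ x k) (sym wk) (high ny) }
          vw' : Valid w'
          vw' = upd-valid vw (nf (val nz) k)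
            (λ {i} e → subst (λ a → z k ≼ ℓ a)
              (trans (below nz (≤-reflexive e)) (sym (below nw (≤-reflexive e))))
              (subst (λ l → z l ≼ ℓ (z i)) e (desc (val nz) i)))
            (next-ok w y z k<j ag w≺ nz s)
          nw' : Near k o (x k) x w'
          nw' = record { val = vw'
                       ; below = λ i<k → trans (upd-other w k (z k) (<⇒≢ i<k)) (below nw i<k)
                       ; low = subst (o ≺_) (sym (upd-at w k (z k))) (low nz)
                       ; high = subst (_≼ x k) (sym (upd-at w k (z k))) (high nz) }
          st : SameTail k w w'
          st k<i = sym (upd-other w k (z k) (λ e → <⇒≢ k<i (sym e)))
      in g w' vw' ((λ {i} i<j → agree w y z i i<j ny nz ag s) ,
           subst (_≺ z j) (st k<j) (subst (w j ≺_) (s k<j) w≺)) (f w w' nw nw' st u))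
    where
    -- If `j` lies beyond `suc k`, the coordinate in question is that of `z`; if `j` equals `suc k`,
    -- it is even smaller.
    next-ok : ∀ w y z → k < j → (∀ {i} → i < j → w i ≡ y i) → w j ≺ y j → ∀ {o} → Near k o (x k) x z →
      SameTail k y z → w (suc k) ≼ ℓ (z k)
    next-ok w y z k<j ag w≺ nz s with m≤n⇒m<n∨m≡n k<j
    ... | inj₁ lt = subst (_≼ ℓ (z k)) (sym (trans (ag lt) (s ≤-refl))) (desc (val nz) k)
    ... | inj₂ refl = inj₁ (≺-≼-trans w≺ (subst (_≼ ℓ (z k)) (sym (s ≤-refl)) (desc (val nz) k)))
    agree : ∀ w y z i → i < j → ∀ {o} → Near k o (x k) x y → Near k o (x k) x z →
      (∀ {i} → i < j → w i ≡ y i) → SameTail k y z → (w [ k ↦ z k ]) i ≡ z i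
    agree w y z i i<j ny nz ag s with <-cmp i k
    ... | tri< i<k _ _ = trans (upd-other w k (z k) (<⇒≢ i<k)) (trans (ag i<j) (trans (below ny i<k) (sym (below nz i<k))))
    ... | tri≈ _ refl _ = upd-at w k (z k)
    ... | tri> _ _ k<i = trans (upd-other w k (z k) (λ e → <⇒≢ k<i (sym e))) (trans (ag i<j) (s k<i))

  Sees-trans : ∀ {k x y z} → Sees k x y → Sees k y z → Sees k x z
  Sees-trans {z = z} (a , p) (b , q) = (λ lt → trans (b lt) (a lt)) , ≺-trans q p

  ⊩-löb : ∀ {k x A} → x ⊩ (◇ k A ⇒ ◇ k (A ∧' ¬' ◇ k A))
  ⊩-löb {k} {x} {A} t n = t λ y vy r a → go y vy r a (≺ᴺ-wf (nf vy k))
    where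
    go : ∀ y → Valid y → Sees k x y → y ⊩ A → Acc _≺ᴺ_ (y k) → ⊥
    go y vy r a (acc rs) = n y vy r (a , λ d → d λ z vz r' a' →
      go z vz (Sees-trans r r') a' (rs (nf vz k , proj₂ r')))

  -- A world `y` seen at `suc k` has coordinate `suc k` strictly below the last exponent of
  -- coordinate `k`. Hence coordinate `k` can be lowered to `nxt o (y (suc k))`, whose last exponent
  -- just admits the next coordinate, while staying above the bound `o` from which `A` is constant.
  ⊩-lower : ∀ {k x A} → Valid x → x ⊩ (◇ (suc k) A ⇒ ◇ k A)
  ⊩-lower {k} {x} {A} vx t n = t λ y vy (ag , lt) a →
    let y<ℓ = subst (λ b → y (suc k) ≺ ℓ b) (sym (ag ≤-refl)) (≺-≼-trans lt (desc vx k))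
    in ⊩-locally-constant k y A (positive (y k) y<ℓ) λ (o , on , o≺ , inv) →
    let γ   = nxt o (y (suc k))
        z   = y [ k ↦ γ ]
        γ≺  = nxt-≺ (nf vy k) o≺ y<ℓ
        zk  = upd-at y k γ
        vz  = upd-valid vy (nxt-nf on (nf vy (suc k)))
                (λ {i} e → inj₁ (≺-≼-trans γ≺ (subst (λ l → y l ≼ ℓ (y i)) e (desc vy i))))
                (inj₂ (sym (ℓ-nxt o (y (suc k)))))
        ny  = record { val = vy ; below = λ _ → refl ; low = o≺ ; high = inj₂ refl }
        nz  = record { val = vz ; below = λ i<k → upd-other y k γ (<⇒≢ i<k)
                     ; low = subst (o ≺_) (sym zk) (≺-nxt o (y (suc k)))
                     ; high = inj₁ (subst (_≺ y k) (sym zk) γ≺) }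
    in n z vz
         ( (λ i<k → trans (upd-other y k γ (<⇒≢ i<k)) (ag (m≤n⇒m≤1+n i<k)))
         , subst (_≺ x k) (sym zk) (subst (γ ≺_) (ag ≤-refl) γ≺))
         (inv y z ny nz (λ k<i → sym (upd-other y k γ (λ e → <⇒≢ k<i (sym e)))) a)
    where
    positive : ∀ {b} a → b ≺ ℓ a → 𝟎 ≺ a
    positive 𝟎 ()
    positive (ω^ _ + _) _ = ≺-𝟎

  ⊩-monotone : ∀ {k m x A} → Valid x → k ≤ m → x ⊩ (◇ m A ⇒ ◇ k A)
  ⊩-monotone {m = m} vx k≤m with m≤n⇒m<n∨m≡n k≤m
  ... | inj₂ refl = λ t → t
  ⊩-monotone {m = suc m} vx k≤m | inj₁ (s≤s k≤m') = λ t → ⊩-monotone vx k≤m' (⊩-lower vx t)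

  -- Forcing makes every variable true, so a derivation is read with `⊤'` substituted for its
  -- variables. This covers derivations of closed formulas that pass through formulas with
  -- variables.
  sound : ∀ {A} → GLP⊢ A → ∀ x → Valid x → x ⊩ A
  sound (taut t) x vx = ⊩-taut t
  sound ax-K x vx = λ t (n , m) → n λ f → m λ g → t λ y vy r a →
    a ((λ p → f y vy r p) , λ q → g y vy r q)
  sound ax-N x vx = λ t → t λ y vy r n → n tt
  sound ax-L x vx = ⊩-löb
  sound (ax-M le) x vx = ⊩-monotone vx le
  sound (ax-P {k} {m} k<m) x vx = λ t d → d λ y vy (ag , _) n → t λ z vz (ag' , lt) a → n λ f →
    f z vz ((λ i<k → trans (ag' i<k) (sym (ag (≤-trans i<k (<⇒≤ k<m))))) , subst (z k ≺_) (sym (ag k<m)) lt) a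
  sound (mp d e) x vx = sound e x vx (sound d x vx)
  sound (mono d) x vx = λ t n → t λ y vy r a → n y vy r (sound d y vy a)

  ◇^ : ℕ → ℕ → Fm
  ◇^ m zero    = ⊤'
  ◇^ m (suc N) = ◇ m (◇^ m N)

  fin : ℕ → Ord
  fin zero    = 𝟎
  fin (suc N) = ω^ 𝟎 + fin N

  -- Before coordinate `m` each entry is ω to the power of the next entry, which makes `fin N`
  -- admissible at `m`; beyond `m` all entries vanish.
  tower : ℕ → ℕ → ℕ → Ord
  tower zero    N zero    = fin N
  tower zero    N (suc i) = 𝟎
  tower (suc m) N zero    = ω^ tower m N zero + 𝟎
  tower (suc m) N (suc i) = tower m N i

  fin-nf : ∀ N → NF (fin N)
  fin-nf zero = nf-𝟎
  fin-nf (suc N) = nf-ω nf-𝟎 (fin-nf N) (head N)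
    where
    head : ∀ N → HeadBelow (_≼ 𝟎) (fin N)
    head zero = tt
    head (suc N) = inj₂ refl

  tower-nf : ∀ m N i → NF (tower m N i)
  tower-nf zero N zero = fin-nf N
  tower-nf zero N (suc i) = nf-𝟎
  tower-nf (suc m) N zero = nf-ω (tower-nf m N zero) nf-𝟎 tt
  tower-nf (suc m) N (suc i) = tower-nf m N i

  tower-valid : ∀ m N → Valid (tower m N)
  tower-valid m N = valid (tower-nf m N) (desc' m)
    where
    desc' : ∀ m i → tower m N (suc i) ≼ ℓ (tower m N i)
    desc' zero zero = 𝟎≼
    desc' zero (suc i) = inj₂ refl
    desc' (suc m) zero = inj₂ refl
    desc' (suc m) (suc i) = desc' m i

  fin-≺ : ∀ N → fin N ≺ fin (suc N)
  fin-≺ zero = ≺-𝟎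
  fin-≺ (suc N) = ≺-tail (fin-≺ N)

  ℓ-fin : ∀ N → ℓ (fin N) ≡ 𝟎
  ℓ-fin zero = refl
  ℓ-fin (suc zero) = refl
  ℓ-fin (suc (suc N)) = ℓ-fin (suc N)

  -- A nonzero finite ordinal has last exponent `𝟎` and so forces the next coordinate to be `𝟎`;
  -- therefore lowering the finite coordinate by one keeps the world valid.
  ⊩-◇^ : ∀ {m} N {x} → Valid x → x m ≡ fin N → x ⊩ ◇^ m N
  ⊩-◇^ zero vx e = tt
  ⊩-◇^ {m} (suc N) {x} vx e n = n (x [ m ↦ fin N ]) vy
    ( (λ i<m → upd-other x m (fin N) (<⇒≢ i<m))
    , subst (_≺ x m) (sym (upd-at x m (fin N))) (subst (fin N ≺_) (sym e) (fin-≺ N)))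
    (⊩-◇^ N vy (upd-at x m (fin N)))
    where
    zero-next : x (suc m) ≼ 𝟎
    zero-next = subst (x (suc m) ≼_) (trans (cong ℓ e) (ℓ-fin (suc N))) (desc vx m)
    vy : Valid (x [ m ↦ fin N ])
    vy = upd-valid vx (fin-nf N)
      (λ {i} eq → inj₁ (≺-≼-trans (subst (fin N ≺_) (sym e) (fin-≺ N))
                         (subst (λ l → x l ≼ ℓ (x i)) eq (desc vx i))))
      (≼-trans zero-next 𝟎≼)

  tower-at : ∀ m N → tower m N m ≡ fin N
  tower-at zero N = refl
  tower-at (suc m) N = tower-at m N

  ◇^-consistent : ∀ m N → ¬ GLP⊢ (¬' ◇^ m N)
  ◇^-consistent m N d = sound d (tower m N) (tower-valid m N) (⊩-◇^ N (tower-valid m N) (tower-at m N))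

-- Comparison of thresholds and the decision algorithm.

module Thresholds where

  open import Defs hiding (L; R)
  open Calculus
  open IgnatievModel using (◇^; ◇^-consistent)
  open import Data.Nat using (ℕ; zero; suc; _+_; _≤_; s≤s)
  open import Data.Nat.Properties using (≤-refl; ≤-trans; n≤1+n; m≤m+n; m≤n+m; +-suc; +-monoˡ-≤; ≤-reflexive)
  open import Relation.Nullary using (¬_)

  -- Ordinal thresholds: w ⊹ x is the least ordinal above w whose last exponent is at least x;
  -- leaf stands for "no lower bound".
  infixl 6 _⊹_
  data T : Set where
    leaf : T
    _⊹_  : T → T → T

  -- If `x` is at most `y`, the ordinal `p ⊹ y` has a sufficient last exponent, so it reaches
  -- `o ⊹ x` exactly when it exceeds `o`. Otherwise `o ⊹ x`, once above `p`, is strictly above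
  -- `p ⊹ y`, so it must already be at most `p`.
  le : T → T → Bool
  le leaf _ = true
  le (o ⊹ x) leaf = false
  le (o ⊹ x) (p ⊹ y) = if le x y then not (le (p ⊹ y) o) else le (o ⊹ x) p

  -- φ k W says that coordinate k is at least W, and ψ k W that it is greater than W.
  φ ψ : ℕ → T → Fm
  φ k leaf = ⊤'
  φ k (o ⊹ x) = ψ k o ∧' φ (suc k) x
  ψ k leaf = ⊤'
  ψ k (o ⊹ x) = ◇ k (ψ k o ∧' φ (suc k) x)

  -- At positive height `leaf` occurs only as the start of a sum, so a threshold of that height is a
  -- genuine bound and its `ψ` is a diamond.
  data Ht : ℕ → T → Set where
    nil  : Ht 0 leaf
    one  : ∀ {h x} → Ht h x → Ht (suc h) (leaf ⊹ x)
    more : ∀ {h o x} → Ht (suc h) o → Ht h x → Ht (suc h) (o ⊹ x)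

  ψ-◇ : ∀ {h k W} → Ht (suc h) W → ψ k W ≡ ◇ k (φ k W)
  ψ-◇ (one _) = refl
  ψ-◇ (more _ _) = refl

  ◇-∨◇ : ∀ {k A B} → A ⊑ B ∨' ◇ k B → ◇ k A ⊑ ◇ k B
  ◇-∨◇ p = ◇-∨ p ⊙ ∨-e ⊑-refl ◇-trans

  -- Unless `o` is `leaf`, `ψ k o` is a `◇ k` formula, hence passes under `◇ (suc k)`, which is then
  -- lowered to `◇ k`.
  ◇-in : ∀ {k A B o} → A ⊑ ψ k o → A ⊑ ◇ (suc k) B → A ⊑ ◇ k (ψ k o ∧' B)
  ◇-in {k} {A} {B} {leaf} p q = q ⊙ ax-M (n≤1+n k) ⊙ mono (∧-i ⊤-i ⊑-refl)
  ◇-in {k} {A} {B} {o ⊹ x} p q =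
    ∧-i p q ⊙ stable-in (stable-◇ ≤-refl) ≤-refl ⊙ ax-M (n≤1+n k)

  -- `φ k U` is not upward closed, because it also bounds coordinate `suc k` from below; the second
  -- disjunct covers the points beyond `U`. Both derivations follow the recursion of `le`, and each
  -- swap of its arguments passes from one to the other.
  le-true  : ∀ {h} k U W → Ht h U → Ht h W → le U W ≡ true  → φ k W ⊑ φ k U ∨' ◇ k (φ k U)
  le-false : ∀ {h} k U W → Ht h U → Ht h W → le U W ≡ false → φ k U ⊑ ◇ k (φ k W)
  ht-exp : ∀ {h o x} → Ht (suc h) (o ⊹ x) → Ht h x
  ht-exp (one h) = h
  ht-exp (more _ h) = h

  not-true : ∀ {b} → not b ≡ true → b ≡ false
  not-true {false} _ = refl

  not-false : ∀ {b} → not b ≡ false → b ≡ true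
  not-false {true} _ = refl

  ⊹-above : ∀ {k o x A} → A ⊑ ψ k o → A ⊑ φ (suc k) x ∨' ◇ (suc k) (φ (suc k) x) →
    A ⊑ φ k (o ⊹ x) ∨' ◇ k (φ k (o ⊹ x))
  ⊹-above {o = o} p q = ∨-case q (∧-i (∧-l ⊙ p) ∧-r ⊙ ∨-l) (◇-in {o = o} (∧-l ⊙ p) ∧-r ⊙ ∨-r)

  le-true k leaf W hU hW _ = ⊤-i ⊙ ∨-l
  le-true k (o ⊹ x) leaf (one _) ()
  le-true k (o ⊹ x) (p ⊹ y) hU hW eq with le x y in exy
  le-true k (leaf ⊹ x) (p ⊹ y) hU@(one hx) hW eq | true =
    ⊹-above {o = leaf} ⊤-i (∧-r ⊙ le-true (suc k) x y hx (ht-exp hW) exy)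
  le-true k (o@(_ ⊹ _) ⊹ x) (p ⊹ y) hU@(more ho hx) hW eq | true =
    ⊹-above {o = o} (le-false k (p ⊹ y) o hW ho (not-true eq)) (∧-r ⊙ le-true (suc k) x y hx (ht-exp hW) exy)
  le-true k (o ⊹ x) (p@(_ ⊹ _) ⊹ y) hU (more hp _) eq | false =
    ∧-l ⊙ ◇-∨◇ (le-true k (o ⊹ x) p hU hp eq) ⊙ ∨-r
  le-false k (o ⊹ x) leaf (one _) ()
  le-false k (o ⊹ x) (p ⊹ y) hU hW eq with le x y in exy
  le-false k (o@(_ ⊹ _) ⊹ x) (p ⊹ y) (more ho _) hW eq | true =
    ∧-l ⊙ ◇-∨◇ (le-true k (p ⊹ y) o hW ho (not-false eq))
  le-false k (o ⊹ x) (leaf ⊹ y) hU (one hy) eq | false =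
    ◇-in {o = leaf} ⊤-i (∧-r ⊙ le-false (suc k) x y (ht-exp hU) hy exy)
  le-false k (o ⊹ x) (p@(_ ⊹ _) ⊹ y) hU (more hp hy) eq | false =
    ◇-in {o = p} (le-false k (o ⊹ x) p hU hp eq) (∧-r ⊙ le-false (suc k) x y (ht-exp hU) hy exy)

  size : T → ℕ
  size leaf = 0
  size (o ⊹ x) = suc (size o + size x)

  -- Each `⊹` costs at most one diamond and leads at most one coordinate further, so `size W` limits
  -- both the number of iterations and the modality needed.
  ◇^-⊑φ : ∀ m N k W → size W + k ≤ m → size W ≤ N → ◇^ m N ⊑ φ k W
  ◇^-⊑ψ : ∀ m N k W → size W + k ≤ m → size W ≤ N → ◇^ m N ⊑ ψ k W
  ◇^-⊑φ m N k leaf p q = ⊤-i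
  ◇^-⊑φ m N k (o ⊹ x) p q = ∧-i
    (◇^-⊑ψ m N k o (≤-trans (+-monoˡ-≤ k (≤-trans (m≤m+n (size o) (size x)) (n≤1+n _))) p)
                   (≤-trans (≤-trans (m≤m+n (size o) (size x)) (n≤1+n _)) q))
    (◇^-⊑φ m N (suc k) x (≤-trans (≤-reflexive (+-suc (size x) k))
                            (≤-trans (s≤s (+-monoˡ-≤ k (m≤n+m (size x) (size o)))) p))
                   (≤-trans (≤-trans (m≤n+m (size x) (size o)) (n≤1+n _)) q))
  ◇^-⊑ψ m N k leaf p q = ⊤-i
  ◇^-⊑ψ m (suc N) k (o ⊹ x) p (s≤s q) = mono (∧-i
    (◇^-⊑ψ m N k o (≤-trans (+-monoˡ-≤ k (≤-trans (m≤m+n (size o) (size x)) (n≤1+n _))) p)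
                   (≤-trans (m≤m+n (size o) (size x)) q))
    (◇^-⊑φ m N (suc k) x (≤-trans (≤-reflexive (+-suc (size x) k))
                            (≤-trans (s≤s (+-monoˡ-≤ k (m≤n+m (size x) (size o)))) p))
                   (≤-trans (m≤n+m (size x) (size o)) q)))
    ⊙ ax-M (≤-trans (m≤n+m k _) p)

  φ-consistent : ∀ k W → ¬ (φ k W ⊑ ⊥')
  φ-consistent k W p =
    ◇^-consistent (size W + k) (size W) (⊑⇒⊢¬ (◇^-⊑φ (size W + k) (size W) k W ≤-refl ≤-refl ⊙ p))

  ◇φ-consistent : ∀ k W → ¬ (◇ k (φ k W) ⊑ ⊥')
  ◇φ-consistent k W p = ◇^-consistent (size W + k) (suc (size W))
    (⊑⇒⊢¬ (mono (◇^-⊑φ (size W + k) (size W) k W ≤-refl ≤-refl) ⊙ ax-M (m≤n+m k (size W)) ⊙ p))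

  -- By Löb's axiom there would be an `A` that sees no further `A`, against the hypothesis.
  ⊑◇⇒⊑⊥ : ∀ {k A} → A ⊑ ◇ k A → A ⊑ ⊥'
  ⊑◇⇒⊑⊥ p = p ⊙ ax-L ⊙ ◇-⊥ (¬-e (∧-l ⊙ p) ∧-r)

  -- The dichotomy, together with the consistency of every φ k W, forces le to be a total preorder.
  le-total : ∀ {h} U W → Ht h U → Ht h W → le U W ≡ false → le W U ≡ true
  le-total U W hU hW eq with le W U in eq'
  ... | true  = refl
  ... | false = ⊥-elim (φ-consistent 0 U (⊑◇⇒⊑⊥
    (le-false 0 U W hU hW eq ⊙ mono (le-false 0 W U hW hU eq') ⊙ ◇-trans)))

  le-refl : ∀ {h} U → Ht h U → le U U ≡ true
  le-refl U hU with le U U in eq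
  ... | true  = refl
  ... | false = trans (sym eq) (le-total U U hU hU eq)

  le-trans : ∀ {h} U W X → Ht h U → Ht h W → Ht h X → le U W ≡ true → le W X ≡ true → le U X ≡ true
  le-trans U W X hU hW hX p q with le U X in eq
  ... | true  = refl
  ... | false = ⊥-elim (φ-consistent 0 U (⊑◇⇒⊑⊥
    (le-false 0 U X hU hX eq ⊙ ◇-∨◇ (le-true 0 W X hW hX q) ⊙ ◇-∨◇ (le-true 0 U W hU hW p))))

  data Conn : Set where
    and or imp : Conn

  conn : Conn → Bool → Bool → Bool
  conn and a b = a ∧ b
  conn or  a b = a ∨ b
  conn imp a b = not a ∨ b

  connF : Conn → Fm → Fm → Fm
  connF and = _∧'_
  connF or  = _∨'_
  connF imp = _⇒_

  data G : Set where
    tt ff : G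
    tok   : T → G
    bin   : Conn → G → G → G
    neg   : G → G
    dia   : ℕ → G → G

  -- At level k the modalities below k have been evaluated, and tok W stands for ψ k W.
  I : ℕ → G → Fm
  I k tt          = ⊤'
  I k ff          = ⊥'
  I k (tok W)     = ψ k W
  I k (bin c A B) = connF c (I k A) (I k B)
  I k (neg A)     = ¬' I k A
  I k (dia j A)   = ◇ (k + j) (I k A)

  evalG : G → Bool
  evalG tt          = true
  evalG ff          = false
  evalG (tok W)     = false
  evalG (bin c A B) = conn c (evalG A) (evalG B)
  evalG (neg A)     = not (evalG A)
  evalG (dia j A)   = false

  -- Fixing the cell above `w` disposes of coordinate `k`; the remaining modalities are renumbered
  -- relative to `suc k`.
  sub : T → G → G
  sub w tt              = tt
  sub w ff              = ff
  sub w (tok W)         = if le W w then tt else ff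
  sub w (bin c A B)     = bin c (sub w A) (sub w B)
  sub w (neg A)         = neg (sub w A)
  -- A default value: `proc` leaves no modality with index 0.
  sub w (dia zero A)    = ff
  sub w (dia (suc j) A) = dia j (sub w A)

  -- U lies in the cell directly above w, as cut out by the tokens of the formula.
  ok : T → T → G → Bool
  ok w U tt          = true
  ok w U ff          = true
  ok w U (tok W)     = if le W w then true else le U W
  ok w U (bin c A B) = ok w U A ∧ ok w U B
  ok w U (neg A)     = ok w U A
  ok w U (dia j A)   = ok w U A

  smaller : Maybe T → Maybe T → Maybe T
  smaller nothing  r        = r
  smaller (just U) nothing  = just U
  smaller (just U) (just W) = if le U W then just U else just W

  candidate : G → T → Maybe T → Maybe T
  candidate B w nothing  = nothing
  candidate B w (just V) = if ok w (w ⊹ V) B then just (w ⊹ V) else nothing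

  best : (T → Maybe T) → G → Maybe T
  best f tt          = nothing
  best f ff          = nothing
  best f (tok W)     = f W
  best f (bin c A B) = smaller (best f A) (best f B)
  best f (neg A)     = best f A
  best f (dia j A)   = best f A

  cand : (G → Maybe T) → G → T → Maybe T
  cand rec B w = candidate B w (rec (sub w B))

  threshold : (G → Maybe T) → G → Maybe T
  threshold rec B = smaller (cand rec B leaf) (best (cand rec B) B)

  close : Maybe T → G
  close nothing  = ff
  close (just W) = tok W

  -- The body comes first, because a threshold can be computed only when every `◇ k` inside has
  -- become a token.
  proc : (G → Maybe T) → G → G
  proc rec tt              = tt
  proc rec ff              = ff
  proc rec (tok W)         = tok W
  proc rec (bin c A B)     = bin c (proc rec A) (proc rec B)
  proc rec (neg A)         = neg (proc rec A)
  proc rec (dia zero A)    = close (threshold rec (proc rec A))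
  proc rec (dia (suc j) A) = dia (suc j) (proc rec A)

  -- The least threshold at which the formula is satisfiable, if any.
  minimum : ℕ → G → Maybe T
  minimum zero    A = if evalG A then just leaf else nothing
  minimum (suc h) A = threshold (minimum h) (proc (minimum h) A)

-- Correctness of the algorithm with respect to GLP derivations.

module Completeness where

  open import Defs hiding (L; R)
  open Calculus
  open Thresholds
  open import Data.Nat using (ℕ; zero; suc; _≤_; _<_; s≤s)
  open import Data.Nat.Properties using (≤-refl; ≤-trans; n≤1+n; m≤m+n; +-suc; +-identityʳ)
  open import Data.List using (List; []; _∷_; _++_; map)

  -- The field ref is needed because ⊢ ¬ ◇ j A does not by itself yield ⊢ ¬ A.
  record Rep (h k : ℕ) (A : Fm) (W : T) : Set where
    constructor rep
    field
      ht   : Ht h W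
      to   : ∀ {j B} → j ≤ k → Stable k B → ◇ j (B ∧' A) ⊑ ◇ j (B ∧' φ k W)
      from : ∀ {j B} → j ≤ k → Stable k B → ◇ j (B ∧' φ k W) ⊑ ◇ j (B ∧' A)
      ref  : ∀ {B} → Stable k B → B ∧' φ k W ⊑ ⊥' → B ∧' A ⊑ ⊥'
  open Rep

  Rep? : (h k : ℕ) → Fm → Maybe T → Set
  Rep? h k A nothing  = A ⊑ ⊥'
  Rep? h k A (just W) = Rep h k A W

  infix 4 _≈_
  _≈_ : Fm → Fm → Set
  A ≈ B = A ⊑ B × B ⊑ A

  Rep?-≈ : ∀ {h k A B} r → A ≈ B → Rep? h k A r → Rep? h k B r
  Rep?-≈ nothing  (_ , q) s = q ⊙ s
  Rep?-≈ (just W) (p , q) s = rep (ht s)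
    (λ le st → mono (∧-mono ⊑-refl q) ⊙ to s le st)
    (λ le st → from s le st ⊙ mono (∧-mono ⊑-refl p))
    (λ st x → ∧-mono ⊑-refl q ⊙ ref s st x)

  connF-mono : ∀ c {C A A' B B'} → C ∧' A ⊑ A' → C ∧' A' ⊑ A → C ∧' B ⊑ B' → C ∧' B' ⊑ B →
    C ∧' connF c A B ⊑ connF c A' B'
  connF-mono and p _ q _ = ∧-i (∧-mono ⊑-refl ∧-l ⊙ p) (∧-mono ⊑-refl ∧-r ⊙ q)
  connF-mono or {C} {A} {A'} {B} p _ q _ =
    ∨-case {A} {B} ∧-r (∧-mono ∧-l ⊑-refl ⊙ p ⊙ ∨-l) (∧-mono ∧-l ⊑-refl ⊙ q ⊙ ∨-r)
  connF-mono imp {C} {A} {A'} {B} _ p q _ =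
    ⊑-curry (∧-i (∧-l ⊙ ∧-l) (modus (∧-i (∧-l ⊙ ∧-l) ∧-r ⊙ p) (∧-l ⊙ ∧-r)) ⊙ q)
    where
    modus : ∀ {D} → D ⊑ A → D ⊑ (A ⇒ B) → D ⊑ B
    modus {D} = ⊑-taut₂ λ v → go (eval v A) (eval v B) (eval v D)
      where
      go : ∀ a b d → (not d ∨ a) ≡ true → (not d ∨ (not a ∨ b)) ≡ true → (not d ∨ b) ≡ true
      go a b false p q = refl
      go true b true p q = q

  connF-cong : ∀ c {A A' B B'} → A ≈ A' → B ≈ B' → connF c A B ≈ connF c A' B'
  connF-cong c (a , a') (b , b') =
    (∧-i (⊤-i {_}) ⊑-refl ⊙ connF-mono c (∧-r ⊙ a) (∧-r ⊙ a') (∧-r ⊙ b) (∧-r ⊙ b')) ,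
    (∧-i (⊤-i {_}) ⊑-refl ⊙ connF-mono c (∧-r ⊙ a') (∧-r ⊙ a) (∧-r ⊙ b') (∧-r ⊙ b))

  ¬-mono : ∀ {C A B} → C ∧' B ⊑ A → C ∧' ¬' A ⊑ ¬' B
  ¬-mono p = ¬-i (¬-e (∧-i (∧-l ⊙ ∧-l) ∧-r ⊙ p) (∧-l ⊙ ∧-r))

  ¬-cong : ∀ {A B} → A ≈ B → ¬' A ≈ ¬' B
  ¬-cong (p , q) = (∧-i (⊤-i {_}) ⊑-refl ⊙ ¬-mono (∧-r ⊙ q)) , (∧-i (⊤-i {_}) ⊑-refl ⊙ ¬-mono (∧-r ⊙ p))

  -- One predicate serves both stages: before `proc` there are no tokens, and after it there are
  -- tokens but no index 0.
  data Wf (Tk : T → Set) (Md : ℕ → Set) : G → Set where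
    tt  : Wf Tk Md tt
    ff  : Wf Tk Md ff
    tok : ∀ {W} → Tk W → Wf Tk Md (tok W)
    bin : ∀ {c A B} → Wf Tk Md A → Wf Tk Md B → Wf Tk Md (bin c A B)
    neg : ∀ {A} → Wf Tk Md A → Wf Tk Md (neg A)
    dia : ∀ {j A} → Md j → Wf Tk Md A → Wf Tk Md (dia j A)

  Pure : ℕ → G → Set
  Pure h = Wf (λ _ → ⊥) (_< h)

  Processed : ℕ → G → Set
  Processed h = Wf (Ht (suc h)) λ j → ∃[ i ] (j ≡ suc i × i < h)

  toks : G → List T
  toks tt          = []
  toks ff          = []
  toks (tok W)     = W ∷ []
  toks (bin c A B) = toks A ++ toks B
  toks (neg A)     = toks A
  toks (dia j A)   = toks A

  toks-ht : ∀ {h B} → Processed h B → ∀ {W} → W ∈ toks B → Ht (suc h) W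
  toks-ht (tok t) (here refl) = t
  toks-ht (bin {A = A} p q) m with ∈-++⁻ (toks A) m
  ... | inj₁ m' = toks-ht p m'
  ... | inj₂ m' = toks-ht q m'
  toks-ht (neg p) m = toks-ht p m
  toks-ht (dia _ p) m = toks-ht p m

  sub-pure : ∀ {h B} w → Processed h B → Pure h (sub w B)
  sub-pure w tt = tt
  sub-pure w ff = ff
  sub-pure w (tok {W} _) with le W w
  ... | true  = tt
  ... | false = ff
  sub-pure w (bin p q) = bin (sub-pure w p) (sub-pure w q)
  sub-pure w (neg p) = neg (sub-pure w p)
  sub-pure w (dia (i , refl , lt) p) = dia lt (sub-pure w p)

  -- The cell of the points above w but not above any token of L exceeding w.
  negs : ℕ → T → List T → Fm
  negs k w []      = ⊤'
  negs k w (W ∷ L) = (if le W w then ⊤' else ¬' ψ k W) ∧' negs k w L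

  cell : ℕ → T → List T → Fm
  cell k w L = ψ k w ∧' negs k w L

  negs-e : ∀ {k w L W} → W ∈ L → le W w ≡ false → negs k w L ⊑ ¬' ψ k W
  negs-e (here refl) eq rewrite eq = ∧-l
  negs-e (there m) eq = ∧-r ⊙ negs-e m eq

  negs-i : ∀ {k w K} L → (∀ {W} → W ∈ L → le W w ≡ true ⊎ K ⊑ ¬' ψ k W) → K ⊑ negs k w L
  negs-i [] f = ⊤-i
  negs-i {k} {w} {K} (W ∷ L) f = ∧-i first (negs-i L (λ m → f (there m)))
    where
    first : K ⊑ (if le W w then ⊤' else ¬' ψ k W)
    first with le W w | f (here refl)
    ... | true  | _ = ⊤-i
    ... | false | inj₂ p = p

  ψ-stable : ∀ k W → Stable (suc k) (ψ k W)
  ψ-stable k leaf    = stable-⊤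
  ψ-stable k (o ⊹ x) = stable-◇ ≤-refl

  negs-stable : ∀ k w L → Stable (suc k) (negs k w L)
  negs-stable k w [] = stable-⊤
  negs-stable k w (W ∷ L) with le W w
  ... | true  = stable-∧ stable-⊤ (negs-stable k w L)
  ... | false = stable-∧ (stable-¬ (ψ-stable k W)) (negs-stable k w L)

  cell-stable : ∀ k w L → Stable (suc k) (cell k w L)
  cell-stable k w L = stable-∧ (ψ-stable k w) (negs-stable k w L)

  ψ-le : ∀ {h} k W w → Ht (suc h) W → w ≡ leaf ⊎ Ht (suc h) w → le W w ≡ true → ψ k w ⊑ ψ k W
  ψ-le k W .leaf (one _) (inj₁ refl) ()
  ψ-le k W .leaf (more _ _) (inj₁ refl) ()
  ψ-le k W w hW (inj₂ hw) eq rewrite ψ-◇ {k = k} hW | ψ-◇ {k = k} hw = ◇-∨◇ (le-true k W w hW hw eq)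

  -- A point lies in the cell above the greatest token that it exceeds. The search through `L` keeps
  -- in `w` the greatest such token met so far; under the current assumptions `K` every token is
  -- still pending, at most `w`, or refuted.
  cells-cover : ∀ {h k Z} L → (∀ {W} → W ∈ L → Ht (suc h) W) →
    (∀ {w} → w ∈ leaf ∷ L → cell k w L ⊑ Z) → ⊤' ⊑ Z
  cells-cover {h} {k} {Z} L hL f = go L leaf ⊤' (here refl) (λ m → m) ⊤-i inj₁
    where
    ht∈ : ∀ {w} → w ∈ leaf ∷ L → w ≡ leaf ⊎ Ht (suc h) w
    ht∈ (here refl) = inj₁ refl
    ht∈ (there m)   = inj₂ (hL m)
    -- When `w` is raised to `W`, the tokens already known to be at most `w` stay at most `W`, by
    -- totality and transitivity.
    climb : ∀ {W W' w} → W ∈ L → W' ∈ L → w ∈ leaf ∷ L → le W w ≡ false → le W' w ≡ true → le W' W ≡ true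
    climb {W} {W'} {w} m m' mw ne e with hL m' | ht∈ mw
    climb m m' mw ne () | one _ | inj₁ refl
    climb m m' mw ne () | more _ _ | inj₁ refl
    ... | hW' | inj₂ hw = le-trans W' w W hW' hw (hL m) e (le-total W w (hL m) hw ne)
    go : ∀ L' w K → w ∈ leaf ∷ L → (∀ {W} → W ∈ L' → W ∈ L) → K ⊑ ψ k w →
      (∀ {W} → W ∈ L → W ∈ L' ⊎ (le W w ≡ true ⊎ K ⊑ ¬' ψ k W)) → K ⊑ Z
    go [] w K mw _ p g = ∧-i p (negs-i L (λ m → drop (g m))) ⊙ f mw
      where
      drop : ∀ {W : T} {Q : Set} → W ∈ [] ⊎ Q → Q
      drop (inj₂ q) = q
    go (W ∷ L') w K mw sb p g with le W w in eq
    ... | true = go L' w K mw (λ m → sb (there m)) p λ m → step (g m)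
      where
      step : ∀ {W'} → W' ∈ W ∷ L' ⊎ (le W' w ≡ true ⊎ K ⊑ ¬' ψ k W') → W' ∈ L' ⊎ (le W' w ≡ true ⊎ K ⊑ ¬' ψ k W')
      step (inj₁ (here refl)) = inj₂ (inj₁ eq)
      step (inj₁ (there m)) = inj₁ m
      step (inj₂ q) = inj₂ q
    ... | false = ⊑-lem {ψ k W}
        (go L' W (K ∧' ψ k W) (there mW) (λ m → sb (there m)) ∧-r λ m → rise m (g m))
        (go L' w (K ∧' ¬' ψ k W) mw (λ m → sb (there m)) (∧-l ⊙ p) λ m → stay (g m))
      where
      mW : W ∈ L
      mW = sb (here refl)
      rise : ∀ {W'} → W' ∈ L → W' ∈ W ∷ L' ⊎ (le W' w ≡ true ⊎ K ⊑ ¬' ψ k W') →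
        W' ∈ L' ⊎ (le W' W ≡ true ⊎ K ∧' ψ k W ⊑ ¬' ψ k W')
      rise m (inj₁ (here refl)) = inj₂ (inj₁ (le-refl W (hL mW)))
      rise m (inj₁ (there m')) = inj₁ m'
      rise m (inj₂ (inj₁ e)) = inj₂ (inj₁ (climb mW m mw eq e))
      rise m (inj₂ (inj₂ q)) = inj₂ (inj₂ (∧-l ⊙ q))
      stay : ∀ {W'} → W' ∈ W ∷ L' ⊎ (le W' w ≡ true ⊎ K ⊑ ¬' ψ k W') →
        W' ∈ L' ⊎ (le W' w ≡ true ⊎ K ∧' ¬' ψ k W ⊑ ¬' ψ k W')
      stay (inj₁ (here refl)) = inj₂ (inj₂ ∧-r)
      stay (inj₁ (there m')) = inj₁ m'
      stay (inj₂ (inj₁ e)) = inj₂ (inj₁ e)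
      stay (inj₂ (inj₂ q)) = inj₂ (inj₂ (∧-l ⊙ q))

  infix 4 _⊢_≈_
  _⊢_≈_ : Fm → Fm → Fm → Set
  C ⊢ A ≈ B = C ∧' A ⊑ B × C ∧' B ⊑ A

  -- Within the cell of w a token has the constant value that sub gives it.
  sub-≈ : ∀ {h k w C L} B → Processed h B → (∀ {W} → W ∈ toks B → W ∈ L) → w ≡ leaf ⊎ Ht (suc h) w →
    Stable (suc k) C → C ⊑ cell k w L → C ⊢ I k B ≈ I (suc k) (sub w B)
  sub-≈ tt _ _ _ _ _ = ∧-r , ∧-r
  sub-≈ ff _ _ _ _ _ = ∧-r , ∧-r
  sub-≈ {k = k} {w} (tok W) (tok hW) sb hw st p with le W w in eq
  ... | true  = ⊤-i , (∧-l ⊙ p ⊙ ∧-l ⊙ ψ-le k W w hW hw eq)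
  ... | false = ¬-e ∧-r (∧-l ⊙ p ⊙ ∧-r ⊙ negs-e (sb (here refl)) eq) , (∧-r ⊙ ⊥-e)
  sub-≈ (bin c A B) (bin a b) sb hw st p
    with sub-≈ A a (λ m → sb (∈-++⁺ˡ m)) hw st p | sub-≈ B b (λ m → sb (∈-++⁺ʳ (toks A) m)) hw st p
  ... | q , q' | r , r' = connF-mono c q q' r r' , connF-mono c q' q r' r
  sub-≈ (neg A) (neg a) sb hw st p with sub-≈ A a sb hw st p
  ... | q , q' = ¬-mono q' , ¬-mono q
  sub-≈ {k = k} (dia .(suc i) A) (dia (i , refl , _) a) sb hw st p with sub-≈ A a sb hw st p
  ... | q , q' rewrite +-suc k i =
    (stable-in st (m≤m+n (suc k) i) ⊙ mono q) , (stable-in st (m≤m+n (suc k) i) ⊙ mono q')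

  ⋁ : List Fm → Fm
  ⋁ []      = ⊥'
  ⋁ (X ∷ L) = X ∨' ⋁ L

  ⋁-i : ∀ {X L} → X ∈ L → X ⊑ ⋁ L
  ⋁-i (here refl) = ∨-l
  ⋁-i (there m)   = ⋁-i m ⊙ ∨-r

  ⋁-e : ∀ {C Z} L → (∀ {X} → X ∈ L → C ∧' X ⊑ Z) → C ∧' ⋁ L ⊑ Z
  ⋁-e [] f = ∧-r ⊙ ⊥-e
  ⋁-e (X ∷ L) f = ∨-case {X} {⋁ L} ∧-r (∧-mono ∧-l ⊑-refl ⊙ f (here refl))
    (∧-mono ∧-l ⊑-refl ⊙ ⋁-e L (λ m → f (there m)))

  ◇-⋁-e : ∀ {j C Z} L → (∀ {X} → X ∈ L → ◇ j (C ∧' X) ⊑ Z) → ◇ j (C ∧' ⋁ L) ⊑ Z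
  ◇-⋁-e [] f = ◇-⊥ ∧-r ⊙ ⊥-e
  ◇-⋁-e {j} {C} (X ∷ L) f = ◇-∨ {B = C ∧' X} {C ∧' ⋁ L}
    (∨-case {X} {⋁ L} ∧-r (∧-mono ∧-l ⊑-refl ⊙ ∨-l) (∧-mono ∧-l ⊑-refl ⊙ ∨-r))
    ⊙ ∨-e (f (here refl)) (◇-⋁-e L (λ m → f (there m)))

  IsLeast : (T → Maybe T) → List T → Maybe T → Set
  IsLeast f L nothing  = ∀ {w} → w ∈ L → f w ≡ nothing
  IsLeast f L (just U) = (∃[ w ] (w ∈ L × f w ≡ just U)) × (∀ {w U'} → w ∈ L → f w ≡ just U' → le U U' ≡ true)

  smaller-least : ∀ {h f} L L' r s → (∀ {w U} → w ∈ L ++ L' → f w ≡ just U → Ht h U) →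
    IsLeast f L r → IsLeast f L' s → IsLeast f (L ++ L') (smaller r s)
  smaller-least L L' nothing nothing hf p q m with ∈-++⁻ L m
  ... | inj₁ m' = p m'
  ... | inj₂ m' = q m'
  smaller-least {f = f} L L' nothing (just U) hf p ((w , mw , e) , q) = (w , ∈-++⁺ʳ L mw , e) , all
    where
    all : ∀ {w U'} → w ∈ L ++ L' → f w ≡ just U' → le U U' ≡ true
    all m e with ∈-++⁻ L m
    ... | inj₂ m' = q m' e
    ... | inj₁ m' with trans (sym (p m')) e
    ...   | ()
  smaller-least {f = f} L L' (just U) nothing hf ((w , mw , e) , p) q = (w , ∈-++⁺ˡ mw , e) , all
    where
    all : ∀ {w U'} → w ∈ L ++ L' → f w ≡ just U' → le U U' ≡ true
    all m e with ∈-++⁻ L m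
    ... | inj₁ m' = p m' e
    ... | inj₂ m' with trans (sym (q m')) e
    ...   | ()
  smaller-least {h} {f} L L' (just U) (just W) hf ((u , mu , eu) , p) ((w , mw , ew) , q) with le U W in eq
  ... | true = (u , ∈-++⁺ˡ mu , eu) , all
    where
    all : ∀ {w U'} → w ∈ L ++ L' → f w ≡ just U' → le U U' ≡ true
    all {U' = U'} m e with ∈-++⁻ L m
    ... | inj₁ m' = p m' e
    ... | inj₂ m' = le-trans U W U' (hf (∈-++⁺ˡ mu) eu) (hf (∈-++⁺ʳ L mw) ew) (hf m e) eq (q m' e)
  ... | false = (w , ∈-++⁺ʳ L mw , ew) , all
    where
    all : ∀ {w U'} → w ∈ L ++ L' → f w ≡ just U' → le W U' ≡ true
    all {U' = U'} m e with ∈-++⁻ L m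
    ... | inj₂ m' = q m' e
    ... | inj₁ m' = le-trans W U U' (hf (∈-++⁺ʳ L mw) ew) (hf (∈-++⁺ˡ mu) eu) (hf m e)
          (le-total U W (hf (∈-++⁺ˡ mu) eu) (hf (∈-++⁺ʳ L mw) ew) eq) (p m' e)

  best-least : ∀ {h f} B → (∀ {w U} → w ∈ toks B → f w ≡ just U → Ht h U) → IsLeast f (toks B) (best f B)
  best-least tt hf = λ ()
  best-least ff hf = λ ()
  best-least {h} {f} (tok W) hf = single (f W) refl
    where
    single : ∀ r → f W ≡ r → IsLeast f (W ∷ []) r
    single nothing e (here refl) = e
    single (just U) e = (W , here refl , e) , all
      where
      all : ∀ {w U'} → w ∈ W ∷ [] → f w ≡ just U' → le U U' ≡ true
      all (here refl) e' with trans (sym e) e'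
      ... | refl = le-refl U (hf (here refl) e)
  best-least (bin c A B) hf = smaller-least (toks A) (toks B) _ _ hf
    (best-least A (λ m → hf (∈-++⁺ˡ m))) (best-least B (λ m → hf (∈-++⁺ʳ (toks A) m)))
  best-least (neg A) hf = best-least A hf
  best-least (dia j A) hf = best-least A hf

  ok-le : ∀ {w U} B → ok w U B ≡ true → ∀ {W} → W ∈ toks B → le W w ≡ true ⊎ le U W ≡ true
  ok-le {w} (tok W) e (here refl) with le W w
  ... | true  = inj₁ refl
  ... | false = inj₂ e
  ok-le {w} {U} (bin c A B) e m with ok w U A in ea | ∈-++⁻ (toks A) m
  ... | true | inj₁ m' = ok-le A ea m'
  ... | true | inj₂ m' = ok-le B e m'
  ok-le (neg A) e m = ok-le A e m
  ok-le (dia j A) e m = ok-le A e m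

  ok-fails : ∀ {w U} B → ok w U B ≡ false → ∃[ W ] (W ∈ toks B × le W w ≡ false × le U W ≡ false)
  ok-fails {w} (tok W) e with le W w in ew
  ... | false = W , here refl , ew , e
  ok-fails {w} {U} (bin c A B) e with ok w U A in ea
  ... | true  = let (W , m , p) = ok-fails B e in W , ∈-++⁺ʳ (toks A) m , p
  ... | false = let (W , m , p) = ok-fails A ea in W , ∈-++⁺ˡ m , p
  ok-fails (neg A) e = ok-fails A e
  ok-fails (dia j A) e = ok-fails A e

  Solves : ℕ → (G → Maybe T) → Set
  Solves h rec = ∀ k A → Pure h A → Rep? h k (I k A) (rec A)

  ⊹-ht : ∀ {h w V} → w ≡ leaf ⊎ Ht (suc h) w → Ht h V → Ht (suc h) (w ⊹ V)
  ⊹-ht (inj₁ refl) hV = one hV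
  ⊹-ht (inj₂ hw) hV = more hw hV

  module _ {h rec} (sol : Solves h rec) (k : ℕ) (B : G) (pB : Processed h B) where

    cells : List T
    cells = leaf ∷ toks B

    cells-ht : ∀ {w} → w ∈ cells → w ≡ leaf ⊎ Ht (suc h) w
    cells-ht (here refl) = inj₁ refl
    cells-ht (there m)   = inj₂ (toks-ht pB m)

    C : T → Fm
    C w = cell k w (toks B)

    J : T → Fm
    J w = I (suc k) (sub w B)

    piece : T → Fm
    piece w = C w ∧' J w

    B⊑pieces : I k B ⊑ ⋁ (map piece cells)
    B⊑pieces = ∧-i ⊤-i ⊑-refl ⊙ ∧-mono (cells-cover {k = k} (toks B) (toks-ht pB) λ {w} m →
        ⊑-curry (∧-i ∧-l (proj₁ (sub-≈ B pB (λ x → x) (cells-ht m) (cell-stable k w (toks B)) ⊑-refl))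
                 ⊙ ⋁-i (∈-map⁺ piece m))) ⊑-refl
      ⊙ modus
      where
      modus : ∀ {A Z} → (A ⇒ Z) ∧' A ⊑ Z
      modus {A} {Z} = taut λ v → go (eval v A) (eval v Z)
        where
        go : ∀ a z → (not ((not a ∨ z) ∧ a) ∨ z) ≡ true
        go false false = refl
        go false true = refl
        go true false = refl
        go true true = refl

    piece⊑B : ∀ {w} → w ∈ cells → piece w ⊑ I k B
    piece⊑B {w} m = proj₂ (sub-≈ B pB (λ x → x) (cells-ht m) (cell-stable k w (toks B)) ⊑-refl)

    data Outcome (w : T) : Set where
      empty : cand rec B w ≡ nothing → piece w ⊑ ⊥' → Outcome w
      found : ∀ V → cand rec B w ≡ just (w ⊹ V) → Rep h (suc k) (J w) V → ok w (w ⊹ V) B ≡ true → Outcome w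

    outcome : ∀ {w} → w ∈ cells → Outcome w
    outcome {w} m with rec (sub w B) in er | sol (suc k) (sub w B) (sub-pure w pB)
    ... | nothing | r = empty (cong (candidate B w) er) (∧-r ⊙ r)
    ... | just V  | r with ok w (w ⊹ V) B in eo
    ...   | true  = found V (trans (cong (candidate B w) er) (cong (if_then just (w ⊹ V) else nothing) eo)) r eo
    ...   | false = empty (trans (cong (candidate B w) er) (cong (if_then just (w ⊹ V) else nothing) eo))
                          (ref r (cell-stable k w (toks B)) absurd)
      where
      -- A candidate beyond some token `W` of its cell would put the point above `W`, which the cell
      -- excludes; so this cell contributes nothing.
      absurd : C w ∧' φ (suc k) V ⊑ ⊥'
      absurd with ok-fails B eo
      ... | W , mW , n , n' = ¬-e
        (∧-mono ∧-l ⊑-refl ⊙ subst (φ k (w ⊹ V) ⊑_) (sym (ψ-◇ (toks-ht pB mW)))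
            (le-false k (w ⊹ V) W (⊹-ht (cells-ht m) (ht r)) (toks-ht pB mW) n'))
        (∧-l ⊙ ∧-r ⊙ negs-e mW n)

    cand-ht : ∀ {w U} → w ∈ cells → cand rec B w ≡ just U → Ht (suc h) U
    cand-ht m e with outcome m
    ... | empty e' _ with trans (sym e') e
    ...   | ()
    cand-ht m e | found V e' r _ with trans (sym e') e
    ... | refl = ⊹-ht (cells-ht m) (ht r)

    threshold-least : IsLeast (cand rec B) cells (threshold rec B)
    threshold-least = smaller-least (leaf ∷ []) (toks B) _ _ cand-ht
      (first (cand rec B leaf) refl) (best-least B (λ m → cand-ht (there m)))
      where
      just-inj : ∀ {U U' : T} → just U ≡ just U' → U ≡ U'
      just-inj refl = refl
      first : ∀ r → cand rec B leaf ≡ r → IsLeast (cand rec B) (leaf ∷ []) r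
      first nothing e (here refl) = e
      first (just U) e = (leaf , here refl , e) , λ where
        (here refl) e' → subst (λ x → le U x ≡ true) (just-inj (trans (sym e) e')) (le-refl U (cand-ht (here refl) e))
    -- `I k B` splits into its cells. A cell is itself a stable context one level up, so inside it
    -- the solution for `suc k` can be applied; the least of the resulting thresholds then
    -- represents all cells together.
    threshold-rep : Rep? (suc h) k (I k B) (threshold rec B)
    threshold-rep with threshold rec B | threshold-least
    ... | nothing | none = ∧-i (⊤-i {_}) B⊑pieces ⊙ ⋁-e (map piece cells) λ m → ∧-r ⊙ refute m
      where
      refute : ∀ {X} → X ∈ map piece cells → X ⊑ ⊥'
      refute m with ∈-map⁻ piece m
      ... | w , mw , refl with outcome mw
      ...   | empty _ p = p
      ...   | found V e _ _ with trans (sym (none mw)) e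
      ...     | ()
    ... | just U | (w , mw , e) , least with outcome mw
    ...   | empty e' _ with trans (sym e') e
    ...     | ()
    threshold-rep | just U | (w , mw , e) , least | found V e' r okw with trans (sym e') e
    ... | refl = rep hU to' from' ref'
      where
      hU : Ht (suc h) (w ⊹ V)
      hU = ⊹-ht (cells-ht mw) (ht r)
      above : ∀ {w' V'} → w' ∈ cells → cand rec B w' ≡ just (w' ⊹ V') →
        φ k (w' ⊹ V') ⊑ φ k (w ⊹ V) ∨' ◇ k (φ k (w ⊹ V))
      above {w'} {V'} m e'' = le-true k (w ⊹ V) (w' ⊹ V') hU (cand-ht m e'') (least m e'')
      reassoc : ∀ {X Y Z} → X ∧' (Y ∧' Z) ⊑ (X ∧' Y) ∧' Z
      reassoc = ∧-i (∧-mono ⊑-refl ∧-l) (∧-r ⊙ ∧-r)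
      to' : ∀ {j B'} → j ≤ k → Stable k B' → ◇ j (B' ∧' I k B) ⊑ ◇ j (B' ∧' φ k (w ⊹ V))
      to' {j} {B'} j≤k st = mono (∧-mono ⊑-refl B⊑pieces) ⊙ ◇-⋁-e (map piece cells) bound
        where
        bound : ∀ {X} → X ∈ map piece cells → ◇ j (B' ∧' X) ⊑ ◇ j (B' ∧' φ k (w ⊹ V))
        bound m with ∈-map⁻ piece m
        ... | w' , mw' , refl with outcome mw'
        ...   | empty _ p = ◇-⊥ (∧-r ⊙ p) ⊙ ⊥-e
        ...   | found V' e'' r' _ =
          mono reassoc
          ⊙ to r' (≤-trans j≤k (n≤1+n k)) (stable-∧ (stable-suc st) (cell-stable k w' (toks B)))
          -- A point at or beyond the least threshold satisfies its description or sees it through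
          -- `◇ k`; in the second case `◇ j` absorbs the `◇ k`.
          ⊙ ◇-∨ (∨-case (∧-mono (∧-r ⊙ ∧-l) ⊑-refl ⊙ above mw' e'')
                   (∧-mono (∧-l ⊙ ∧-l) ⊑-refl ⊙ ∨-l)
                   (∧-mono (∧-l ⊙ ∧-l) ⊑-refl ⊙ stable-in st ≤-refl ⊙ ∨-r))
          ⊙ ∨-e ⊑-refl (◇-absorb j≤k)
      -- `ok` puts `w ⊹ V` at or below every token exceeding `w`. Being above such a token would
      -- therefore mean seeing another point with the same description.
      into-cell : φ k (w ⊹ V) ∧' ¬' ◇ k (φ k (w ⊹ V)) ⊑ C w
      into-cell = ∧-i (∧-l ⊙ ∧-l) (negs-i (toks B) decide)
        where
        decide : ∀ {W} → W ∈ toks B → le W w ≡ true ⊎ (φ k (w ⊹ V) ∧' ¬' ◇ k (φ k (w ⊹ V)) ⊑ ¬' ψ k W)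
        decide {W} m with ok-le B okw m
        ... | inj₁ t = inj₁ t
        ... | inj₂ t = inj₂ (¬-mono (∧-r ⊙ subst (_⊑ ◇ k (φ k (w ⊹ V))) (sym (ψ-◇ (toks-ht pB m)))
                (◇-∨◇ (le-true k (w ⊹ V) W hU (toks-ht pB m) t))))
      from' : ∀ {j B'} → j ≤ k → Stable k B' → ◇ j (B' ∧' φ k (w ⊹ V)) ⊑ ◇ j (B' ∧' I k B)
      -- An arbitrary point with this description may lie beyond the cell, so it is first exchanged
      -- for a least one.
      from' j≤k st = stable-löb st j≤k
        ⊙ mono (∧-i (∧-mono ⊑-refl into-cell) (∧-r ⊙ ∧-l ⊙ ∧-r))
        ⊙ from r (≤-trans j≤k (n≤1+n k)) (stable-∧ (stable-suc st) (cell-stable k w (toks B)))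
        ⊙ mono (∧-i (∧-l ⊙ ∧-l) (∧-mono ∧-r ⊑-refl ⊙ piece⊑B mw))
      ref' : ∀ {B'} → Stable k B' → B' ∧' φ k (w ⊹ V) ⊑ ⊥' → B' ∧' I k B ⊑ ⊥'
      ref' {B'} st p = ∧-mono ⊑-refl B⊑pieces ⊙ ⋁-e (map piece cells) bound
        where
        bound : ∀ {X} → X ∈ map piece cells → B' ∧' X ⊑ ⊥'
        bound m with ∈-map⁻ piece m
        ... | w' , mw' , refl with outcome mw'
        ...   | empty _ q = ∧-r ⊙ q
        ...   | found V' e'' r' _ = reassoc
          ⊙ ref r' (stable-∧ (stable-suc st) (cell-stable k w' (toks B)))
              (∨-case (∧-mono (∧-r ⊙ ∧-l) ⊑-refl ⊙ above mw' e'')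
                (∧-mono (∧-l ⊙ ∧-l) ⊑-refl ⊙ p)
                (∧-mono (∧-l ⊙ ∧-l) ⊑-refl ⊙ stable-in st ≤-refl ⊙ ◇-⊥ p))

  close-≈ : ∀ {h k A} r → Rep? (suc h) k A r → ◇ k A ≈ I k (close r)
  close-≈ nothing p = ◇-⊥ p , ⊥-e
  close-≈ {k = k} {A} (just W) p rewrite ψ-◇ {k = k} (ht p) =
    (mono (∧-i ⊤-i ⊑-refl) ⊙ to p ≤-refl stable-⊤ ⊙ mono ∧-r) ,
    (mono (∧-i ⊤-i ⊑-refl) ⊙ from p ≤-refl stable-⊤ ⊙ mono ∧-r)

  close-processed : ∀ {h k A} r → Rep? (suc h) k A r → Processed h (close r)
  close-processed nothing  p = ff
  close-processed (just W) p = tok (ht p)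

  proc-≈ : ∀ {h rec} → Solves h rec → ∀ k A → Pure (suc h) A → Processed h (proc rec A) × I k A ≈ I k (proc rec A)
  proc-≈ sol k tt tt = tt , ⊑-refl , ⊑-refl
  proc-≈ sol k ff ff = ff , ⊑-refl , ⊑-refl
  proc-≈ sol k (bin c A B) (bin a b) with proc-≈ sol k A a | proc-≈ sol k B b
  ... | p , e | p' , e' = bin p p' , connF-cong c e e'
  proc-≈ sol k (neg A) (neg a) with proc-≈ sol k A a
  ... | p , e = neg p , ¬-cong e
  proc-≈ {h} {rec} sol k (dia zero A) (dia _ a) with proc-≈ sol k A a
  ... | p , (e , e') rewrite +-identityʳ k =
    let r = threshold-rep sol k (proc rec A) p
        (c , c') = close-≈ (threshold rec (proc rec A)) r
    in close-processed {k = k} (threshold rec (proc rec A)) r , (mono e ⊙ c) , (c' ⊙ mono e')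
  proc-≈ sol k (dia (suc j) A) (dia (s≤s lt) a) with proc-≈ sol k A a
  ... | p , (e , e') = dia (j , refl , lt) p , mono e , mono e'

  evalG-≈ : ∀ {k} A → Pure 0 A → I k A ≈ (if evalG A then ⊤' else ⊥')
  evalG-≈ tt tt = ⊑-refl , ⊑-refl
  evalG-≈ ff ff = ⊑-refl , ⊑-refl
  evalG-≈ {k} (bin c A B) (bin a b) with connF-cong c (evalG-≈ {k} A a) (evalG-≈ {k} B b)
  ... | p , q with table c (evalG A) (evalG B)
    where
    table : ∀ c a b → connF c (if a then ⊤' else ⊥') (if b then ⊤' else ⊥') ≈ (if conn c a b then ⊤' else ⊥')
    table and true true = ⊤-i , ∧-i ⊑-refl ⊑-refl
    table and true false = ∧-r , ⊥-e
    table and false b = ∧-l , ⊥-e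
    table or true b = ⊤-i , ∨-l
    table or false true = ⊤-i , ∨-r
    table or false false = ∨-e ⊑-refl ⊑-refl , ⊥-e
    table imp true true = ⊤-i , ⊑-curry ∧-r
    table imp true false = taut (λ v → refl) , ⊥-e
    table imp false b = ⊤-i , ⊑-curry (∧-r ⊙ ⊥-e)
  ... | p' , q' = (p ⊙ p') , (q' ⊙ q)
  evalG-≈ {k} (neg A) (neg a) with ¬-cong (evalG-≈ {k} A a)
  ... | p , q with evalG A
  ...   | true  = (p ⊙ taut (λ v → refl)) , ⊥-e
  ...   | false = ⊤-i , (taut (λ v → refl) ⊙ q)
  evalG-≈ (dia j A) (dia () _)

  minimum-solves : ∀ h → Solves h (minimum h)
  minimum-solves zero k A a with evalG A | evalG-≈ {k} A a
  ... | true  | _ , t = rep nil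
    (λ _ _ → mono (∧-mono ⊑-refl ⊤-i)) (λ _ _ → mono (∧-mono ⊑-refl t)) (λ _ p → ∧-mono ⊑-refl ⊤-i ⊙ p)
  ... | false | f , _ = f
  minimum-solves (suc h) k A a with proc-≈ (minimum-solves h) k A a
  ... | p , (e , e') = Rep?-≈ (threshold (minimum h) (proc (minimum h) A)) (e' , e)
    (threshold-rep (minimum-solves h) k (proc (minimum h) A) p)

  toG : Fm → G
  toG (var i)  = ff
  toG ⊤'       = tt
  toG ⊥'       = ff
  toG (A ∧' B) = bin and (toG A) (toG B)
  toG (A ∨' B) = bin or (toG A) (toG B)
  toG (A ⇒ B)  = bin imp (toG A) (toG B)
  toG (¬' A)   = neg (toG A)
  toG (◇ k A)  = dia k (toG A)

  toG-pure : ∀ {n A} → InL n A → Pure n (toG A)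
  toG-pure ⊤ᴸ = tt
  toG-pure ⊥ᴸ = ff
  toG-pure (∧ᴸ a b) = bin (toG-pure a) (toG-pure b)
  toG-pure (∨ᴸ a b) = bin (toG-pure a) (toG-pure b)
  toG-pure (⇒ᴸ a b) = bin (toG-pure a) (toG-pure b)
  toG-pure (¬ᴸ a) = neg (toG-pure a)
  toG-pure (◇ᴸ lt a) = dia lt (toG-pure a)

  I-toG : ∀ {n A} → InL n A → I 0 (toG A) ≡ A
  I-toG ⊤ᴸ = refl
  I-toG ⊥ᴸ = refl
  I-toG (∧ᴸ a b) = cong₂ _∧'_ (I-toG a) (I-toG b)
  I-toG (∨ᴸ a b) = cong₂ _∨'_ (I-toG a) (I-toG b)
  I-toG (⇒ᴸ a b) = cong₂ _⇒_ (I-toG a) (I-toG b)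
  I-toG (¬ᴸ a) = cong ¬'_ (I-toG a)
  I-toG (◇ᴸ lt a) = cong (◇ _) (I-toG a)

  refuted : Maybe T → Bool
  refuted nothing  = true
  refuted (just _) = false

  decide : ℕ → Fm → Bool
  decide n A = refuted (minimum n (neg (toG A)))

  -- `Rep` transfers statements only under a diamond, so in the case of a least point consistency is
  -- needed for `◇ 0 (φ 0 W)`: a derivation of `A` would refute `◇ 0 (¬' A)` and with it this
  -- formula.
  decide-correct : ∀ {n A} → InL n A →
    (decide n A ≡ true → GLP⊢ A) × (GLP⊢ A → decide n A ≡ true)
  decide-correct {n} {A} l
    with minimum n (neg (toG A)) | minimum-solves n 0 (neg (toG A)) (neg (toG-pure l))
  ... | nothing | r = (λ _ → mp (⊑⇒⊢¬ (subst (λ X → ¬' X ⊑ ⊥') (I-toG l) r)) ¬¬-e) , λ _ → refl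
  ... | just W  | r = (λ ()) , λ d → ⊥-elim (◇φ-consistent 0 W
    (mono (∧-i ⊤-i ⊑-refl) ⊙ from r ≤-refl stable-⊤
     ⊙ ◇-⊥ (∧-r ⊙ ¬-e (⊢-wk d) (subst (λ X → ¬' I 0 (toG A) ⊑ ¬' X) (I-toG l) ⊑-refl))))

-- A language of folds over trees and its compilation to a stack machine.

module TreeLanguage where

  open Thresholds using (Conn; and)
  open import Data.Nat using (ℕ; zero; suc; _+_; _*_; _≤_; z≤n; s≤s)
  open import Data.Nat.Properties
  open import Data.Nat.Solver using (module +-*-Solver)
  open import Data.Fin using (Fin; zero; suc)
  open import Data.Vec using (Vec; []; _∷_; lookup)
  open import Data.List using (List; []; _∷_)

  -- Labels of the symbols of arity 0, 1 and 2.  A formula is stored as the tree whose prefix code is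
  -- its encoding; τᶜ, oᶜ and ωᶜ code tok, leaf and ⊹.
  data L0 : Set where
    ⊤ᶜ ⊥ᶜ oᶜ : L0

  data L1 : Set where
    ¬ᶜ ◇ᶜ 1ᶜ τᶜ : L1

  data L2 : Set where
    op : Conn → L2
    ωᶜ : L2

  data D : Set where
    n0 : L0 → D
    n1 : L1 → D → D
    n2 : L2 → D → D → D

  ∣_∣ : D → ℕ
  ∣ n0 l ∣     = 1
  ∣ n1 l a ∣   = suc ∣ a ∣
  ∣ n2 l a b ∣ = suc (∣ a ∣ + ∣ b ∣)

  ∣_∣ᵉ : ∀ {m} → Vec D m → ℕ
  ∣ [] ∣ᵉ    = 0
  ∣ t ∷ ρ ∣ᵉ = ∣ t ∣ + ∣ ρ ∣ᵉ

  -- The step of a `cata` receives only the results at the children; a program that needs a subtree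
  -- itself must let the fold reproduce it.
  data Exp : ℕ → Set where
    var  : ∀ {m} → Fin m → Exp m
    k0   : ∀ {m} → L0 → Exp m
    k1   : ∀ {m} → L1 → Exp m → Exp m
    k2   : ∀ {m} → L2 → Exp m → Exp m → Exp m
    bind : ∀ {m} → Exp m → Exp (suc m) → Exp m
    case cata : ∀ {m} → Exp m → (L0 → Exp m) → (L1 → Exp (suc m)) → (L2 → Exp (suc (suc m))) → Exp m

  caseD : {A : Set} → (L0 → A) → (L1 → D → A) → (L2 → D → D → A) → D → A
  caseD f g h (n0 l)     = f l
  caseD f g h (n1 l a)   = g l a
  caseD f g h (n2 l a b) = h l a b

  foldD : (L0 → D) → (L1 → D → D) → (L2 → D → D → D) → D → D
  foldD f g h (n0 l)     = f l
  foldD f g h (n1 l a)   = g l (foldD f g h a)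
  foldD f g h (n2 l a b) = h l (foldD f g h a) (foldD f g h b)

  eval : ∀ {m} → Exp m → Vec D m → D
  eval (var i) ρ      = lookup ρ i
  eval (k0 l) ρ       = n0 l
  eval (k1 l e) ρ     = n1 l (eval e ρ)
  eval (k2 l e e') ρ  = n2 l (eval e ρ) (eval e' ρ)
  eval (bind e e') ρ  = eval e' (eval e ρ ∷ ρ)
  eval (case e f g h) ρ = caseD (λ l → eval (f l) ρ) (λ l x → eval (g l) (x ∷ ρ))
    (λ l x y → eval (h l) (y ∷ x ∷ ρ)) (eval e ρ)
  eval (cata e f g h) ρ = foldD (λ l → eval (f l) ρ) (λ l x → eval (g l) (x ∷ ρ))
    (λ l x y → eval (h l) (y ∷ x ∷ ρ)) (eval e ρ)

  -- Upper bounds on the numbers of stack operations; binding a value v costs 24 ∣ v ∣.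
  mutual
    cost : ∀ {m} → Exp m → Vec D m → ℕ
    cost (var i) ρ        = 13 * ∣ ρ ∣ᵉ
    cost (k0 l) ρ         = 1
    cost (k1 l e) ρ       = cost e ρ + 1
    cost (k2 l e e') ρ    = cost e' ρ + (cost e ρ + 1)
    cost (bind e e') ρ    = cost e ρ + (24 * ∣ eval e ρ ∣ + cost e' (eval e ρ ∷ ρ))
    cost (case e f g h) ρ = cost e ρ + suc (caseCost f g h ρ (eval e ρ))
    cost (cata e f g h) ρ = cost e ρ + (10 * ∣ eval e ρ ∣ + cataCost f g h ρ (eval e ρ))

    caseCost : ∀ {m} → (L0 → Exp m) → (L1 → Exp (suc m)) → (L2 → Exp (suc (suc m))) → Vec D m → D → ℕ
    caseCost f g h ρ (n0 l)     = cost (f l) ρ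
    caseCost f g h ρ (n1 l a)   = 24 * ∣ a ∣ + cost (g l) (a ∷ ρ)
    caseCost f g h ρ (n2 l a b) = 24 * ∣ a ∣ + (24 * ∣ b ∣ + cost (h l) (b ∷ a ∷ ρ))

    cataCost : ∀ {m} → (L0 → Exp m) → (L1 → Exp (suc m)) → (L2 → Exp (suc (suc m))) → Vec D m → D → ℕ
    cataCost f g h ρ (n0 l)     = suc (cost (f l) ρ)
    cataCost f g h ρ (n1 l a)   = cataCost f g h ρ a + suc (caseCost f g h ρ (n1 l (foldE f g h ρ a)))
    cataCost f g h ρ (n2 l a b) = cataCost f g h ρ b + (cataCost f g h ρ a +
      suc (caseCost f g h ρ (n2 l (foldE f g h ρ a) (foldE f g h ρ b))))

    foldE : ∀ {m} → (L0 → Exp m) → (L1 → Exp (suc m)) → (L2 → Exp (suc (suc m))) → Vec D m → D → D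
    foldE f g h ρ = foldD (λ l → eval (f l) ρ) (λ l x → eval (g l) (x ∷ ρ)) (λ l x y → eval (h l) (y ∷ x ∷ ρ))

  -- A machine with four stacks: values, environment, and two for control.
  data Stk : Set where
    kS kE kX kY : Stk

  data Sym : Set where
    #  : Sym
    y0 : L0 → Sym
    y1 : L1 → Sym
    y2 : L2 → Sym

  data Cmd : Set where
    push : Stk → Sym → Cmd
    pop  : Stk → (Sym → Cmd) → Cmd
    loop : Stk → (Sym → Cmd) → Cmd
    _∙_  : Cmd → Cmd → Cmd
    skip : Cmd

  infixr 5 _∙_

  record St : Set where
    constructor ⟨_,_,_,_⟩
    field
      σS σE σX σY : List Sym
  open St public

  get : Stk → St → List Sym
  get kS = σS
  get kE = σE
  get kX = σX
  get kY = σY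

  set : Stk → List Sym → St → St
  set kS w ⟨ s , e , x , y ⟩ = ⟨ w , e , x , y ⟩
  set kE w ⟨ s , e , x , y ⟩ = ⟨ s , w , x , y ⟩
  set kX w ⟨ s , e , x , y ⟩ = ⟨ s , e , w , y ⟩
  set kY w ⟨ s , e , x , y ⟩ = ⟨ s , e , x , w ⟩

  -- An empty stack reads as #.
  hd : List Sym → Sym
  hd []      = #
  hd (s ∷ _) = s

  tl : List Sym → List Sym
  tl []      = []
  tl (_ ∷ r) = r

  popped : Stk → St → St
  popped k σ = set k (tl (get k σ)) σ

  -- Run c σ n σ' : from σ the command c ends in σ' after at most n operations.
  data Run : Cmd → St → ℕ → St → Set where
    r-push : ∀ {k s σ} → Run (push k s) σ 1 (set k (s ∷ get k σ) σ)
    r-skip : ∀ {σ} → Run skip σ 1 σ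
    r-pop  : ∀ {k f σ n σ'} → Run (f (hd (get k σ))) (popped k σ) n σ' → Run (pop k f) σ (suc n) σ'
    r-end  : ∀ {k f σ} → hd (get k σ) ≡ # → Run (loop k f) σ 1 (popped k σ)
    r-step : ∀ {k f σ n m σ' σ''} → hd (get k σ) ≢ # → Run (f (hd (get k σ))) (popped k σ) n σ' →
             Run (loop k f) σ' m σ'' → Run (loop k f) σ (suc (n + m)) σ''
    r-seq  : ∀ {c c' σ n m σ' σ''} → Run c σ n σ' → Run c' σ' m σ'' → Run (c ∙ c') σ (n + m) σ''
    r-wk   : ∀ {c σ n m σ'} → n ≤ m → Run c σ n σ' → Run c σ m σ'

  -- Reversal puts children before their parent and the second child before the first. A fold can
  -- therefore consume the reversed code symbol by symbol, and it finds the result for the first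
  -- child on top of the value stack.
  code rcode : D → List Sym → List Sym
  code (n0 l) r      = y0 l ∷ r
  code (n1 l a) r    = y1 l ∷ code a r
  code (n2 l a b) r  = y2 l ∷ code a (code b r)
  rcode (n0 l) r     = y0 l ∷ r
  rcode (n1 l a) r   = rcode a (y1 l ∷ r)
  rcode (n2 l a b) r = rcode b (rcode a (y2 l ∷ r))

  env : ∀ {m} → Vec D m → List Sym
  env []      = []
  env (t ∷ ρ) = code t (env ρ)

  -- The number of trees still to be read is kept in unary on stack Y.
  one : Sym
  one = y0 ⊤ᶜ

  count : Sym → Cmd
  count #      = skip
  count (y0 _) = skip
  count (y1 _) = push kY one
  count (y2 _) = push kY one ∙ push kY one

  scan : Stk → Cmd
  scan k = loop kY λ _ → pop k λ s → push kX s ∙ count s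

  -- The marker on `X` ends the moved tree and the one on `Y` ends the counter, so nested traversals
  -- can share both stacks. The loops that meet the markers remove them.
  toX : Stk → Cmd
  toX k = push kX # ∙ push kY # ∙ push kY one ∙ scan k

  toE dup discard dropE bindS : Cmd
  toE = loop kX λ s → push kE s
  dup = loop kX λ s → push kE s ∙ push kS s
  discard = loop kX λ _ → skip
  dropE = toX kE ∙ discard
  bindS = toX kS ∙ toE

  pick : ∀ {m} → Fin m → Cmd
  pick zero    = toX kE ∙ dup
  pick (suc i) = toX kE ∙ pick i ∙ toE

  local1 local2 : Cmd → Cmd
  local1 c = bindS ∙ c ∙ dropE
  local2 c = bindS ∙ bindS ∙ c ∙ dropE ∙ dropE

  -- Of two arguments the second is computed first, so that pushing the label last completes a
  -- prefix code.
  comp : ∀ {m} → Exp m → Cmd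
  byArity : ∀ {m} → (L0 → Exp m) → (L1 → Exp (suc m)) → (L2 → Exp (suc (suc m))) → Sym → Cmd
  comp (var i)        = pick i
  comp (k0 l)         = push kS (y0 l)
  comp (k1 l e)       = comp e ∙ push kS (y1 l)
  comp (k2 l e e')    = comp e' ∙ comp e ∙ push kS (y2 l)
  comp (bind e e')    = comp e ∙ local1 (comp e')
  comp (case e f g h) = comp e ∙ pop kS (byArity f g h)
  comp (cata e f g h) = comp e ∙ toX kS ∙ loop kX (byArity f g h)
  byArity f g h #      = skip
  byArity f g h (y0 l) = comp (f l)
  byArity f g h (y1 l) = local1 (comp (g l))
  byArity f g h (y2 l) = local2 (comp (h l))

  ∣∣-pos : ∀ t → 1 ≤ ∣ t ∣
  ∣∣-pos (n0 l)     = s≤s z≤n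
  ∣∣-pos (n1 l a)   = s≤s z≤n
  ∣∣-pos (n2 l a b) = s≤s z≤n

  module _ where
    open +-*-Solver

    arith₁ : ∀ a n → suc (4 + (5 * a + n)) ≡ 5 * suc a + n
    arith₁ = solve 2 (λ a n → con 1 :+ (con 4 :+ (con 5 :* a :+ n)) := con 5 :* (con 1 :+ a) :+ n) refl

    arith₂ : ∀ a b n → suc (4 + (5 * a + (5 * b + n))) ≡ 5 * suc (a + b) + n
    arith₂ = solve 3 (λ a b n → con 1 :+ (con 4 :+ (con 5 :* a :+ (con 5 :* b :+ n))) := con 5 :* (con 1 :+ (a :+ b)) :+ n) refl

    arith₅ : ∀ c a b n → c * b + (c * a + (c + n)) ≡ c * suc (a + b) + n
    arith₅ = solve 4 (λ c a b n → c :* b :+ (c :* a :+ (c :+ n)) := c :* (con 1 :+ (a :+ b)) :+ n) refl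

    arith₆ : ∀ c a n → c * a + (c + n) ≡ c * suc a + n
    arith₆ = solve 3 (λ c a n → c :* a :+ (c :+ n) := c :* (con 1 :+ a) :+ n) refl

  ≡-wk : ∀ {c σ n m σ'} → n ≡ m → Run c σ n σ' → Run c σ m σ'
  ≡-wk refl r = r

  data Src : Stk → Set where
    srcS : Src kS
    srcE : Src kE

  holding : ∀ {k} → Src k → (s e w x y : List Sym) → St
  holding srcS s e w x y = ⟨ w , e , x , y ⟩
  holding srcE s e w x y = ⟨ s , w , x , y ⟩

  scan-step : ∀ {k} (sk : Src k) s e b w x y n {m σ'} →
    Run (push kX b ∙ count b) (holding sk s e w x y) n (holding sk s e w (b ∷ x) m) → 
    ∀ {l} → Run (scan k) (holding sk s e w (b ∷ x) m) l σ' →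
    Run (scan k) (holding sk s e (b ∷ w) x (one ∷ y)) (suc (suc n + l)) σ'
  scan-step srcS s e b w x y n r r' = r-step (λ ()) (r-pop r) r'
  scan-step srcE s e b w x y n r r' = r-step (λ ()) (r-pop r) r'

  put : ∀ {k} (sk : Src k) s e b w x y → Run (push kX b) (holding sk s e w x y) 1 (holding sk s e w (b ∷ x) y)
  put srcS s e b w x y = r-push
  put srcE s e b w x y = r-push

  tick : ∀ {k} (sk : Src k) s e w x y → Run (push kY one) (holding sk s e w x y) 1 (holding sk s e w x (one ∷ y))
  tick srcS s e w x y = r-push
  tick srcE s e w x y = r-push

  -- A single loop passes over all pending trees, hence the continuation. The factor 5 counts the
  -- loop test, the pop, the push to `X` and at most two pushes to the counter.
  scan-run : ∀ {k} (sk : Src k) s e t w x y {n σ'} →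
    Run (scan k) (holding sk s e w (rcode t x) y) n σ' →
    Run (scan k) (holding sk s e (code t w) x (one ∷ y)) (5 * ∣ t ∣ + n) σ'
  scan-run sk s e (n0 l) w x y r =
    r-wk (n≤1+n _) (scan-step sk s e (y0 l) w x y 2 (r-seq (put sk s e (y0 l) w x y) r-skip) r)
  scan-run sk s e (n1 l a) w x y {n} r = r-wk (≤-trans (n≤1+n _) (≤-reflexive (arith₁ ∣ a ∣ n)))
    (scan-step sk s e (y1 l) (code a w) x y 2
      (r-seq (put sk s e (y1 l) (code a w) x y) (tick sk s e (code a w) (y1 l ∷ x) y))
      (scan-run sk s e a w (y1 l ∷ x) y r))
  scan-run sk s e (n2 l a b) w x y {n} r = r-wk (≤-reflexive (arith₂ ∣ a ∣ ∣ b ∣ n))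
    (scan-step sk s e (y2 l) (code a (code b w)) x y 3
      (r-seq (put sk s e (y2 l) (code a (code b w)) x y)
        (r-seq (tick sk s e (code a (code b w)) (y2 l ∷ x) y) (tick sk s e (code a (code b w)) (y2 l ∷ x) (one ∷ y))))
      (scan-run sk s e a (code b w) (y2 l ∷ x) (one ∷ y) (scan-run sk s e b w (rcode a (y2 l ∷ x)) y r)))

  -- To the 5 operations per symbol come three pushes and the end of the loop; these 4 are charged
  -- to the symbols, of which there is at least one.
  toX-run : ∀ {k} (sk : Src k) s e t w x y →
    Run (toX k) (holding sk s e (code t w) x y) (9 * ∣ t ∣) (holding sk s e w (rcode t (# ∷ x)) y)
  toX-run {k} sk s e t w x y = r-wk bound (start sk (scan-run sk s e t w (# ∷ x) (# ∷ y) (stop sk)))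
    where
    stop : ∀ {k} (sk : Src k) → Run (scan k) (holding sk s e w (rcode t (# ∷ x)) (# ∷ y)) 1
      (holding sk s e w (rcode t (# ∷ x)) y)
    stop srcS = r-end refl
    stop srcE = r-end refl
    start : ∀ {k} (sk : Src k) {n σ} → Run (scan k) (holding sk s e (code t w) (# ∷ x) (one ∷ # ∷ y)) n σ →
      Run (toX k) (holding sk s e (code t w) x y) (3 + n) σ
    start srcS r = r-seq r-push (r-seq r-push (r-seq r-push r))
    start srcE r = r-seq r-push (r-seq r-push (r-seq r-push r))
    bound : 3 + (5 * ∣ t ∣ + 1) ≤ 9 * ∣ t ∣
    bound = ≤-trans (≤-reflexive (eq ∣ t ∣)) (≤-trans (+-monoˡ-≤ (5 * ∣ t ∣) (*-monoʳ-≤ 4 (∣∣-pos t)))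
      (≤-reflexive (sym (*-distribʳ-+ ∣ t ∣ 4 5))))
      where
      eq : ∀ a → 3 + (5 * a + 1) ≡ 4 + 5 * a
      eq a = cong (3 +_) (+-comm (5 * a) 1)

  toE-run : ∀ t {s e x y n σ'} → Run toE ⟨ s , code t e , x , y ⟩ n σ' →
    Run toE ⟨ s , e , rcode t x , y ⟩ (2 * ∣ t ∣ + n) σ'
  toE-run (n0 l) r = r-step (λ ()) r-push r
  toE-run (n1 l a) {n = n} r = ≡-wk (arith₆ 2 ∣ a ∣ n) (toE-run a (r-step (λ ()) r-push r))
  toE-run (n2 l a b) {n = n} r = ≡-wk (arith₅ 2 ∣ a ∣ ∣ b ∣ n) (toE-run b (toE-run a (r-step (λ ()) r-push r)))

  discard-run : ∀ t {s e x y n σ'} → Run discard ⟨ s , e , x , y ⟩ n σ' →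
    Run discard ⟨ s , e , rcode t x , y ⟩ (2 * ∣ t ∣ + n) σ'
  discard-run (n0 l) r = r-step (λ ()) r-skip r
  discard-run (n1 l a) {n = n} r = ≡-wk (arith₆ 2 ∣ a ∣ n) (discard-run a (r-step (λ ()) r-skip r))
  discard-run (n2 l a b) {n = n} r =
    ≡-wk (arith₅ 2 ∣ a ∣ ∣ b ∣ n) (discard-run b (discard-run a (r-step (λ ()) r-skip r)))

  dup-run : ∀ t {s e x y n σ'} → Run dup ⟨ code t s , code t e , x , y ⟩ n σ' →
    Run dup ⟨ s , e , rcode t x , y ⟩ (3 * ∣ t ∣ + n) σ'
  dup-run (n0 l) r = r-step (λ ()) (r-seq r-push r-push) r
  dup-run (n1 l a) {n = n} r = ≡-wk (arith₆ 3 ∣ a ∣ n) (dup-run a (r-step (λ ()) (r-seq r-push r-push) r))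
  dup-run (n2 l a b) {n = n} r =
    ≡-wk (arith₅ 3 ∣ a ∣ ∣ b ∣ n) (dup-run b (dup-run a (r-step (λ ()) (r-seq r-push r-push) r)))

  +1-≤ : ∀ c t → c * ∣ t ∣ + 1 ≤ suc c * ∣ t ∣
  +1-≤ c t = ≤-trans (≤-reflexive (+-comm (c * ∣ t ∣) 1)) (+-monoˡ-≤ (c * ∣ t ∣) (∣∣-pos t))

  -- The constant is 9 for `toX`, 2 per symbol for the way back and 1 for the end of the loop.
  -- Removing the binding costs the same, whence the 24 in `cost`.
  bindS-run : ∀ t {s e x y} → Run bindS ⟨ code t s , e , x , y ⟩ (12 * ∣ t ∣) ⟨ s , code t e , x , y ⟩
  bindS-run t {s} {e} {x} {y} =
    r-wk (≤-trans (+-monoʳ-≤ (9 * ∣ t ∣) (+1-≤ 2 t)) (≤-reflexive (sym (*-distribʳ-+ ∣ t ∣ 9 3))))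
      (r-seq (toX-run srcS s e t s x y) (toE-run t (r-end refl)))

  dropE-run : ∀ t {s e x y} → Run dropE ⟨ s , code t e , x , y ⟩ (12 * ∣ t ∣) ⟨ s , e , x , y ⟩
  dropE-run t {s} {e} {x} {y} =
    r-wk (≤-trans (+-monoʳ-≤ (9 * ∣ t ∣) (+1-≤ 2 t)) (≤-reflexive (sym (*-distribʳ-+ ∣ t ∣ 9 3))))
      (r-seq (toX-run srcE s e t e x y) (discard-run t (r-end refl)))

  local1-run : ∀ {c n} a {s s' e x y} → Run c ⟨ s , code a e , x , y ⟩ n ⟨ s' , code a e , x , y ⟩ →
    Run (local1 c) ⟨ code a s , e , x , y ⟩ (24 * ∣ a ∣ + n) ⟨ s' , e , x , y ⟩
  local1-run {n = n} a r = ≡-wk (eq (12 * ∣ a ∣) n ∣ a ∣ refl) (r-seq (bindS-run a) (r-seq r (dropE-run a)))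
    where
    eq : ∀ b n a → b ≡ 12 * a → b + (n + b) ≡ 24 * a + n
    eq .(12 * a) n a refl = solve 2 (λ a n → con 12 :* a :+ (n :+ con 12 :* a) := con 24 :* a :+ n) refl a n
      where open +-*-Solver

  local2-run : ∀ {c n} a b {s s' e x y} →
    Run c ⟨ s , code b (code a e) , x , y ⟩ n ⟨ s' , code b (code a e) , x , y ⟩ →
    Run (local2 c) ⟨ code a (code b s) , e , x , y ⟩ (24 * ∣ a ∣ + (24 * ∣ b ∣ + n)) ⟨ s' , e , x , y ⟩
  local2-run {n = n} a b r = ≡-wk (eq ∣ a ∣ ∣ b ∣ n)
    (r-seq (bindS-run a) (r-seq (bindS-run b) (r-seq r (r-seq (dropE-run b) (dropE-run a)))))
    where
    open +-*-Solver
    eq : ∀ a b n → 12 * a + (12 * b + (n + (12 * b + 12 * a))) ≡ 24 * a + (24 * b + n)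
    eq = solve 3 (λ a b n → con 12 :* a :+ (con 12 :* b :+ (n :+ (con 12 :* b :+ con 12 :* a)))
                   := con 24 :* a :+ (con 24 :* b :+ n)) refl

  -- Copying the chosen tree costs 9 for `toX`, 3 per symbol for `dup` and 1 for the end of the
  -- loop; lifting an earlier tree away and back costs 12.
  pick-run : ∀ {m} (i : Fin m) (ρ : Vec D m) {s x y} →
    Run (pick i) ⟨ s , env ρ , x , y ⟩ (13 * ∣ ρ ∣ᵉ) ⟨ code (lookup ρ i) s , env ρ , x , y ⟩
  pick-run zero (t ∷ ρ) {s} {x} {y} = r-wk
    (≤-trans (+-monoʳ-≤ (9 * ∣ t ∣) (+1-≤ 3 t))
      (≤-trans (≤-reflexive (sym (*-distribʳ-+ ∣ t ∣ 9 4))) (*-monoʳ-≤ 13 (m≤m+n ∣ t ∣ ∣ ρ ∣ᵉ))))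
    (r-seq (toX-run srcE s (env ρ) t (env ρ) x y) (dup-run t (r-end refl)))
  pick-run (suc i) (t ∷ ρ) {s} {x} {y} = r-wk
    (≤-trans (+-monoʳ-≤ (9 * ∣ t ∣) (+-monoʳ-≤ (13 * ∣ ρ ∣ᵉ) (+1-≤ 2 t)))
      (≤-trans (≤-reflexive (eq ∣ t ∣ ∣ ρ ∣ᵉ)) (≤-trans (+-monoˡ-≤ (13 * ∣ ρ ∣ᵉ) (*-monoˡ-≤ ∣ t ∣ (n≤1+n 12))) (≤-reflexive (sym (*-distribˡ-+ 13 ∣ t ∣ ∣ ρ ∣ᵉ))))))
    (r-seq (toX-run srcE s (env ρ) t (env ρ) x y)
      (r-seq (pick-run i ρ) (toE-run t (r-end refl))))
    where
    open +-*-Solver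
    eq : ∀ a b → 9 * a + (13 * b + 3 * a) ≡ 12 * a + 13 * b
    eq = solve 2 (λ a b → con 9 :* a :+ (con 13 :* b :+ con 3 :* a) := con 12 :* a :+ con 13 :* b) refl

  comp-run : ∀ {m} (e : Exp m) (ρ : Vec D m) {s x y} →
    Run (comp e) ⟨ s , env ρ , x , y ⟩ (cost e ρ) ⟨ code (eval e ρ) s , env ρ , x , y ⟩
  case-run : ∀ {m} f g h (ρ : Vec D m) t {s x y} →
    Run (pop kS (byArity f g h)) ⟨ code t s , env ρ , x , y ⟩ (suc (caseCost f g h ρ t))
        ⟨ code (caseD (λ l → eval (f l) ρ) (λ l x → eval (g l) (x ∷ ρ)) (λ l x y → eval (h l) (y ∷ x ∷ ρ)) t) s
        , env ρ , x , y ⟩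
  cata-run : ∀ {m} f g h (ρ : Vec D m) t {s x y n σ'} →
    Run (loop kX (byArity f g h)) ⟨ code (foldE f g h ρ t) s , env ρ , x , y ⟩ n σ' →
    Run (loop kX (byArity f g h)) ⟨ s , env ρ , rcode t x , y ⟩ (cataCost f g h ρ t + n) σ'
  comp-run (var i) ρ = pick-run i ρ
  comp-run (k0 l) ρ = r-push
  comp-run (k1 l e) ρ = r-seq (comp-run e ρ) r-push
  comp-run (k2 l e e') ρ = r-seq (comp-run e' ρ) (r-seq (comp-run e ρ) r-push)
  comp-run (bind e e') ρ = r-seq (comp-run e ρ) (local1-run (eval e ρ) (comp-run e' (eval e ρ ∷ ρ)))
  comp-run (case e f g h) ρ = r-seq (comp-run e ρ) (case-run f g h ρ (eval e ρ))
  comp-run (cata e f g h) ρ {s} {x} {y} = r-seq (comp-run e ρ) (r-wk bound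
    (r-seq (toX-run srcS s (env ρ) (eval e ρ) s x y) (cata-run f g h ρ (eval e ρ) (r-end refl))))
    where
    t = eval e ρ
    bound : 9 * ∣ t ∣ + (cataCost f g h ρ t + 1) ≤ 10 * ∣ t ∣ + cataCost f g h ρ t
    bound = ≤-trans (≤-reflexive (eq ∣ t ∣ (cataCost f g h ρ t)))
      (+-monoˡ-≤ (cataCost f g h ρ t) (+1-≤ 9 t))
      where
      open +-*-Solver
      eq : ∀ a c → 9 * a + (c + 1) ≡ (9 * a + 1) + c
      eq = solve 2 (λ a c → con 9 :* a :+ (c :+ con 1) := (con 9 :* a :+ con 1) :+ c) refl
  case-run f g h ρ (n0 l) = r-pop (comp-run (f l) ρ)
  case-run f g h ρ (n1 l a) = r-pop (local1-run a (comp-run (g l) (a ∷ ρ)))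
  case-run f g h ρ (n2 l a b) = r-pop (local2-run a b (comp-run (h l) (b ∷ a ∷ ρ)))
  cata-run f g h ρ (n0 l) r = r-step (λ ()) (comp-run (f l) ρ) r
  cata-run f g h ρ (n1 l a) r = ≡-wk (sym (+-assoc (cataCost f g h ρ a) _ _))
    (cata-run f g h ρ a (r-step (λ ()) (local1-run (foldE f g h ρ a) (comp-run (g l) (foldE f g h ρ a ∷ ρ))) r))
  cata-run f g h ρ (n2 l a b) {n = n} r = ≡-wk
    (trans (cong (cataCost f g h ρ b +_) (sym (+-assoc (cataCost f g h ρ a) _ n)))
           (sym (+-assoc (cataCost f g h ρ b) _ n)))
    (cata-run f g h ρ b (cata-run f g h ρ a
      (r-step (λ ()) (local2-run (foldE f g h ρ a) (foldE f g h ρ b)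
        (comp-run (h l) (foldE f g h ρ b ∷ foldE f g h ρ a ∷ ρ))) r)))

-- Simulation of the four stacks on an ideal one-sided tape.

module IdealTape where

  open import Defs using (Move; L; R)
  open TreeLanguage
  open import Data.Nat using (ℕ; zero; suc; pred; _+_; _*_; _≤_; _<_; z≤n; s≤s; _≡ᵇ_)
  open import Data.Nat.Properties
  open import Data.Nat.Solver using (module +-*-Solver)
  open import Data.Bool using (T)
  open import Data.List using (List; []; _∷_; length)
  open import Function using (_∘_)

  -- All stacks grow to the right from cell 0; `mark` singles out this cell so that the head finds
  -- its way back after each operation.
  record Cell : Set where
    constructor cell⟨_,_,_,_,_⟩
    field
      mark : Bool
      cS cE cX cY : Maybe Sym
  open Cell public

  track : Stk → Cell → Maybe Sym
  track kS = cS
  track kE = cE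
  track kX = cX
  track kY = cY

  write : Stk → Maybe Sym → Cell → Cell
  write kS v cell⟨ b , s , e , x , y ⟩ = cell⟨ b , v , e , x , y ⟩
  write kE v cell⟨ b , s , e , x , y ⟩ = cell⟨ b , s , v , x , y ⟩
  write kX v cell⟨ b , s , e , x , y ⟩ = cell⟨ b , s , e , v , y ⟩
  write kY v cell⟨ b , s , e , x , y ⟩ = cell⟨ b , s , e , x , v ⟩

  Act : Set → Set
  Act Q = Maybe Q × Cell × Move

  route : ∀ {Q Q' : Set} → (Q → Q') → Maybe Q' → Act Q → Act Q'
  route f x (q , w , m) = maybe′ (just ∘ f) x q , w , m

  data PushQ : Set where
    seek back : PushQ

  data PopQ : Set where
    seek take : PopQ
    back    : Sym → PopQ

  pushδ : Stk → Sym → PushQ → Cell → Act PushQ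
  pushδ k s seek c with track k c
  ... | nothing = just back , write k (just s) c , L
  ... | just _  = just seek , c , R
  pushδ k s back c = (if mark c then nothing else just back) , c , L

  popδ : Stk → PopQ → Cell → (PopQ ⊎ Sym) × Cell × Move
  popδ k seek c with track k c
  ... | nothing = inj₁ take , c , L
  ... | just _  = inj₁ seek , c , R
  popδ k take c with track k c
  -- Only on an empty stack: the left move from cell 0 stayed there, so the cell read is still free.
  ... | nothing = inj₁ (back #) , write k nothing c , L
  ... | just s  = inj₁ (back s) , write k nothing c , L
  popδ k (back s) c = (if mark c then inj₂ s else inj₁ (back s)) , c , L

  QC : Cmd → Set
  QC (push k s) = PushQ
  QC (pop k f)  = PopQ ⊎ Σ Sym (λ s → QC (f s))
  QC (loop k f) = PopQ ⊎ Σ Sym (λ s → QC (f s))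
  QC (c ∙ c')   = QC c ⊎ QC c'
  QC skip       = ⊤

  startC : ∀ c → QC c
  startC (push k s) = seek
  startC (pop k f)  = inj₁ seek
  startC (loop k f) = inj₁ seek
  startC (c ∙ c')   = inj₁ (startC c)
  startC skip       = tt

  routePop : ∀ {Q Q' : Set} → (PopQ → Q') → (Sym → Maybe Q') → (PopQ ⊎ Sym) × Cell × Move → Act Q'
  routePop ι x (inj₁ q , w , m) = just (ι q) , w , m
  routePop ι x (inj₂ s , w , m) = x s , w , m

  enter again : (f : Sym → Cmd) → Sym → Maybe (PopQ ⊎ Σ Sym (λ s → QC (f s)))
  enter f s = just (inj₂ (s , startC (f s)))
  again f # = nothing
  again f s = enter f s

  δC : ∀ c → QC c → Cell → Act (QC c)
  δC (push k s) q c                = pushδ k s q c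
  δC (pop k f) (inj₁ q) c          = routePop {PopQ} inj₁ (enter f) (popδ k q c)
  δC (pop k f) (inj₂ (s , q)) c    = route (λ q' → inj₂ (s , q')) nothing (δC (f s) q c)
  δC (loop k f) (inj₁ q) c         = routePop {PopQ} inj₁ (again f) (popδ k q c)
  δC (loop k f) (inj₂ (s , q)) c   = route (λ q' → inj₂ (s , q')) (just (inj₁ seek)) (δC (f s) q c)
  δC (c₁ ∙ c₂) (inj₁ q) c          = route inj₁ (just (inj₂ (startC c₂))) (δC c₁ q c)
  δC (c₁ ∙ c₂) (inj₂ q) c          = route inj₂ nothing (δC c₂ q c)
  δC skip tt c                     = nothing , c , L

  _[_≔_] : (ℕ → Cell) → ℕ → Cell → ℕ → Cell
  (T [ p ≔ w ]) i = if i ≡ᵇ p then w else T i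

  move : Move → ℕ → ℕ
  move L = pred
  move R = suc

  -- At the left end 0 a left move stays in place, because pred 0 = 0.
  data Steps {Q : Set} (δ : Q → Cell → Act Q) : ℕ → Maybe Q → ℕ → (ℕ → Cell) → Maybe Q → ℕ → (ℕ → Cell) → Set where
    done : ∀ {q p T T'} → T ≗ T' → Steps δ 0 q p T q p T'
    step : ∀ {n q p T q' w m q″ p″ T″} → δ q (T p) ≡ (q' , w , m) → Steps δ n q' (move m p) (T [ p ≔ w ]) q″ p″ T″ →
           Steps δ (suc n) (just q) p T q″ p″ T″

  ≡ᵇ-true : ∀ i p → (i ≡ᵇ p) ≡ true → i ≡ p
  ≡ᵇ-true i p e = ≡ᵇ⇒≡ i p (subst T (sym e) tt)

  ≡ᵇ-refl : ∀ i → (i ≡ᵇ i) ≡ true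
  ≡ᵇ-refl zero    = refl
  ≡ᵇ-refl (suc i) = ≡ᵇ-refl i

  ≔-cong : ∀ {T T'} p w → T ≗ T' → T [ p ≔ w ] ≗ T' [ p ≔ w ]
  ≔-cong p w e i with i ≡ᵇ p
  ... | true  = refl
  ... | false = e i

  ≔-same : ∀ T p → T [ p ≔ T p ] ≗ T
  ≔-same T p i with i ≡ᵇ p in eq
  ... | true  = cong T (sym (≡ᵇ-true i p eq))
  ... | false = refl

  module _ {Q : Set} {δ : Q → Cell → Act Q} where

    -- Tapes are functions and are identified only pointwise, so runs have to be carried along
    -- pointwise equality.
    steps-resp : ∀ {n q p T T₀ q' p' T'} → T₀ ≗ T → Steps δ n q p T q' p' T' → Steps δ n q p T₀ q' p' T'
    steps-resp e (done e') = done (λ i → trans (e i) (e' i))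
    steps-resp {p = p} e (step {q = q} {w = w} eq s) =
      step (trans (cong (δ q) (e p)) eq) (steps-resp (≔-cong p w e) s)

    steps-trans : ∀ {n m q p T q' p' T' q″ p″ T″} → Steps δ n q p T q' p' T' → Steps δ m q' p' T' q″ p″ T″ →
      Steps δ (n + m) q p T q″ p″ T″
    steps-trans (done e) s' = steps-resp e s'
    steps-trans (step eq s) s' = step eq (steps-trans s s')

    step-keep : ∀ {n q p T q' m q″ p″ T″} → δ q (T p) ≡ (q' , T p , m) → Steps δ n q' (move m p) T q″ p″ T″ →
      Steps δ (suc n) (just q) p T q″ p″ T″
    step-keep {p = p} {T} eq s = step eq (steps-resp (≔-same T p) s)

    sweep-right : ∀ k {T} g → (∀ {c s} → track k c ≡ just s → δ g c ≡ (just g , c , R)) →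
      ∀ d p → (∀ {i} → i < d + p → ∃[ s ] track k (T i) ≡ just s) → Steps δ d (just g) p T (just g) (d + p) T
    sweep-right k g h zero p f = done (λ _ → refl)
    sweep-right k {T} g h (suc d) p f = step-keep (h (proj₂ (f (s≤s (m≤n+m p d)))))
      (subst (λ l → Steps δ d (just g) (suc p) T (just g) l T) (+-suc d p)
        (sweep-right k g h d (suc p) (λ {i} lt → f (subst (i <_) (+-suc d p) lt))))

    sweep-left : ∀ {T x} b → (∀ {c} → mark c ≡ false → δ b c ≡ (just b , c , L)) →
      (∀ {c} → mark c ≡ true → δ b c ≡ (x , c , L)) → (∀ i → mark (T i) ≡ (i ≡ᵇ 0)) →
      ∀ p → Steps δ (suc p) (just b) p T x 0 T
    sweep-left b h h' m zero    = step-keep (h' (m 0)) (done (λ _ → refl))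
    sweep-left b h h' m (suc p) = step-keep (h (m (suc p))) (sweep-left b h h' m p)

  lift-steps : ∀ {Q Q' : Set} {δ : Q → Cell → Act Q} {δ' : Q' → Cell → Act Q'} (f : Q → Q') (x : Maybe Q') →
    (∀ q c → δ' (f q) c ≡ route f x (δ q c)) → ∀ {n q p T q' p' T'} → Steps δ n q p T q' p' T' →
    Steps δ' n (maybe′ (just ∘ f) x q) p T (maybe′ (just ∘ f) x q') p' T'
  lift-steps f x h (done e) = done e
  lift-steps f x h (step {q = q} {p} {T} eq s) = step (trans (h q (T p)) (cong (route f x) eq)) (lift-steps f x h s)

  -- Bottom of the stack at position 0.
  at : List Sym → ℕ → Maybe Sym
  at []      i = nothing
  at (s ∷ r) i = if i ≡ᵇ length r then just s else at r i

  tape : St → ℕ → Cell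
  tape σ i = cell⟨ i ≡ᵇ 0 , at (σS σ) i , at (σE σ) i , at (σX σ) i , at (σY σ) i ⟩

  at-inside : ∀ w {i} → i < length w → ∃[ s ] at w i ≡ just s
  at-inside (s ∷ r) {i} lt with i ≡ᵇ length r in eq
  ... | true  = s , refl
  ... | false = at-inside r (≤∧≢⇒< (≤-pred lt) λ { refl → false≢true (trans (sym eq) (≡ᵇ-refl i)) })
    where
    false≢true : false ≢ true
    false≢true ()

  at-outside : ∀ w {i} → length w ≤ i → at w i ≡ nothing
  at-outside [] _ = refl
  at-outside (s ∷ r) {i} le with i ≡ᵇ length r in eq
  ... | true  = ⊥-elim (<-irrefl (sym (≡ᵇ-true i _ eq)) le)
  ... | false = at-outside r (≤-trans (n≤1+n _) le)

  track-tape : ∀ k σ i → track k (tape σ i) ≡ at (get k σ) i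
  track-tape kS σ i = refl
  track-tape kE σ i = refl
  track-tape kX σ i = refl
  track-tape kY σ i = refl

  tape-set : ∀ k w σ i → tape (set k w σ) i ≡ write k (at w i) (tape σ i)
  tape-set kS w σ i = refl
  tape-set kE w σ i = refl
  tape-set kX w σ i = refl
  tape-set kY w σ i = refl

  write-same : ∀ k σ i → write k (at (get k σ) i) (tape σ i) ≡ tape σ i
  write-same kS σ i = refl
  write-same kE σ i = refl
  write-same kX σ i = refl
  write-same kY σ i = refl

  push-tape : ∀ k s σ → let ℓ = length (get k σ) in
    tape σ [ ℓ ≔ write k (just s) (tape σ ℓ) ] ≗ tape (set k (s ∷ get k σ) σ)
  push-tape k s σ i rewrite tape-set k (s ∷ get k σ) σ i with i ≡ᵇ length (get k σ) in eq
  ... | true rewrite ≡ᵇ-true i _ eq = refl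
  ... | false = sym (write-same k σ i)

  pop-tape : ∀ k σ → let p = length (tl (get k σ)) in
    tape σ [ p ≔ write k nothing (tape σ p) ] ≗ tape (popped k σ)
  pop-tape k σ i = trans (cases i (get k σ) refl) (sym (tape-set k (tl (get k σ)) σ i))
    where
    cases : ∀ i w → get k σ ≡ w → (tape σ [ length (tl w) ≔ write k nothing (tape σ (length (tl w))) ]) i
       ≡ write k (at (tl w) i) (tape σ i)
    cases zero [] e = refl
    cases (suc i) [] e = trans (sym (write-same k σ (suc i))) (cong (λ w → write k (at w (suc i)) (tape σ (suc i))) e)
    cases i (s ∷ r) e with i ≡ᵇ length r in eq
    ... | true rewrite ≡ᵇ-true i _ eq = cong (λ v → write k v (tape σ (length r))) (sym (at-outside r ≤-refl))
    ... | false = trans (sym (write-same k σ i))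
          (cong (λ v → write k v (tape σ i)) (trans (cong (λ w → at w i) e) (cong (λ b → if b then just s else at r i) eq)))

  inside : ∀ k σ {i} → i < length (get k σ) → ∃[ s ] track k (tape σ i) ≡ just s
  inside k σ {i} lt = let (s , e) = at-inside (get k σ) lt in s , trans (track-tape k σ i) e

  module _ {Q : Set} {δ : Q → Cell → Act Q} where

    -- There are `ℓ` steps to the first free cell, one that writes there, and `suc (pred ℓ)` for the
    -- return including the test of the mark.
    push-steps : ∀ {k s} (ι : PushQ → Q) x → (∀ q c → δ (ι q) c ≡ route ι x (pushδ k s q c)) → ∀ σ →
      let ℓ = length (get k σ) in
      Steps δ (ℓ + suc (suc (pred ℓ))) (just (ι seek)) 0 (tape σ) x 0 (tape (set k (s ∷ get k σ) σ))
    push-steps {k} {s} ι x h σ = steps-trans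
      (subst (λ l → Steps δ ℓ (just (ι seek)) 0 (tape σ) (just (ι seek)) l (tape σ)) (+-identityʳ ℓ)
        (sweep-right k (ι seek) right ℓ 0 (λ {i} lt → inside k σ (subst (i <_) (+-identityʳ ℓ) lt))))
      (step (trans (h seek _) writes) (steps-resp (push-tape k s σ)
        (sweep-left (ι back) (λ {c} → left c) (λ {c} → stop c) (λ i → refl) (pred ℓ))))
      where
      ℓ = length (get k σ)
      right : ∀ {c b} → track k c ≡ just b → δ (ι seek) c ≡ (just (ι seek) , c , R)
      right {c} e = trans (h seek c) (lemma e)
        where
        lemma : ∀ {b} → track k c ≡ just b → route ι x (pushδ k s seek c) ≡ (just (ι seek) , c , R)
        lemma e rewrite e = refl
      writes : route ι x (pushδ k s seek (tape σ ℓ)) ≡ (just (ι back) , write k (just s) (tape σ ℓ) , L)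
      writes rewrite trans (track-tape k σ ℓ) (at-outside (get k σ) ≤-refl) = refl
      left : ∀ c → mark c ≡ false → δ (ι back) c ≡ (just (ι back) , c , L)
      left c e rewrite h back c | e = refl
      stop : ∀ c → mark c ≡ true → δ (ι back) c ≡ (x , c , L)
      stop c e rewrite h back c | e = refl

    -- The first free cell only shows where the stack ends; the symbol is taken from the cell to its
    -- left. The return starts at `pred (pred ℓ)`, which is also right for an empty stack, where
    -- both left moves stay at 0.
    pop-steps : ∀ {k} (ι : PopQ → Q) (x : Sym → Maybe Q) →
      (∀ q c → δ (ι q) c ≡ routePop {PopQ} ι x (popδ k q c)) → ∀ σ →
      let ℓ = length (get k σ) in
      Steps δ (ℓ + suc (suc (suc (pred (pred ℓ))))) (just (ι seek)) 0 (tape σ) (x (hd (get k σ))) 0 (tape (popped k σ))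
    pop-steps {k} ι x h σ = steps-trans
      (subst (λ l → Steps δ ℓ (just (ι seek)) 0 (tape σ) (just (ι seek)) l (tape σ)) (+-identityʳ ℓ)
        (sweep-right k (ι seek) right ℓ 0 (λ {i} lt → inside k σ (subst (i <_) (+-identityʳ ℓ) lt))))
      (step-keep (trans (h seek _) turn) (step (trans (h take _) grab)
        (subst (λ l → Steps δ (suc (pred (pred ℓ))) (just (ι (back (hd (get k σ))))) (pred (pred ℓ))
                        (tape σ [ l ≔ write k nothing (tape σ l) ]) (x (hd (get k σ))) 0 (tape (popped k σ)))
               len-tl
          (steps-resp (pop-tape k σ)
            (sweep-left (ι (back (hd (get k σ)))) (λ {c} → left c) (λ {c} → stop c) (λ i → refl) (pred (pred ℓ)))))))
      where
      ℓ = length (get k σ)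
      len-tl : length (tl (get k σ)) ≡ pred ℓ
      len-tl with get k σ
      ... | []    = refl
      ... | _ ∷ _ = refl
      right : ∀ {c b} → track k c ≡ just b → δ (ι seek) c ≡ (just (ι seek) , c , R)
      right {c} e = trans (h seek c) (lemma e)
        where
        lemma : ∀ {b} → track k c ≡ just b → routePop {PopQ} ι x (popδ k seek c) ≡ (just (ι seek) , c , R)
        lemma e rewrite e = refl
      turn : routePop {PopQ} ι x (popδ k seek (tape σ ℓ)) ≡ (just (ι take) , tape σ ℓ , L)
      turn rewrite trans (track-tape k σ ℓ) (at-outside (get k σ) ≤-refl) = refl
      reads : ∀ w → get k σ ≡ w → track k (tape σ (pred (length w))) ≡ nothing × hd w ≡ # ⊎
        track k (tape σ (pred (length w))) ≡ just (hd w)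
      reads [] e = inj₁ (trans (track-tape k σ 0) (cong (λ w → at w 0) e) , refl)
      reads (s ∷ r) e = inj₂ (trans (track-tape k σ (length r)) (trans (cong (λ w → at w (length r)) e)
        (cong (λ b → if b then just s else at r (length r)) (≡ᵇ-refl (length r)))))
      grab : routePop {PopQ} ι x (popδ k take (tape σ (pred ℓ)))
        ≡ (just (ι (back (hd (get k σ)))) , write k nothing (tape σ (pred ℓ)) , L)
      grab with reads (get k σ) refl
      ... | inj₁ (e , e') rewrite e | e' = refl
      ... | inj₂ e rewrite e = refl
      left : ∀ c → mark c ≡ false → δ (ι (back (hd (get k σ)))) c ≡ (just (ι (back (hd (get k σ)))) , c , L)
      left c e rewrite h (back (hd (get k σ))) c | e = refl
      stop : ∀ c → mark c ≡ true → δ (ι (back (hd (get k σ)))) c ≡ (x (hd (get k σ)) , c , L)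
      stop c e rewrite h (back (hd (get k σ))) c | e = refl

  height : St → ℕ
  height ⟨ s , e , x , y ⟩ = length s + (length e + (length x + length y))

  get≤height : ∀ k σ → length (get k σ) ≤ height σ
  get≤height kS ⟨ s , e , x , y ⟩ = m≤m+n _ _
  get≤height kE ⟨ s , e , x , y ⟩ = ≤-trans (m≤m+n _ _) (m≤n+m _ (length s))
  get≤height kX ⟨ s , e , x , y ⟩ = ≤-trans (≤-trans (m≤m+n _ _) (m≤n+m _ (length e))) (m≤n+m _ (length s))
  get≤height kY ⟨ s , e , x , y ⟩ = ≤-trans (≤-trans (m≤n+m _ (length x)) (m≤n+m _ (length e))) (m≤n+m _ (length s))

  set-height : ∀ k w σ {d} → length w ≤ d + length (get k σ) → height (set k w σ) ≤ d + height σ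
  set-height kS w ⟨ s , e , x , y ⟩ {d} le = ≤-trans (+-monoˡ-≤ _ le) (≤-reflexive (+-assoc d (length s) _))
  set-height kE w ⟨ s , e , x , y ⟩ {d} le = ≤-trans (+-monoʳ-≤ (length s) (+-monoˡ-≤ _ le))
    (≤-reflexive (solve 4 (λ s d e z → s :+ ((d :+ e) :+ z) := d :+ (s :+ (e :+ z))) refl
      (length s) d (length e) (length x + length y)))
    where open +-*-Solver
  set-height kX w ⟨ s , e , x , y ⟩ {d} le = ≤-trans (+-monoʳ-≤ (length s) (+-monoʳ-≤ (length e) (+-monoˡ-≤ _ le)))
    (≤-reflexive (solve 5 (λ s e d x y → s :+ (e :+ ((d :+ x) :+ y)) := d :+ (s :+ (e :+ (x :+ y)))) refl
      (length s) (length e) d (length x) (length y)))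
    where open +-*-Solver
  set-height kY w ⟨ s , e , x , y ⟩ {d} le = ≤-trans (+-monoʳ-≤ (length s) (+-monoʳ-≤ (length e) (+-monoʳ-≤ (length x) le)))
    (≤-reflexive (solve 5 (λ s e d x y → s :+ (e :+ (x :+ (d :+ y))) := d :+ (s :+ (e :+ (x :+ y)))) refl
      (length s) (length e) d (length x) (length y)))
    where open +-*-Solver

  popped-height : ∀ k σ → height (popped k σ) ≤ height σ
  popped-height k σ = set-height k (tl (get k σ)) σ (tl-len (get k σ))
    where
    tl-len : ∀ w → length (tl w) ≤ length w
    tl-len []      = z≤n
    tl-len (_ ∷ w) = n≤1+n _

  +-swap : ∀ m n h → m + (n + h) ≡ (n + m) + h
  +-swap m n h = trans (sym (+-assoc m n h)) (cong (_+ h) (+-comm m n))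

  run-height : ∀ {c σ n σ'} → Run c σ n σ' → height σ' ≤ n + height σ
  run-height (r-push {k} {s} {σ}) = set-height k (s ∷ get k σ) σ ≤-refl
  run-height r-skip = n≤1+n _
  run-height (r-pop {k} {σ = σ} {n} r) =
    ≤-trans (run-height r) (≤-trans (+-monoʳ-≤ n (popped-height k σ)) (n≤1+n _))
  run-height (r-end {k} {σ = σ} _) = ≤-trans (popped-height k σ) (n≤1+n _)
  run-height (r-step {k} {σ = σ} {n} {m} _ r r') = ≤-trans (run-height r')
    (≤-trans (+-monoʳ-≤ m (≤-trans (run-height r) (+-monoʳ-≤ n (popped-height k σ))))
      (≤-trans (≤-reflexive (+-swap m n (height σ))) (n≤1+n _)))
  run-height (r-seq {σ = σ} {n} {m} r r') = ≤-trans (run-height r')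
    (≤-trans (+-monoʳ-≤ m (run-height r)) (≤-reflexive (+-swap m n (height σ))))
  run-height {σ = σ} (r-wk le r) = ≤-trans (run-height r) (+-monoˡ-≤ (height σ) le)

  Timed : ∀ c → St → ℕ → St → Set
  Timed c σ b σ' = ∃[ t ] (t ≤ b × Steps (δC c) t (just (startC c)) 0 (tape σ) nothing 0 (tape σ'))

  opCost : ℕ → ℕ
  opCost H = 3 + (H + H)

  op-bound : ∀ {ℓ H} → ℓ ≤ H → ℓ + suc (suc (suc (pred (pred ℓ)))) ≤ opCost H
  op-bound {ℓ} {H} le = ≤-trans (+-mono-≤ le (s≤s (s≤s (s≤s (≤-trans (≤-trans (pred[n]≤n {pred ℓ}) (pred[n]≤n {ℓ})) le)))))
    (≤-reflexive (trans (+-suc H _) (cong suc (trans (+-suc H _) (cong suc (+-suc H H))))))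

  op-bound' : ∀ {ℓ H} → ℓ ≤ H → ℓ + suc (suc (pred ℓ)) ≤ opCost H
  op-bound' {ℓ} {H} le = ≤-trans (+-mono-≤ le (s≤s (s≤s (≤-trans (pred[n]≤n {ℓ}) le))))
    (≤-trans (≤-reflexive (trans (+-suc H _) (cong suc (+-suc H H)))) (n≤1+n _))

  -- An operation raises the total height by at most one, so every stack stays within `n` plus the
  -- initial height. Fixing this bound `H` throughout gives all operations the same price.
  run-timed : ∀ {c σ n σ'} → Run c σ n σ' → ∀ H → n + height σ ≤ H → Timed c σ (n * opCost H) σ'
  run-timed (r-push {k} {s} {σ}) H le =
    _ , ≤-trans (op-bound' (≤-trans (get≤height k σ) (≤-trans (n≤1+n _) le))) (≤-reflexive (sym (+-identityʳ _))) ,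
    push-steps (λ q → q) nothing (λ q c → route-id (pushδ k s q c)) σ
    where
    route-id : ∀ {Q : Set} (a : Act Q) → a ≡ route (λ q → q) nothing a
    route-id (just _ , _ , _) = refl
    route-id (nothing , _ , _) = refl
  run-timed r-skip H le = 1 , s≤s z≤n , step-keep refl (done (λ _ → refl))
  run-timed (r-pop {k} {f} {σ} {n} r) H le =
    let (t , b , s) = run-timed r H (≤-trans (+-monoʳ-≤ n (popped-height k σ)) (≤-trans (n≤1+n _) le))
    in _ , +-mono-≤ (op-bound (≤-trans (get≤height k σ) (≤-trans (m≤n+m (height σ) (suc n)) le))) b ,
       steps-trans (pop-steps inj₁ (enter f) (λ q c → refl) σ) (lift-steps (λ q → inj₂ (_ , q)) nothing (λ q c → refl) s)
  run-timed (r-end {k} {f} {σ} e) H le =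
    _ , ≤-trans (op-bound (≤-trans (get≤height k σ) (≤-trans (n≤1+n _) le))) (≤-reflexive (sym (+-identityʳ _))) ,
    subst (λ x → Steps (δC (loop k f)) _ _ 0 (tape σ) x 0 (tape (popped k σ))) (cong (again f) e)
      (pop-steps inj₁ (again f) (λ q c → refl) σ)
  run-timed (r-step {k} {f} {σ} {n} {m} {σ'} ne r r') H le =
    let (t , b , s) = run-timed r H (≤-trans (+-monoʳ-≤ n (popped-height k σ))
                        (≤-trans (+-monoˡ-≤ (height σ) (m≤m+n n m)) (≤-trans (n≤1+n _) le)))
        (t' , b' , s') = run-timed r' H (≤-trans (+-monoʳ-≤ m (≤-trans (run-height r) (+-monoʳ-≤ n (popped-height k σ))))
                        (≤-trans (≤-reflexive (+-swap m n (height σ))) (≤-trans (n≤1+n _) le)))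
    in _ , +-mono-≤ (op-bound (≤-trans (get≤height k σ) (≤-trans (m≤n+m (height σ) (suc (n + m))) le)))
             (≤-trans (+-mono-≤ b b') (≤-reflexive (sym (*-distribʳ-+ (opCost H) n m)))) ,
       steps-trans (subst (λ x → Steps (δC (loop k f)) _ _ 0 (tape σ) x 0 (tape (popped k σ))) (again-enter _ ne)
                      (pop-steps inj₁ (again f) (λ q c → refl) σ))
         (steps-trans (lift-steps (λ q → inj₂ (_ , q)) (just (inj₁ seek)) (λ q c → refl) s) s')
    where
    again-enter : ∀ s → s ≢ # → again f s ≡ enter f s
    again-enter # ne = ⊥-elim (ne refl)
    again-enter (y0 _) ne = refl
    again-enter (y1 _) ne = refl
    again-enter (y2 _) ne = refl
  run-timed (r-seq {c} {c'} {σ} {n} {m} r r') H le =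
    let (t , b , s) = run-timed r H (≤-trans (+-monoˡ-≤ (height σ) (m≤m+n n m)) le)
        (t' , b' , s') = run-timed r' H (≤-trans (+-monoʳ-≤ m (run-height r)) (≤-trans (≤-reflexive (+-swap m n (height σ))) le))
    in _ , ≤-trans (+-mono-≤ b b') (≤-reflexive (sym (*-distribʳ-+ (opCost H) n m))) ,
       steps-trans (lift-steps inj₁ (just (inj₂ (startC c'))) (λ q c → refl) s)
                   (lift-steps inj₂ nothing (λ q c → refl) s')
  run-timed {σ = σ} (r-wk {n = n} {m} le' r) H le =
    let (t , b , s) = run-timed r H (≤-trans (+-monoˡ-≤ (height σ) le') le)
    in t , ≤-trans b (*-monoˡ-≤ (opCost H) le') , s

-- Realisation by an actual Turing machine with finite alphabet and state set.

module TuringMachine where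

  open import Defs hiding (eval)
  open TreeLanguage
  open IdealTape
  open Thresholds using (Conn; and; or; imp)
  open import Data.Nat using (ℕ; zero; suc; _+_; _*_; _≤_; _<_; _≡ᵇ_)
  open import Data.Nat.Properties
  open import Data.Nat.Solver using (module +-*-Solver)
  open import Data.Fin using (Fin; _↑ˡ_; _↑ʳ_; splitAt) renaming (zero to fz; suc to fs)
  open import Data.Fin.Properties using (splitAt-↑ˡ; splitAt-↑ʳ)
  open import Data.List using (List; []; _∷_; _++_; length; map; concatMap; lookup; cartesianProduct; _ʳ++_)
  open import Data.List.Relation.Unary.Any using (index) renaming (map to Any-map)
  open import Data.List.Relation.Unary.Any.Properties using (lookup-index)
  open import Function using (_∘_)

  -- Only `dec-enc` is demanded, so the enumeration may contain repetitions.
  record Finite (A : Set) : Set where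
    constructor finite
    field
      elems : List A
      all   : ∀ a → a ∈ elems

    enc : A → Fin (length elems)
    enc a = index (all a)

    dec : Fin (length elems) → A
    dec = lookup elems

    dec-enc : ∀ a → dec (enc a) ≡ a
    dec-enc a = sym (lookup-index (all a))
  open Finite

  fin-image : ∀ {A B : Set} (f : A → B) (g : B → A) → (∀ b → f (g b) ≡ b) → Finite A → Finite B
  fin-image f g fg (finite xs m) = finite (map f xs) λ b → subst (_∈ map f xs) (fg b) (∈-map⁺ f (m (g b)))

  fin-⊎ : ∀ {A B : Set} → Finite A → Finite B → Finite (A ⊎ B)
  fin-⊎ (finite xs m) (finite ys n) = finite (map inj₁ xs ++ map inj₂ ys) λ where
    (inj₁ a) → ∈-++⁺ˡ (∈-map⁺ inj₁ (m a))
    (inj₂ b) → ∈-++⁺ʳ (map inj₁ xs) (∈-map⁺ inj₂ (n b))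

  fin-Σ : ∀ {A : Set} {B : A → Set} → Finite A → (∀ a → Finite (B a)) → Finite (Σ A B)
  fin-Σ {A} {B} (finite xs m) F = finite (concatMap row xs) λ (a , b) →
    ∈-concatMap⁺ row (Any-map (λ { refl → ∈-map⁺ (a ,_) (all (F a) b) }) (m a))
    where
    row : (a : A) → List (Σ A B)
    row a = map (a ,_) (elems (F a))

  fin-× : ∀ {A B : Set} → Finite A → Finite B → Finite (A × B)
  fin-× (finite xs m) (finite ys n) = finite (cartesianProduct xs ys) λ (a , b) → ∈-cartesianProduct⁺ (m a) (n b)

  fin-⊤ : Finite ⊤
  fin-⊤ = finite (tt ∷ []) λ _ → here refl

  fin-Bool : Finite Bool
  fin-Bool = finite (true ∷ false ∷ []) λ { true → here refl ; false → there (here refl) }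

  fin-Maybe : ∀ {A : Set} → Finite A → Finite (Maybe A)
  fin-Maybe (finite xs m) = finite (nothing ∷ map just xs) λ where
    nothing  → here refl
    (just a) → there (∈-map⁺ just (m a))

  fin-Sym : Finite Sym
  fin-Sym = finite (# ∷ y0 ⊤ᶜ ∷ y0 ⊥ᶜ ∷ y0 oᶜ ∷ y1 ¬ᶜ ∷ y1 ◇ᶜ ∷ y1 1ᶜ ∷ y1 τᶜ ∷ y2 ωᶜ ∷ map (y2 ∘ op) conns) λ where
      #           → here refl
      (y0 ⊤ᶜ)     → there (here refl)
      (y0 ⊥ᶜ)     → there (there (here refl))
      (y0 oᶜ)     → there (there (there (here refl)))
      (y1 ¬ᶜ)     → there (there (there (there (here refl))))
      (y1 ◇ᶜ)     → there (there (there (there (there (here refl)))))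
      (y1 1ᶜ)     → there (there (there (there (there (there (here refl))))))
      (y1 τᶜ)     → there (there (there (there (there (there (there (here refl)))))))
      (y2 ωᶜ)     → there (there (there (there (there (there (there (there (here refl))))))))
      (y2 (op c)) → there (there (there (there (there (there (there (there (there (∈-map⁺ (y2 ∘ op) (all-conns c))))))))))
    where
    conns : List Conn
    conns = and ∷ or ∷ imp ∷ []
    all-conns : ∀ c → c ∈ conns
    all-conns and = here refl
    all-conns or  = there (here refl)
    all-conns imp = there (there (here refl))

  opaque
    fin-Cell : Finite Cell
    fin-Cell = fin-image (λ (b , s , e , x , y) → cell⟨ b , s , e , x , y ⟩) (λ c → mark c , cS c , cE c , cX c , cY c)
      (λ c → refl) (fin-× fin-Bool (fin-× ms (fin-× ms (fin-× ms ms))))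
      where
      ms : Finite (Maybe Sym)
      ms = fin-Maybe fin-Sym

  fin-PushQ : Finite PushQ
  fin-PushQ = finite (seek ∷ back ∷ []) λ { seek → here refl ; back → there (here refl) }

  fin-PopQ : Finite PopQ
  fin-PopQ = finite (seek ∷ take ∷ map back (elems fin-Sym)) λ where
    seek     → here refl
    take     → there (here refl)
    (back s) → there (there (∈-map⁺ back (all fin-Sym s)))

  opaque
    fin-QC : ∀ c → Finite (QC c)
    fin-QC (push k s) = fin-PushQ
    fin-QC (pop k f)  = fin-⊎ fin-PopQ (fin-Σ fin-Sym λ s → fin-QC (f s))
    fin-QC (loop k f) = fin-⊎ fin-PopQ (fin-Σ fin-Sym λ s → fin-QC (f s))
    fin-QC (c ∙ c')   = fin-⊎ (fin-QC c) (fin-QC c')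
    fin-QC skip       = fin-⊤

  label : Σsym → Sym
  label fz = y0 ⊤ᶜ
  label (fs fz) = y0 ⊥ᶜ
  label (fs (fs fz)) = y2 (op and)
  label (fs (fs (fs fz))) = y2 (op or)
  label (fs (fs (fs (fs fz)))) = y2 (op imp)
  label (fs (fs (fs (fs (fs fz))))) = y1 ¬ᶜ
  label (fs (fs (fs (fs (fs (fs fz)))))) = y1 ◇ᶜ
  label (fs (fs (fs (fs (fs (fs (fs fz))))))) = y1 1ᶜ
  -- The symbol of a variable, given an arbitrary label: it does not occur in the encodings of
  -- closed formulas.
  label (fs (fs (fs (fs (fs (fs (fs (fs fz)))))))) = y0 oᶜ

  answer : Maybe Sym → Bool
  answer (just (y0 ⊤ᶜ)) = true
  answer _              = false

  data RealQ (Q : Set) : Set where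
    init₀ init₁ rewind final : RealQ Q
    main : Q → RealQ Q

  opaque
    fin-RealQ : ∀ {Q} → Finite Q → Finite (RealQ Q)
    fin-RealQ (finite xs m) = finite (init₀ ∷ init₁ ∷ rewind ∷ final ∷ map main xs) λ where
      init₀    → here refl
      init₁    → there (here refl)
      rewind   → there (there (here refl))
      final    → there (there (there (here refl)))
      (main q) → there (there (there (there (∈-map⁺ main (m q)))))

  module Machine (c : Cmd) (FC : Finite Cell) (FQ : Finite (RealQ (QC c))) where

    e′ : ℕ
    e′ = length (elems FC)

    Γ′ : Set
    Γ′ = Fin (suc (9 + e′))

    emptyCell : Cell
    emptyCell = cell⟨ false , nothing , nothing , nothing , nothing ⟩

    -- Blanks count as empty cells, so the tape to the right of everything written agrees with the
    -- ideal one.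
    view : Γ′ → Cell
    view fz     = emptyCell
    view (fs i) = [ (λ _ → emptyCell) , dec FC ]′ (splitAt 9 i)

    raw : Γ′ → Maybe Σsym
    raw fz     = nothing
    raw (fs i) = [ just , (λ _ → nothing) ]′ (splitAt 9 i)

    wr : Cell → Γ′
    wr w = fs (9 ↑ʳ enc FC w)

    view-wr : ∀ w → view (wr w) ≡ w
    view-wr w = trans (cong [ (λ _ → emptyCell) , dec FC ]′ (splitAt-↑ʳ 9 e′ (enc FC w))) (dec-enc FC w)

    raw-in : ∀ s → raw (fs (s ↑ˡ e′)) ≡ just s
    raw-in s = cong [ just , (λ _ → nothing) ]′ (splitAt-↑ˡ 9 s e′)

    exit : Maybe (QC c) → RealQ (QC c)
    exit (just q) = main q
    exit nothing  = final

    δᴿ : RealQ (QC c) → Γ′ → Bool ⊎ (RealQ (QC c) × Γ′ × Move)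
    δᴿ init₀ γ with raw γ
    ... | just s  = inj₂ (init₁ , wr cell⟨ true , nothing , nothing , just (label s) , nothing ⟩ , R)
    ... | nothing = inj₁ false
    δᴿ init₁ γ with raw γ
    ... | just s  = inj₂ (init₁ , wr cell⟨ false , nothing , nothing , just (label s) , nothing ⟩ , R)
    ... | nothing = inj₂ (rewind , wr emptyCell , L)
    δᴿ rewind γ = inj₂ ((if mark (view γ) then main (startC c) else rewind) , wr (view γ) , L)
    δᴿ (main q) γ = let (q' , w , m) = δC c q (view γ) in inj₂ (exit q' , wr w , m)
    δᴿ final γ = inj₁ (answer (cS (view γ)))

    encode-act : Bool ⊎ (RealQ (QC c) × Γ′ × Move) → Bool ⊎ (Fin (length (elems FQ)) × Γ′ × Move)
    encode-act (inj₁ b)           = inj₁ b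
    encode-act (inj₂ (q , w , m)) = inj₂ (enc FQ q , w , m)

    machine : TM
    machine = record { nQ = length (elems FQ) ; e = e′ ; start = enc FQ init₀
                     ; δ = λ i γ → encode-act (δᴿ (dec FQ i) γ) }

    step-run : ∀ q l h r {q' w m} f → δᴿ q h ≡ inj₂ (q' , w , m) →
      run machine (suc f) (enc FQ q , l , h , r) ≡ run machine f (enc FQ q' , shift machine m l w r)
    step-run q l h r f eq rewrite dec-enc FQ q | eq = refl

    halt-run : ∀ q l h r {b} f → δᴿ q h ≡ inj₁ b → run machine (suc f) (enc FQ q , l , h , r) ≡ just b
    halt-run q l h r f eq rewrite dec-enc FQ q | eq = refl

    data Left (T : ℕ → Cell) : List Γ′ → ℕ → Set where
      []  : Left T [] 0
      _∷_ : ∀ {x l p} → view x ≡ T p → Left T l p → Left T (x ∷ l) (suc p)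

    data Right (T : ℕ → Cell) : List Γ′ → ℕ → Set where
      []  : ∀ {p} → (∀ i → p ≤ i → T i ≡ emptyCell) → Right T [] p
      _∷_ : ∀ {x r p} → view x ≡ T p → Right T r (suc p) → Right T (x ∷ r) p

    record Rel (T : ℕ → Cell) (p : ℕ) (t : List Γ′ × Γ′ × List Γ′) : Set where
      constructor rel
      field
        onLeft  : Left T (proj₁ t) p
        onHead  : view (proj₁ (proj₂ t)) ≡ T p
        onRight : Right T (proj₂ (proj₂ t)) (suc p)

    left-resp : ∀ {T T' l p} → (∀ {i} → i < p → T i ≡ T' i) → Left T l p → Left T' l p
    left-resp h []       = []
    left-resp h (e ∷ ls) = trans e (h ≤-refl) ∷ left-resp (λ lt → h (m≤n⇒m≤1+n lt)) ls

    right-resp : ∀ {T T' r p} → (∀ {i} → p ≤ i → T i ≡ T' i) → Right T r p → Right T' r p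
    right-resp h ([] f)   = [] λ i le → trans (sym (h le)) (f i le)
    right-resp h (e ∷ rs) = trans e (h ≤-refl) ∷ right-resp (λ le → h (≤-trans (n≤1+n _) le)) rs

    rel-resp : ∀ {T T' p t} → T ≗ T' → Rel T p t → Rel T' p t
    rel-resp {p = p} h (rel a b d) = rel (left-resp (λ {i} _ → h i) a) (trans b (h p)) (right-resp (λ {i} _ → h i) d)

    ≔-at : ∀ T p w → (T [ p ≔ w ]) p ≡ w
    ≔-at T p w rewrite ≡ᵇ-refl p = refl

    ≔-other : ∀ T p w {i} → i ≢ p → T i ≡ (T [ p ≔ w ]) i
    ≔-other T p w {i} ne with i ≡ᵇ p in eq
    ... | true  = ⊥-elim (ne (≡ᵇ-true i p eq))
    ... | false = refl

    shift-rel : ∀ {T p l h r} m w → Rel T p (l , h , r) → Rel (T [ p ≔ w ]) (move m p) (shift machine m l (wr w) r)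
    shift-rel {T} {p} {l} {h} {r} m w (rel a b d) = go m l r
        (left-resp (λ lt → ≔-other T p w (<⇒≢ lt)) a)
        (trans (view-wr w) (sym (≔-at T p w)))
        (right-resp (λ le → ≔-other T p w (λ eq → <⇒≢ le (sym eq))) d)
      where
      go : ∀ {T p} m l {h} r → Left T l p → view h ≡ T p → Right T r (suc p) → Rel T (move m p) (shift machine m l h r)
      go L [] r [] b d = rel [] b d
      go L (x ∷ l) r (e ∷ a) b d = rel a e (b ∷ d)
      go R l [] a b ([] f) = rel (b ∷ a) (sym (f _ ≤-refl)) ([] λ i le → f i (≤-trans (n≤1+n _) le))
      go R l (x ∷ r) a b (e ∷ d) = rel (b ∷ a) e d

    main-run : ∀ {n q p T q' p' T'} → Steps (δC c) n q p T q' p' T' → ∀ f {t} → Rel T p t →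
      ∃[ t' ] (Rel T' p' t' × run machine (n + f) (enc FQ (exit q) , t) ≡ run machine f (enc FQ (exit q') , t'))
    main-run (done e) f {t} r = t , rel-resp e r , refl
    main-run (step {n} {q} {p} {T} {q'} {w} {m} eq s) f {l , h , r} rl@(rel _ b _)
      with main-run s f (shift-rel m w rl)
    ... | t' , rl' , e' = t' , rl' , trans (step-run (main q) l h r (n + f) act) e'
      where
      act : δᴿ (main q) h ≡ inj₂ (exit q' , wr w , m)
      act rewrite b | eq = refl

    rewind-run : ∀ {T} → (∀ i → mark (T i) ≡ (i ≡ᵇ 0)) → ∀ p f {t} → Rel T p t →
      ∃[ t' ] (Rel T 0 t' × run machine (suc p + f) (enc FQ rewind , t) ≡ run machine f (enc FQ (main (startC c)) , t'))
    rewind-run {T} mk p f {l , h , r} rl@(rel a b d) = finish p rl refl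
      where
      kept : ∀ p → view h ≡ T p → T [ p ≔ view h ] ≗ T
      kept p b i rewrite b = ≔-same T p i
      act : ∀ {v} → mark (view h) ≡ v →
        δᴿ rewind h ≡ inj₂ ((if v then main (startC c) else rewind) , wr (view h) , L)
      act e rewrite e = refl
      finish : ∀ p' → Rel T p' (l , h , r) → p ≡ p' → ∃[ t' ] (Rel T 0 t' ×
        run machine (suc p + f) (enc FQ rewind , l , h , r) ≡ run machine f (enc FQ (main (startC c)) , t'))
      finish zero rl'@(rel _ b' _) refl = _ , rel-resp (kept 0 b') (shift-rel L (view h) rl') ,
        step-run rewind l h r f (act (trans (cong mark b') (mk 0)))
      finish (suc p') rl'@(rel _ b' _) refl
        with rewind-run mk p' f (rel-resp (kept (suc p') b') (shift-rel L (view h) rl'))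
      ... | t' , rl″ , e = t' , rl″ , trans (step-run rewind l h r (suc p' + f) (act (trans (cong mark b') (mk (suc p'))))) e

    loaded : List Sym → St
    loaded x = ⟨ [] , [] , x , [] ⟩

    after : ∀ x s → tape (loaded (s ∷ x)) (length x) ≡ cell⟨ length x ≡ᵇ 0 , nothing , nothing , just s , nothing ⟩
    after x s rewrite ≡ᵇ-refl (length x) = refl

    before : ∀ x s {i} → i < length x → tape (loaded x) i ≡ tape (loaded (s ∷ x)) i
    before x s {i} lt with i ≡ᵇ length x in eq
    ... | true  = ⊥-elim (<⇒≢ lt (≡ᵇ-true i _ eq))
    ... | false = refl

    inputs : List Σsym → List Γ′
    inputs = map (inSym machine)

    init₀-act : ∀ s → δᴿ init₀ (inSym machine s) ≡
      inj₂ (init₁ , wr cell⟨ true , nothing , nothing , just (label s) , nothing ⟩ , R)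
    init₀-act s rewrite raw-in s = refl

    init₁-act : ∀ s → δᴿ init₁ (inSym machine s) ≡
      inj₂ (init₁ , wr cell⟨ false , nothing , nothing , just (label s) , nothing ⟩ , R)
    init₁-act s rewrite raw-in s = refl

    unread : List Σsym → Γ′ × List Γ′
    unread []      = fz , []
    unread (s ∷ w) = inSym machine s , inputs w

    shift-unread : ∀ l h w → shift machine R l h (inputs w) ≡ (h ∷ l , unread w)
    shift-unread l h []      = refl
    shift-unread l h (s ∷ w) = refl

    -- Loading from left to right puts the last input symbol on top of stack `X`, which therefore
    -- holds the reversed word.
    init₁-run : ∀ w x s l f → Left (tape (loaded (s ∷ x))) l (suc (length x)) →
      ∃[ t' ] (Rel (tape (loaded (map label w ʳ++ (s ∷ x)))) (length w + length x) t' ×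
        run machine (suc (length w) + f) (enc FQ init₁ , l , unread w) ≡ run machine f (enc FQ rewind , t'))
    init₁-run [] x s (y ∷ l) f (e ∷ ls) = _ ,
      rel ls e (trans (view-wr emptyCell) (sym (blank-at (suc (length x)) ≤-refl)) ∷ [] λ i le → blank-at i (≤-trans (n≤1+n _) le)) ,
      step-run init₁ (y ∷ l) fz [] f refl
      where
      blank-at : ∀ i → suc (length x) ≤ i → tape (loaded (s ∷ x)) i ≡ emptyCell
      blank-at (suc i) le = cong (λ v → cell⟨ false , nothing , nothing , v , nothing ⟩) (at-outside (s ∷ x) le)
    init₁-run (b ∷ w) x s l f ls
      with init₁-run w (s ∷ x) (label b) (_ ∷ l) f
        (trans (view-wr _) (sym (after (s ∷ x) (label b))) ∷ left-resp (λ lt → before (s ∷ x) (label b) lt) ls)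
    ... | t' , rl , e = t' , subst (λ p → Rel (tape (loaded (map label w ʳ++ (label b ∷ s ∷ x)))) p t') (+-suc (length w) (length x)) rl ,
      trans (step-run init₁ l (inSym machine b) (inputs w) (suc (length w) + f) (init₁-act b))
        (trans (cong (λ t → run machine (suc (length w) + f) (enc FQ init₁ , t)) (shift-unread l _ w)) e)

    first : Σsym → Cell
    first b = cell⟨ true , nothing , nothing , just (label b) , nothing ⟩

    loaded-height : ∀ w x → height (loaded (map label w ʳ++ x)) ≡ length w + height (loaded x)
    loaded-height [] x = refl
    loaded-height (b ∷ w) x = trans (loaded-height w (label b ∷ x)) (+-suc (length w) _)

    -- Loading and rewinding pass each symbol once, and two further steps are spent at the first
    -- blank and on the answer, whence `2 * N + 2`. The head ends at cell 0, where the bottom of the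
    -- value stack shows the answer.
    accepts : ∀ b w {n σ'} → Run c (loaded (map label (b ∷ w) ʳ++ [])) n σ' → ∀ N → length (b ∷ w) ≤ N → ∀ F →
      2 * N + 2 + n * opCost (n + N) ≤ F → Accepts? machine (b ∷ w) F ≡ just (answer (at (σS σ') 0))
    accepts b w {n} {σ'} r N le F leF
      with run-timed r (n + N) (+-monoʳ-≤ n (≤-trans (≤-reflexive (trans (loaded-height (b ∷ w) []) (+-identityʳ _))) le))
    ... | t , t≤ , st
      with m≤n⇒∃[o]m+o≡n {suc (suc (length w) + (suc (length w + 0) + (t + 1)))} {F} enough
      where
      open +-*-Solver
      total : ∀ l t → suc (suc l + (suc (l + 0) + (t + 1))) ≡ 2 * suc l + 2 + t
      total = solve 2 (λ l t → con 1 :+ ((con 1 :+ l) :+ ((con 1 :+ (l :+ con 0)) :+ (t :+ con 1)))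
                         := con 2 :* (con 1 :+ l) :+ con 2 :+ t) refl
      enough : suc (suc (length w) + (suc (length w + 0) + (t + 1))) ≤ F
      enough = ≤-trans (≤-reflexive (total (length w) t))
        (≤-trans (+-mono-≤ (+-monoˡ-≤ 2 (*-monoʳ-≤ 2 le)) t≤) leF)
    ... | f , refl
      with init₁-run w [] (label b) (wr (first b) ∷ []) (suc (length w + 0) + (t + suc f)) (view-wr (first b) ∷ [])
    ... | t₁ , rl₁ , e₁ with rewind-run (λ i → refl) (length w + 0) (t + suc f) rl₁
    ... | t₂ , rl₂ , e₂ with main-run st (suc f) rl₂
    ... | (l , h , r') , rel _ hd≡ _ , e₃ =
      trans (cong (λ k → run machine k (enc FQ init₀ , [] , unread (b ∷ w))) (fuel (length w) (length w + 0) t f))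
        (trans (step-run init₀ [] (inSym machine b) (inputs w) _ (init₀-act b))
        (trans (cong (λ t' → run machine (suc (length w) + (suc (length w + 0) + (t + suc f))) (enc FQ init₁ , t'))
                (shift-unread [] (wr (first b)) w))
        (trans e₁ (trans e₂ (trans e₃ (trans (halt-run final l h r' f refl) (cong (λ v → just (answer (cS v))) hd≡)))))))
      where
      fuel : ∀ a b t f → suc (suc a + (suc b + (t + 1))) + f ≡ suc (suc a + (suc b + (t + suc f)))
      fuel = solve 4 (λ a b t f → (con 1 :+ ((con 1 :+ a) :+ ((con 1 :+ b) :+ (t :+ con 1)))) :+ f
               := con 1 :+ ((con 1 :+ a) :+ ((con 1 :+ b) :+ (t :+ (con 1 :+ f))))) refl
        where open +-*-Solver

-- The algorithm as programs of the tree language, with their correctness.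

module Programs where

  open Thresholds
  open Completeness
  open TreeLanguage
  open import Data.Nat using (ℕ; zero; suc; _+_; _<_; s≤s)
  open import Data.Nat.Properties
  open import Data.Fin using (Fin; zero; suc)
  open import Data.Vec using (Vec; []; _∷_; lookup)
  open import Data.List using ([]; _∷_)

  encT : T → D
  encT leaf    = n0 oᶜ
  encT (o ⊹ x) = n2 ωᶜ (encT o) (encT x)

  encM : Maybe T → D
  encM nothing  = n0 ⊥ᶜ
  encM (just U) = encT U

  encB : Bool → D
  encB true  = n0 ⊤ᶜ
  encB false = n0 ⊥ᶜ

  ones : ℕ → D → D
  ones zero    a = a
  ones (suc j) a = n1 1ᶜ (ones j a)

  encG : G → D
  encG tt          = n0 ⊤ᶜ
  encG ff          = n0 ⊥ᶜ
  encG (tok W)     = n1 τᶜ (encT W)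
  encG (bin c A B) = n2 (op c) (encG A) (encG B)
  encG (neg A)     = n1 ¬ᶜ (encG A)
  encG (dia j A)   = n1 ◇ᶜ (ones j (encG A))

  -- The function computed at the subtrees of the argument of a cata.
  foldE-of : ∀ {m} → Exp m → Vec D m → D → D
  foldE-of (cata e f g h) = foldE f g h
  foldE-of _ _ t          = t

  layer : ∀ {m} → Exp m → Vec D m → D → D
  layer (cata e f g h) ρ = caseD (λ l → eval (f l) ρ) (λ l x → eval (g l) (x ∷ ρ)) (λ l x y → eval (h l) (y ∷ x ∷ ρ))
  layer _ _ t            = t

  pattern v0 = zero
  pattern v1 = suc zero

  no : ∀ {m} → Exp m
  no = k0 ⊥ᶜ

  onTrue : ∀ {m} → Exp m → Exp m → L0 → Exp m
  onTrue t f ⊤ᶜ = t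
  onTrue t f _  = f

  ifE : ∀ {m} → Exp m → Exp m → Exp m → Exp m
  ifE e t f = case e (onTrue t f) (λ _ → no) (λ _ → no)

  ifE-eval : ∀ {m} (e t f : Exp m) ρ {b} → eval e ρ ≡ encB b → eval (ifE e t f) ρ ≡ (if b then eval t ρ else eval f ρ)
  ifE-eval e t f ρ {true}  eq rewrite eq = refl
  ifE-eval e t f ρ {false} eq rewrite eq = refl

  isNone isOne : ∀ {m} → Fin m → Exp m
  isNone i = case (var i) (λ { ⊥ᶜ → k0 ⊤ᶜ ; _ → no }) (λ _ → no) (λ _ → no)
  isOne i = case (var i) (λ _ → no) (λ { 1ᶜ → k0 ⊤ᶜ ; _ → no }) (λ _ → no)

  isNone-eval : ∀ {m} (i : Fin m) ρ r → lookup ρ i ≡ encM r → eval (isNone i) ρ ≡ encB (refuted r)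
  isNone-eval i ρ nothing  eq rewrite eq = refl
  isNone-eval i ρ (just leaf) eq rewrite eq = refl
  isNone-eval i ρ (just (_ ⊹ _)) eq rewrite eq = refl

  -- A comparison in progress, to be negated or not, is stored with one of two tags.
  tagged : Bool → L2
  tagged false = op and
  tagged true  = op or

  lit : ∀ {m} → Bool → Exp m
  lit true  = k0 ⊤ᶜ
  lit false = k0 ⊥ᶜ

  -- `le` exchanges its arguments, so it is not a fold over either. The program iterates one step of
  -- it on a stored state: once for each summand of the second threshold, once more, and once for
  -- each summand of the first. Exponents are compared by the program for the next smaller height.
  LE STEP : ∀ {m} → ℕ → Fin m → Fin m → Exp m
  compare : ∀ {m} → ℕ → Bool → Exp (suc (suc m))
  stepE : ∀ {m} → ℕ → Fin m → Exp m

  compare h b = case (var v1) (λ _ → lit (not b)) (λ _ → no)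
    (λ _ → case (var (suc (suc v0))) (λ _ → lit b) (λ _ → no)
      (λ _ → ifE (LE h (suc (suc v0)) v0)
        (k2 (tagged (not b)) (var (suc (suc (suc (suc v0))))) (var (suc (suc v1))))
        (k2 (tagged b) (var (suc (suc (suc (suc v1))))) (var v1))))

  stepE {m} h i = case (var i) k0 (λ _ → no) branch
    where
    branch : L2 → Exp (suc (suc m))
    branch (op and) = compare h false
    branch (op or)  = compare h true
    branch _        = no

  STEP h i j = cata (var j) (λ _ → k2 (op and) (var i) (var j)) (λ _ → no) (λ _ → stepE h v1)

  LE zero    i j = k0 ⊤ᶜ
  LE (suc h) i j = cata (var i) (λ _ → bind (STEP h i j) (stepE h v0)) (λ _ → no) (λ _ → stepE h v1)

  EVALB : ∀ {m} → Fin m → Exp m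
  EVALB {m} i = cata (var i) atom unary binary
    where
    atom : L0 → Exp m
    atom ⊤ᶜ = k0 ⊤ᶜ
    atom _  = no
    unary : L1 → Exp (suc m)
    unary ¬ᶜ = ifE (var v0) no (k0 ⊤ᶜ)
    unary _  = no
    binary : L2 → Exp (suc (suc m))
    binary (op and) = ifE (var v1) (var v0) no
    binary (op or)  = ifE (var v1) (k0 ⊤ᶜ) (var v0)
    binary (op imp) = ifE (var v1) (var v0) (k0 ⊤ᶜ)
    binary ωᶜ       = no

  SUB : ∀ {m} → ℕ → Fin m → Fin m → Exp m
  SUB {m} h i w = cata (var i) k0 unary (λ l → k2 l (var v1) (var v0))
    where
    strip : L1 → Exp (suc (suc m))
    strip 1ᶜ = k1 ◇ᶜ (var v0)
    strip _  = no
    unary : L1 → Exp (suc m)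
    unary τᶜ = ifE (LE h v0 (suc w)) (k0 ⊤ᶜ) no
    unary ◇ᶜ = case (var v0) (λ _ → no) strip (λ _ → no)
    unary l  = k1 l (var v0)

  OK : ∀ {m} → ℕ → Fin m → Fin m → Fin m → Exp m
  OK {m} h i w u = cata (var i) atom unary binary
    where
    atom : L0 → Exp m
    atom oᶜ = k0 oᶜ
    atom _  = k0 ⊤ᶜ
    unary : L1 → Exp (suc m)
    unary τᶜ = ifE (LE h v0 (suc w)) (k0 ⊤ᶜ) (ifE (LE h (suc u) v0) (k0 ⊤ᶜ) no)
    unary _  = var v0
    binary : L2 → Exp (suc (suc m))
    binary (op _) = ifE (var v1) (var v0) no
    binary ωᶜ     = k2 ωᶜ (var v1) (var v0)

  SMALLER : ∀ {m} → ℕ → Fin m → Fin m → Exp m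
  SMALLER h i j = ifE (isNone i) (var j) (ifE (isNone j) (var i) (ifE (LE h i j) (var i) (var j)))

  CAND : ∀ {m} → (∀ {m} → Fin m → Exp m) → ℕ → Fin m → Fin m → Exp m
  CAND rec h i w = bind (SUB h i w) (bind (rec v0) (ifE (isNone v0) no
    (bind (k2 ωᶜ (var (suc (suc w))) (var v0))
      (ifE (OK h (suc (suc (suc i))) (suc (suc (suc w))) v0) (var v0) no))))

  bestAtom : ∀ {m} → L0 → Exp m
  bestAtom oᶜ = k0 oᶜ
  bestAtom _  = no

  bestUnary : (∀ {m} → Fin m → Exp m) → ℕ → ∀ {m} → Fin m → L1 → Exp (suc m)
  bestUnary rec h i τᶜ = CAND rec h (suc i) v0
  bestUnary rec h i _  = var v0

  bestBinary : ℕ → ∀ {m} → L2 → Exp (suc (suc m))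
  bestBinary h (op _) = SMALLER h v1 v0
  bestBinary h ωᶜ     = k2 ωᶜ (var v1) (var v0)

  BEST : ∀ {m} → (∀ {m} → Fin m → Exp m) → ℕ → Fin m → Exp m
  BEST rec h i = cata (var i) bestAtom (bestUnary rec h i) (bestBinary h)

  THRESH : ∀ {m} → (∀ {m} → Fin m → Exp m) → ℕ → Fin m → Exp m
  THRESH rec h i = bind (k0 oᶜ) (bind (CAND rec h (suc i) v0) (bind (BEST rec h (suc (suc i))) (SMALLER h v1 v0)))

  procUnary : (∀ {m} → Fin m → Exp m) → ℕ → ∀ {m} → L1 → Exp (suc m)
  procUnary rec h ◇ᶜ = ifE (isOne v0) (k1 ◇ᶜ (var v0)) (bind (THRESH rec h v0) (ifE (isNone v0) no (k1 τᶜ (var v0))))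
  procUnary rec h l  = k1 l (var v0)

  rebuild : ∀ {m} → L2 → Exp (suc (suc m))
  rebuild l = k2 l (var v1) (var v0)

  PROC : ∀ {m} → (∀ {m} → Fin m → Exp m) → ℕ → Fin m → Exp m
  PROC rec h i = cata (var i) k0 (procUnary rec h) rebuild

  MIN : ℕ → ∀ {m} → Fin m → Exp m
  MIN zero    i = ifE (EVALB i) (k0 oᶜ) no
  MIN (suc h) i = bind (PROC (MIN h) (suc h) i) (THRESH (MIN h) (suc h) v0)

  DECIDE : ℕ → Exp 1
  DECIDE n = bind (k1 ¬ᶜ (var v0)) (bind (MIN n v0) (isNone v0))

  data LeState : Set where
    done    : Bool → LeState
    pending : Bool → T → T → LeState

  encS : LeState → D
  encS (done b)        = encB b
  encS (pending b U W) = n2 (tagged b) (encT U) (encT W)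

  xor : Bool → Bool → Bool
  xor false c = c
  xor true  c = not c

  stepS : LeState → LeState
  stepS (done b) = done b
  stepS (pending b leaf W) = done (not b)
  stepS (pending b (o ⊹ x) leaf) = done b
  stepS (pending b (o ⊹ x) (p ⊹ y)) = if le x y then pending (not b) (p ⊹ y) o else pending b (o ⊹ x) p

  spine : T → ℕ
  spine leaf    = 0
  spine (o ⊹ x) = suc (spine o)

  iterS : ℕ → LeState → LeState
  iterS zero    s = s
  iterS (suc n) s = stepS (iterS n s)

  iterS-step : ∀ n s → iterS n (stepS s) ≡ stepS (iterS n s)
  iterS-step zero    s = refl
  iterS-step (suc n) s = cong stepS (iterS-step n s)

  iterS-done : ∀ n b → iterS n (done b) ≡ done b
  iterS-done zero    b = refl
  iterS-done (suc n) b = cong stepS (iterS-done n b)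

  -- Each undecided step removes a summand from one of the two spines, and `b` keeps the parity of
  -- the negations met. The strict inequality leaves one step for reading off the result.
  iterS-le : ∀ n b U W → spine U + spine W < n → iterS n (pending b U W) ≡ done (xor b (le U W))
  iterS-le (suc n) b leaf W lt = trans (sym (iterS-step n _)) (trans (iterS-done n _) (cong done (eq b)))
    where
    eq : ∀ b → not b ≡ xor b true
    eq false = refl
    eq true  = refl
  iterS-le (suc n) b (o ⊹ x) leaf lt = trans (sym (iterS-step n _)) (trans (iterS-done n _) (cong done (eq b)))
    where
    eq : ∀ b → b ≡ xor b false
    eq false = refl
    eq true  = refl
  iterS-le (suc n) b (o ⊹ x) (p ⊹ y) (s≤s lt) = trans (sym (iterS-step n _)) next
    where
    flip : ∀ b c → xor (not b) c ≡ xor b (not c)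
    flip false false = refl
    flip false true  = refl
    flip true  false = refl
    flip true  true  = refl
    next : iterS n (stepS (pending b (o ⊹ x) (p ⊹ y))) ≡ done (xor b (le (o ⊹ x) (p ⊹ y)))
    next with le x y
    ... | true  = trans (iterS-le n (not b) (p ⊹ y) o
                    (≤-trans (s≤s (≤-reflexive (trans (cong suc (+-comm (spine p) (spine o))) (sym (+-suc (spine o) (spine p)))))) lt))
                    (cong done (flip b _))
    ... | false = iterS-le n b (o ⊹ x) p (≤-trans (≤-reflexive (cong suc (sym (+-suc (spine o) (spine p))))) lt)

  -- Thresholds at a level of height h, including the empty one.
  Thr : ℕ → T → Set
  Thr h U = U ≡ leaf ⊎ Ht h U

  thr-base : ∀ {h o x} → Thr (suc h) (o ⊹ x) → Thr (suc h) o
  thr-base (inj₂ (one _))    = inj₁ refl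
  thr-base (inj₂ (more p _)) = inj₂ p

  thr-exp : ∀ {h o x} → Thr (suc h) (o ⊹ x) → Thr h x
  thr-exp (inj₂ p) = inj₂ (ht-exp p)

  GoodState : ℕ → LeState → Set
  GoodState h (done b)        = true ≡ true
  GoodState h (pending b U W) = Thr h U × Thr h W

  stepS-good : ∀ {h} s → GoodState (suc h) s → GoodState (suc h) (stepS s)
  stepS-good (done b) g = refl
  stepS-good (pending b leaf W) g = refl
  stepS-good (pending b (o ⊹ x) leaf) g = refl
  stepS-good (pending b (o ⊹ x) (p ⊹ y)) (g , g') with le x y
  ... | true  = g' , thr-base g
  ... | false = g , thr-base g'

  iterS-good : ∀ {h} n s → GoodState (suc h) s → GoodState (suc h) (iterS n s)
  iterS-good zero    s g = g
  iterS-good (suc n) s g = stepS-good (iterS n s) (iterS-good n s g)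

  lit-eval : ∀ {m} b (ρ : Vec D m) → eval (lit b) ρ ≡ encB b
  lit-eval true  ρ = refl
  lit-eval false ρ = refl

  LE-eval : ∀ {m} h (i j : Fin m) ρ {U W} → lookup ρ i ≡ encT U → lookup ρ j ≡ encT W → Thr h U → Thr h W →
    eval (LE h i j) ρ ≡ encB (le U W)
  compare-eval : ∀ {m} h b (ρ : Vec D m) U W → Thr (suc h) U → Thr (suc h) W →
    eval (compare h b) (encT W ∷ encT U ∷ ρ) ≡ encS (stepS (pending b U W))
  stepE-eval : ∀ {m} h (i : Fin m) ρ s → lookup ρ i ≡ encS s → GoodState (suc h) s →
    eval (stepE h i) ρ ≡ encS (stepS s)
  STEP-eval : ∀ {m} h (i j : Fin m) ρ {U W} → lookup ρ i ≡ encT U → lookup ρ j ≡ encT W → Thr (suc h) U → Thr (suc h) W →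
    eval (STEP h i j) ρ ≡ encS (iterS (spine W) (pending false U W))

  compare-eval h b ρ leaf W g g' = lit-eval (not b) _
  compare-eval h b ρ (o ⊹ x) leaf g g' = lit-eval b _
  compare-eval h b ρ (o ⊹ x) (p ⊹ y) g g' = trans
    (ifE-eval (LE h (suc (suc v0)) v0) _ _ _ (LE-eval h (suc (suc v0)) v0 _ {x} {y} refl refl (thr-exp g) (thr-exp g')))
    (out (le x y))
    where
    out : ∀ c → (if c then n2 (tagged (not b)) (encT (p ⊹ y)) (encT o) else n2 (tagged b) (encT (o ⊹ x)) (encT p))
      ≡ encS (if c then pending (not b) (p ⊹ y) o else pending b (o ⊹ x) p)
    out true  = refl
    out false = refl

  stepE-eval h i ρ (done true) eq g rewrite eq = refl
  stepE-eval h i ρ (done false) eq g rewrite eq = refl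
  stepE-eval h i ρ (pending false U W) eq (g , g') rewrite eq = compare-eval h false ρ U W g g'
  stepE-eval h i ρ (pending true U W) eq (g , g') rewrite eq = compare-eval h true ρ U W g g'

  STEP-eval {m} h i j ρ {U} {W} ei ej gU gW = trans (cong F ej) (go W)
    where
    F : D → D
    F = foldE (λ _ → k2 (op and) (var i) (var j)) (λ _ → no) (λ _ → stepE h v1) ρ
    go : ∀ W' → F (encT W') ≡ encS (iterS (spine W') (pending false U W))
    go leaf rewrite ei | ej = refl
    go (p ⊹ y) = stepE-eval h v1 (F (encT y) ∷ F (encT p) ∷ ρ) (iterS (spine p) (pending false U W)) (go p)
      (iterS-good (spine p) (pending false U W) (gU , gW))

  LE-eval zero i j ρ {leaf} ei ej gU gW = refl
  LE-eval zero i j ρ {U ⊹ x} ei ej (inj₂ ()) gW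
  LE-eval (suc h) i j ρ {U} {W} ei ej gU gW = trans (cong F ei) (trans (go U)
      (cong encS (trans (iterS-+ (spine U) (suc (spine W)))
        (iterS-le (spine U + suc (spine W)) false U W (≤-reflexive (sym (+-suc (spine U) (spine W))))))))
    where
    s₀ : LeState
    s₀ = pending false U W
    F : D → D
    F = foldE (λ _ → bind (STEP h i j) (stepE h v0)) (λ _ → no) (λ _ → stepE h v1) ρ
    iterS-+ : ∀ n k → iterS n (iterS k s₀) ≡ iterS (n + k) s₀
    iterS-+ zero    k = refl
    iterS-+ (suc n) k = cong stepS (iterS-+ n k)
    go : ∀ U' → F (encT U') ≡ encS (iterS (spine U') (iterS (suc (spine W)) s₀))
    go leaf = stepE-eval h v0 (eval (STEP h i j) ρ ∷ ρ) (iterS (spine W) s₀) (STEP-eval h i j ρ ei ej gU gW)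
      (iterS-good (spine W) s₀ (gU , gW))
    go (o ⊹ x) = stepE-eval h v1 (F (encT x) ∷ F (encT o) ∷ ρ) (iterS (spine o) (iterS (suc (spine W)) s₀)) (go o)
      (iterS-good (spine o) (iterS (suc (spine W)) s₀) (iterS-good (suc (spine W)) s₀ (gU , gW)))

  module _ {m} (i : Fin m) (ρ : Vec D m) where

    EVALB-conn : ∀ c a b → layer (EVALB i) ρ (n2 (op c) (encB a) (encB b)) ≡ encB (conn c a b)
    EVALB-conn and true  b     = refl
    EVALB-conn and false b     = refl
    EVALB-conn or  true  b     = refl
    EVALB-conn or  false b     = refl
    EVALB-conn imp true  b     = refl
    EVALB-conn imp false b     = refl

    EVALB-fold : ∀ A → foldE-of (EVALB i) ρ (encG A) ≡ encB (evalG A)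
    EVALB-fold tt = refl
    EVALB-fold ff = refl
    EVALB-fold (tok W) = refl
    EVALB-fold (bin c A B) rewrite EVALB-fold A | EVALB-fold B = EVALB-conn c (evalG A) (evalG B)
    EVALB-fold (neg A) rewrite EVALB-fold A with evalG A
    ... | true  = refl
    ... | false = refl
    EVALB-fold (dia j A) = refl

    EVALB-eval : ∀ {A} → lookup ρ i ≡ encG A → eval (EVALB i) ρ ≡ encB (evalG A)
    EVALB-eval {A} e = trans (cong (foldE-of (EVALB i) ρ) e) (EVALB-fold A)

  module _ {m} (h : ℕ) (i w : Fin m) (ρ : Vec D m) where

    private
      F : D → D
      F = foldE-of (SUB h i w) ρ

    -- The fold also runs through the tree of a token, and the branch for `τᶜ` receives only the
    -- result; the comparison there needs the threshold unchanged.
    SUB-T : ∀ W → F (encT W) ≡ encT W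
    SUB-T leaf    = refl
    SUB-T (o ⊹ x) = cong₂ (n2 ωᶜ) (SUB-T o) (SUB-T x)

    -- No formula is encoded by a tree with root `1ᶜ`, so the absence of this root reveals the index
    -- 0.
    SUB-dia : ∀ A → layer (SUB h i w) ρ (n1 ◇ᶜ (encG A)) ≡ n0 ⊥ᶜ
    SUB-dia tt = refl
    SUB-dia ff = refl
    SUB-dia (tok W) = refl
    SUB-dia (bin c A B) = refl
    SUB-dia (neg A) = refl
    SUB-dia (dia j A) = refl

    SUB-fold : ∀ {w'} → lookup ρ w ≡ encT w' → Thr h w' → ∀ B → (∀ {W} → W ∈ toks B → Thr h W) →
      F (encG B) ≡ encG (sub w' B)
    SUB-fold ew tw tt tB = refl
    SUB-fold ew tw ff tB = refl
    SUB-fold {w'} ew tw (tok W) tB = trans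
      (ifE-eval (LE h v0 (suc w)) _ _ (F (encT W) ∷ ρ) (LE-eval h v0 (suc w) _ (SUB-T W) ew (tB (here refl)) tw))
      (out (le W w'))
      where
      out : ∀ c → (if c then n0 ⊤ᶜ else n0 ⊥ᶜ) ≡ encG (if c then tt else ff)
      out true  = refl
      out false = refl
    SUB-fold ew tw (bin c A B) tB = cong₂ (n2 (op c))
      (SUB-fold ew tw A (λ m → tB (∈-++⁺ˡ m))) (SUB-fold ew tw B (λ m → tB (∈-++⁺ʳ (toks A) m)))
    SUB-fold ew tw (neg A) tB = cong (n1 ¬ᶜ) (SUB-fold ew tw A tB)
    SUB-fold {w'} ew tw (dia zero A) tB =
      trans (cong (λ x → layer (SUB h i w) ρ (n1 ◇ᶜ x)) (SUB-fold ew tw A tB)) (SUB-dia (sub w' A))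
    SUB-fold {w'} ew tw (dia (suc j) A) tB = cong (n1 ◇ᶜ) (pass j)
      where
      pass : ∀ j → F (ones j (encG A)) ≡ ones j (encG (sub w' A))
      pass zero    = SUB-fold ew tw A tB
      pass (suc j) = cong (n1 1ᶜ) (pass j)

    SUB-eval : ∀ {w' B} → lookup ρ i ≡ encG B → lookup ρ w ≡ encT w' → Thr h w' → (∀ {W} → W ∈ toks B → Thr h W) →
      eval (SUB h i w) ρ ≡ encG (sub w' B)
    SUB-eval {w'} {B} ei ew tw tB = trans (cong F ei) (SUB-fold ew tw B tB)

  module _ {m} (h : ℕ) (i w u : Fin m) (ρ : Vec D m) where

    private
      F : D → D
      F = foldE-of (OK h i w u) ρ

    OK-T : ∀ W → F (encT W) ≡ encT W
    OK-T leaf    = refl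
    OK-T (o ⊹ x) = cong₂ (n2 ωᶜ) (OK-T o) (OK-T x)

    OK-fold : ∀ {w' u'} → lookup ρ w ≡ encT w' → lookup ρ u ≡ encT u' → Thr h w' → Thr h u' →
      ∀ B → (∀ {W} → W ∈ toks B → Thr h W) → F (encG B) ≡ encB (ok w' u' B)
    OK-fold ew eu tw tu tt tB = refl
    OK-fold ew eu tw tu ff tB = refl
    OK-fold {w'} {u'} ew eu tw tu (tok W) tB = trans
      (ifE-eval (LE h v0 (suc w)) _ _ (F (encT W) ∷ ρ) (LE-eval h v0 (suc w) _ (OK-T W) ew (tB (here refl)) tw))
      out
      where
      ρ₁ : Vec D (suc m)
      ρ₁ = F (encT W) ∷ ρ
      out : (if le W w' then n0 ⊤ᶜ else eval (ifE (LE h (suc u) v0) (k0 ⊤ᶜ) no) ρ₁)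
        ≡ encB (if le W w' then true else le u' W)
      out with le W w'
      ... | true  = refl
      ... | false = trans
        (ifE-eval (LE h (suc u) v0) (k0 ⊤ᶜ) no ρ₁ (LE-eval h (suc u) v0 ρ₁ eu (OK-T W) tu (tB (here refl)))) (bool (le u' W))
        where
        bool : ∀ b → (if b then n0 ⊤ᶜ else n0 ⊥ᶜ) ≡ encB b
        bool true  = refl
        bool false = refl
    OK-fold {w'} {u'} ew eu tw tu (bin c A B) tB
      rewrite OK-fold ew eu tw tu A (λ m → tB (∈-++⁺ˡ m)) | OK-fold ew eu tw tu B (λ m → tB (∈-++⁺ʳ (toks A) m))
      with ok w' u' A
    ... | true  = refl
    ... | false = refl
    OK-fold ew eu tw tu (neg A) tB = OK-fold ew eu tw tu A tB
    OK-fold ew eu tw tu (dia zero A) tB = OK-fold ew eu tw tu A tB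
    OK-fold ew eu tw tu (dia (suc j) A) tB = OK-fold ew eu tw tu (dia j A) tB

    OK-eval : ∀ {w' u' B} → lookup ρ i ≡ encG B → lookup ρ w ≡ encT w' → lookup ρ u ≡ encT u' → Thr h w' → Thr h u' →
      (∀ {W} → W ∈ toks B → Thr h W) → eval (OK h i w u) ρ ≡ encB (ok w' u' B)
    OK-eval {B = B} ei ew eu tw tu tB = trans (cong F ei) (OK-fold ew eu tw tu B tB)

  SMALLER-eval : ∀ {m} h (i j : Fin m) ρ {r s} → lookup ρ i ≡ encM r → lookup ρ j ≡ encM s →
    (∀ {U} → r ≡ just U → Thr h U) → (∀ {U} → s ≡ just U → Thr h U) →
    eval (SMALLER h i j) ρ ≡ encM (smaller r s)
  SMALLER-eval h i j ρ {nothing} ei ej tr ts =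
    trans (ifE-eval (isNone i) _ _ ρ (isNone-eval i ρ nothing ei)) ej
  SMALLER-eval h i j ρ {just U} {nothing} ei ej tr ts =
    trans (ifE-eval (isNone i) _ _ ρ (isNone-eval i ρ (just U) ei))
      (trans (ifE-eval (isNone j) _ _ ρ (isNone-eval j ρ nothing ej)) ei)
  SMALLER-eval h i j ρ {just U} {just W} ei ej tr ts =
    trans (ifE-eval (isNone i) _ _ ρ (isNone-eval i ρ (just U) ei))
      (trans (ifE-eval (isNone j) _ _ ρ (isNone-eval j ρ (just W) ej))
        (trans (ifE-eval (LE h i j) _ _ ρ (LE-eval h i j ρ ei ej (tr refl) (ts refl))) out))
    where
    out : (if le U W then lookup ρ i else lookup ρ j) ≡ encM (if le U W then just U else just W)
    out with le U W
    ... | true  = ei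
    ... | false = ej

  Computes : ℕ → (∀ {m} → Fin m → Exp m) → Set
  Computes h rec = ∀ {m} (i : Fin m) ρ {A} → lookup ρ i ≡ encG A → Pure h A → eval (rec i) ρ ≡ encM (minimum h A)

  thr-tok : ∀ {h B} → Processed h B → ∀ {W} → W ∈ toks B → Thr (suc h) W
  thr-tok pB m = inj₂ (toks-ht pB m)

  best-ht : ∀ {h f} B → (∀ {w U} → w ∈ toks B → f w ≡ just U → Ht h U) → ∀ {U} → best f B ≡ just U → Thr h U
  best-ht {f = f} B hf e with best f B | best-least B hf
  best-ht B hf refl | .(just _) | (w , m , e) , _ = inj₂ (hf m e)

  module _ {h} {rec : ∀ {m} → Fin m → Exp m} (cr : Computes h rec) {B : G} (pB : Processed h B) where

    private
      f : T → Maybe T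
      f = cand (minimum h) B

    f-ht : ∀ {w} → w ∈ leaf ∷ toks B → ∀ {U} → f w ≡ just U → Thr (suc h) U
    f-ht m e = inj₂ (cand-ht (minimum-solves h) 0 B pB m e)

    cell-thr : ∀ {w} → w ∈ leaf ∷ toks B → Thr (suc h) w
    cell-thr m = cells-ht (minimum-solves h) 0 B pB m

    CAND-eval : ∀ {m} (i w : Fin m) ρ {w'} → lookup ρ i ≡ encG B → lookup ρ w ≡ encT w' → w' ∈ leaf ∷ toks B →
      eval (CAND rec (suc h) i w) ρ ≡ encM (f w')
    CAND-eval {m} i w ρ {w'} ei ew mw = trans (ifE-eval (isNone v0) _ _ ρ₂ (isNone-eval v0 ρ₂ r eᵣ)) (split r refl eᵣ)
      where
      r : Maybe T
      r = minimum h (sub w' B)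
      ρ₁ : Vec D (suc m)
      ρ₁ = eval (SUB (suc h) i w) ρ ∷ ρ
      e₁ : lookup ρ₁ v0 ≡ encG (sub w' B)
      e₁ = SUB-eval (suc h) i w ρ ei ew (cell-thr mw) (thr-tok pB)
      ρ₂ : Vec D (suc (suc m))
      ρ₂ = eval (rec v0) ρ₁ ∷ ρ₁
      eᵣ : lookup ρ₂ v0 ≡ encM r
      eᵣ = cr v0 ρ₁ e₁ (sub-pure w' pB)
      split : ∀ r' → r ≡ r' → lookup ρ₂ v0 ≡ encM r' →
        (if refuted r' then n0 ⊥ᶜ else eval (bind (k2 ωᶜ (var (suc (suc w))) (var v0))
          (ifE (OK (suc h) (suc (suc (suc i))) (suc (suc (suc w))) v0) (var v0) (no))) ρ₂) ≡ encM (candidate B w' r)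
      split nothing e _ rewrite e = refl
      split (just V) e e' = trans (ifE-eval (OK (suc h) (suc (suc (suc i))) (suc (suc (suc w))) v0) (var v0) no ρ₃
          (OK-eval (suc h) (suc (suc (suc i))) (suc (suc (suc w))) v0 ρ₃ ei ew eU (cell-thr mw) tU (thr-tok pB)))
          out
        where
        ρ₃ : Vec D (suc (suc (suc m)))
        ρ₃ = n2 ωᶜ (lookup ρ w) (lookup ρ₂ v0) ∷ ρ₂
        eU : n2 ωᶜ (lookup ρ w) (lookup ρ₂ v0) ≡ encT (w' ⊹ V)
        eU = cong₂ (n2 ωᶜ) ew e'
        tU : Thr (suc h) (w' ⊹ V)
        tU = inj₂ (⊹-ht (cell-thr mw) (ht-of (minimum h (sub w' B)) e (minimum-solves h 0 (sub w' B) (sub-pure w' pB))))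
          where
          ht-of : ∀ {A} s → s ≡ just V → Rep? h 0 A s → Ht h V
          ht-of .(just V) refl q = Rep.ht q
        out : (if ok w' (w' ⊹ V) B then n2 ωᶜ (lookup ρ w) (lookup ρ₂ v0) else n0 ⊥ᶜ) ≡ encM (candidate B w' r)
        out rewrite e with ok w' (w' ⊹ V) B
        ... | true  = eU
        ... | false = refl

    BEST-T : ∀ {m} (i : Fin m) ρ W → foldE-of (BEST rec (suc h) i) ρ (encT W) ≡ encT W
    BEST-T i ρ leaf    = refl
    BEST-T i ρ (o ⊹ x) = cong₂ (n2 ωᶜ) (BEST-T i ρ o) (BEST-T i ρ x)

    BEST-fold : ∀ {m} (i : Fin m) ρ → lookup ρ i ≡ encG B → ∀ B' → (∀ {W} → W ∈ toks B' → W ∈ toks B) →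
      foldE-of (BEST rec (suc h) i) ρ (encG B') ≡ encM (best f B')
    BEST-fold i ρ ei tt sb = refl
    BEST-fold i ρ ei ff sb = refl
    BEST-fold i ρ ei (tok W) sb = CAND-eval (suc i) v0 (foldE-of (BEST rec (suc h) i) ρ (encT W) ∷ ρ) ei (BEST-T i ρ W) (there (sb (here refl)))
    BEST-fold i ρ ei (bin c A A') sb = SMALLER-eval (suc h) v1 v0 (F (encG A') ∷ F (encG A) ∷ ρ)
      (BEST-fold i ρ ei A sbˡ) (BEST-fold i ρ ei A' sbʳ)
      (best-ht A λ m e → cand-ht (minimum-solves h) 0 B pB (there (sbˡ m)) e)
      (best-ht A' λ m e → cand-ht (minimum-solves h) 0 B pB (there (sbʳ m)) e)
      where
      F : D → D
      F = foldE-of (BEST rec (suc h) i) ρ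
      sbˡ : ∀ {W} → W ∈ toks A → W ∈ toks B
      sbˡ m = sb (∈-++⁺ˡ m)
      sbʳ : ∀ {W} → W ∈ toks A' → W ∈ toks B
      sbʳ m = sb (∈-++⁺ʳ (toks A) m)
    BEST-fold i ρ ei (neg A) sb = BEST-fold i ρ ei A sb
    BEST-fold i ρ ei (dia zero A) sb = BEST-fold i ρ ei A sb
    BEST-fold i ρ ei (dia (suc j) A) sb = BEST-fold i ρ ei (dia j A) sb

    BEST-eval : ∀ {m} (i : Fin m) ρ → lookup ρ i ≡ encG B → eval (BEST rec (suc h) i) ρ ≡ encM (best f B)
    BEST-eval i ρ ei = trans (cong (foldE-of (BEST rec (suc h) i) ρ) ei) (BEST-fold i ρ ei B (λ m → m))

    THRESH-eval : ∀ {m} (i : Fin m) ρ → lookup ρ i ≡ encG B →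
      eval (THRESH rec (suc h) i) ρ ≡ encM (threshold (minimum h) B)
    THRESH-eval {m} i ρ ei = SMALLER-eval (suc h) v1 v0 ρ₃
      (CAND-eval (suc i) v0 ρ₁ {leaf} ei refl (here refl))
      (BEST-eval (suc (suc i)) ρ₂ ei)
      (λ e → f-ht (here refl) e)
      (best-ht B λ m e → cand-ht (minimum-solves h) 0 B pB (there m) e)
      where
      ρ₁ : Vec D (suc m)
      ρ₁ = n0 oᶜ ∷ ρ
      ρ₂ : Vec D (suc (suc m))
      ρ₂ = eval (CAND rec (suc h) (suc i) v0) ρ₁ ∷ ρ₁
      ρ₃ : Vec D (suc (suc (suc m)))
      ρ₃ = eval (BEST rec (suc h) (suc (suc i))) ρ₂ ∷ ρ₂

  isOne-eval : ∀ {m} (i : Fin m) ρ A → lookup ρ i ≡ encG A → eval (isOne i) ρ ≡ encB false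
  isOne-eval i ρ tt e rewrite e = refl
  isOne-eval i ρ ff e rewrite e = refl
  isOne-eval i ρ (tok W) e rewrite e = refl
  isOne-eval i ρ (bin c A B) e rewrite e = refl
  isOne-eval i ρ (neg A) e rewrite e = refl
  isOne-eval i ρ (dia j A) e rewrite e = refl

  module _ {h} {rec : ∀ {m} → Fin m → Exp m} (cr : Computes h rec) {m} (i : Fin m) (ρ : Vec D m) where

    private
      F : D → D
      F = foldE-of (PROC rec (suc h) i) ρ

    PROC-fold : ∀ A → Pure (suc h) A → F (encG A) ≡ encG (proc (minimum h) A)
    PROC-fold tt p = refl
    PROC-fold ff p = refl
    PROC-fold (tok W) (tok ())
    PROC-fold (bin c A B) (bin p q) = cong₂ (n2 (op c)) (PROC-fold A p) (PROC-fold B q)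
    PROC-fold (neg A) (neg p) = cong (n1 ¬ᶜ) (PROC-fold A p)
    PROC-fold (dia zero A) (dia _ p) =
      trans (ifE-eval (isOne v0) _ _ ρ₁ (isOne-eval v0 ρ₁ A' e₁))
        (trans (ifE-eval (isNone v0) _ _ ρ₂ (isNone-eval v0 ρ₂ r eᵣ)) (out r eᵣ))
      where
      A' : G
      A' = proc (minimum h) A
      r : Maybe T
      r = threshold (minimum h) A'
      ρ₁ : Vec D (suc m)
      ρ₁ = F (encG A) ∷ ρ
      ρ₂ : Vec D (suc (suc m))
      ρ₂ = eval (THRESH rec (suc h) v0) ρ₁ ∷ ρ₁
      e₁ : lookup ρ₁ v0 ≡ encG A'
      e₁ = PROC-fold A p
      eᵣ : eval (THRESH rec (suc h) v0) ρ₁ ≡ encM r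
      eᵣ = THRESH-eval {rec = rec} cr (proj₁ (proc-≈ (minimum-solves h) 0 A p)) v0 ρ₁ e₁
      out : ∀ {d} r → d ≡ encM r → (if refuted r then n0 ⊥ᶜ else n1 τᶜ d) ≡ encG (close r)
      out nothing  e = refl
      out (just W) e = cong (n1 τᶜ) e
    PROC-fold (dia (suc j) A) (dia _ p) = cong (n1 ◇ᶜ) (pass (suc j))
      where
      pass : ∀ j → F (ones j (encG A)) ≡ ones j (encG (proc (minimum h) A))
      pass zero    = PROC-fold A p
      pass (suc j) = cong (n1 1ᶜ) (pass j)

    PROC-eval : ∀ {A} → lookup ρ i ≡ encG A → Pure (suc h) A → eval (PROC rec (suc h) i) ρ ≡ encG (proc (minimum h) A)
    PROC-eval {A} e p = trans (cong F e) (PROC-fold A p)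

  MIN-computes : ∀ h → Computes h (MIN h)
  MIN-computes zero i ρ {A} e p = trans (ifE-eval (EVALB i) _ _ ρ (EVALB-eval i ρ {A} e)) out
    where
    out : (if evalG A then n0 oᶜ else n0 ⊥ᶜ) ≡ encM (minimum zero A)
    out with evalG A
    ... | true  = refl
    ... | false = refl
  MIN-computes (suc h) i ρ {A} e p = THRESH-eval {rec = MIN h} (MIN-computes h)
    (proj₁ (proc-≈ (minimum-solves h) 0 A p)) v0 (eval (PROC (MIN h) (suc h) i) ρ ∷ ρ)
    (PROC-eval {rec = MIN h} (MIN-computes h) i ρ {A} e p)

  DECIDE-eval : ∀ n A → Pure n A → eval (DECIDE n) (encG A ∷ []) ≡ encB (refuted (minimum n (neg A)))
  DECIDE-eval n A p = isNone-eval v0 (eval (MIN n v0) ρ₁ ∷ ρ₁) (minimum n (neg A)) (MIN-computes n v0 ρ₁ {neg A} refl (neg p))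
    where
    ρ₁ : Vec D 2
    ρ₁ = encG (neg A) ∷ encG A ∷ []

-- Compositional polynomial bounds for programs.

module CostBounds where

  open Thresholds
  open Completeness
  open TreeLanguage
  open Programs
  open import Data.Nat using (ℕ; zero; suc; _+_; _*_; _^_; _≤_; z≤n; s≤s)
  open import Data.Nat.Properties
  open import Data.Nat.Solver using (module +-*-Solver)
  open import Data.Fin using (Fin; zero; suc)
  open import Data.Vec using (Vec; _∷_; lookup)
  open import Data.List using (_∷_)

  -- The bounds are opaque because the polynomials in them become too large to be unfolded.
  PB : {A : Set} → (A → ℕ) → (A → ℕ) → Set
  PB μ f = ∃[ c ] ∃[ d ] (∀ a → f a ≤ c * suc (μ a) ^ d)

  mono-bound : ∀ {C E} c d s → c ≤ C → d ≤ E → c * suc s ^ d ≤ C * suc s ^ E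
  mono-bound c d s p q = *-mono-≤ p (^-monoʳ-≤ (suc s) q)

  module _ {A : Set} {μ : A → ℕ} where

    opaque
      pb-const : ∀ k → PB μ (λ _ → k)
      pb-const k = k , 0 , λ a → ≤-reflexive (sym (*-identityʳ k))

    opaque
      pb-μ : PB μ μ
      pb-μ = 1 , 1 , λ a → ≤-trans (n≤1+n (μ a)) (≤-reflexive (eq (suc (μ a))))
        where
        eq : ∀ s → s ≡ 1 * s ^ 1
        eq s = sym (trans (*-identityˡ (s ^ 1)) (*-identityʳ s))

    opaque
      pb-≤ : ∀ {f g} → (∀ a → f a ≤ g a) → PB μ g → PB μ f
      pb-≤ h (c , d , p) = c , d , λ a → ≤-trans (h a) (p a)

    opaque
      pb-+ : ∀ {f g} → PB μ f → PB μ g → PB μ (λ a → f a + g a)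
      pb-+ (c , d , p) (c' , d' , q) = c + c' , d + d' , λ a → ≤-trans
        (+-mono-≤ (≤-trans (p a) (mono-bound c d (μ a) ≤-refl (m≤m+n d d')))
                  (≤-trans (q a) (mono-bound c' d' (μ a) ≤-refl (m≤n+m d' d))))
        (≤-reflexive (sym (*-distribʳ-+ (suc (μ a) ^ (d + d')) c c')))

    opaque
      pb-* : ∀ {f g} → PB μ f → PB μ g → PB μ (λ a → f a * g a)
      pb-* (c , d , p) (c' , d' , q) = c * c' , d + d' , λ a → ≤-trans (*-mono-≤ (p a) (q a))
        (≤-reflexive (trans (eq c (suc (μ a) ^ d) c' (suc (μ a) ^ d'))
                            (cong (c * c' *_) (sym (^-distribˡ-+-* (suc (μ a)) d d')))))
        where
        open +-*-Solver
        eq : ∀ a b c d → (a * b) * (c * d) ≡ (a * c) * (b * d)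
        eq = solve 4 (λ a b c d → (a :* b) :* (c :* d) := (a :* c) :* (b :* d)) refl

    opaque
      pb-^ : ∀ {f} d → PB μ f → PB μ (λ a → f a ^ d)
      pb-^ zero    p = pb-const 1
      pb-^ (suc d) p = pb-* p (pb-^ d p)

    opaque
      pb-pull : ∀ {f} {B : Set} (g : B → A) → PB μ f → PB (λ b → μ (g b)) (λ b → f (g b))
      pb-pull g (c , d , p) = c , d , λ b → p (g b)

  lookup-size : ∀ {m} (ρ : Vec D m) i → ∣ lookup ρ i ∣ ≤ ∣ ρ ∣ᵉ
  lookup-size (t ∷ ρ) zero    = m≤m+n ∣ t ∣ ∣ ρ ∣ᵉ
  lookup-size (t ∷ ρ) (suc i) = ≤-trans (lookup-size ρ i) (m≤n+m ∣ ρ ∣ᵉ ∣ t ∣)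

  -- Every symbol of a value has to be written by some operation, so a polynomial cost also bounds
  -- the size of the result.
  size≤cost : ∀ {m} (e : Exp m) ρ → ∣ eval e ρ ∣ ≤ cost e ρ
  size≤case : ∀ {m} f g h (ρ : Vec D m) t → ∣ caseD (λ l → eval (f l) ρ) (λ l x → eval (g l) (x ∷ ρ))
    (λ l x y → eval (h l) (y ∷ x ∷ ρ)) t ∣ ≤ caseCost f g h ρ t
  size≤cata : ∀ {m} f g h (ρ : Vec D m) t → ∣ foldE f g h ρ t ∣ ≤ cataCost f g h ρ t
  size≤cost (var i) ρ = ≤-trans (lookup-size ρ i) (m≤m+n ∣ ρ ∣ᵉ _)
  size≤cost (k0 l) ρ = ≤-refl
  size≤cost (k1 l e) ρ = ≤-trans (s≤s (size≤cost e ρ)) (≤-reflexive (+-comm 1 (cost e ρ)))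
  size≤cost (k2 l e e') ρ = ≤-trans (s≤s (+-mono-≤ (size≤cost e ρ) (size≤cost e' ρ)))
    (≤-reflexive (eq (cost e ρ) (cost e' ρ)))
    where
    open +-*-Solver
    eq : ∀ a b → suc (a + b) ≡ b + (a + 1)
    eq = solve 2 (λ a b → con 1 :+ (a :+ b) := b :+ (a :+ con 1)) refl
  size≤cost (bind e e') ρ = ≤-trans (size≤cost e' (eval e ρ ∷ ρ))
    (≤-trans (m≤n+m _ (24 * ∣ eval e ρ ∣)) (m≤n+m _ (cost e ρ)))
  size≤cost (case e f g h) ρ = ≤-trans (size≤case f g h ρ (eval e ρ)) (≤-trans (n≤1+n _) (m≤n+m _ (cost e ρ)))
  size≤cost (cata e f g h) ρ = ≤-trans (size≤cata f g h ρ (eval e ρ))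
    (≤-trans (m≤n+m _ (10 * ∣ eval e ρ ∣)) (m≤n+m _ (cost e ρ)))
  size≤case f g h ρ (n0 l) = size≤cost (f l) ρ
  size≤case f g h ρ (n1 l a) = ≤-trans (size≤cost (g l) (a ∷ ρ)) (m≤n+m _ (24 * ∣ a ∣))
  size≤case f g h ρ (n2 l a b) =
    ≤-trans (size≤cost (h l) (b ∷ a ∷ ρ)) (≤-trans (m≤n+m _ (24 * ∣ b ∣)) (m≤n+m _ (24 * ∣ a ∣)))
  size≤cata f g h ρ (n0 l) = ≤-trans (size≤cost (f l) ρ) (n≤1+n _)
  size≤cata f g h ρ (n1 l a) =
    ≤-trans (size≤case f g h ρ (n1 l (foldE f g h ρ a))) (≤-trans (n≤1+n _) (m≤n+m _ (cataCost f g h ρ a)))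
  size≤cata f g h ρ (n2 l a b) = ≤-trans (size≤case f g h ρ (n2 l (foldE f g h ρ a) (foldE f g h ρ b)))
    (≤-trans (n≤1+n _) (≤-trans (m≤n+m _ (cataCost f g h ρ a)) (m≤n+m _ (cataCost f g h ρ b))))

  -- Some programs have bounds only on the inputs they are meant for. A family of environments lets
  -- the index carry such invariants, while `μ` remains the size of the outermost input.
  record Fam (m : ℕ) : Set₁ where
    field
      Ix    : Set
      ρ     : Ix → Vec D m
      μ     : Ix → ℕ
      small : PB μ (λ a → ∣ ρ a ∣ᵉ)
  open Fam

  record Cst {m} (F : Fam m) (e : Exp m) : Set where
    constructor cst
    field
      pb : PB (μ F) (λ a → cost e (ρ F a))
  open Cst

  restrict : ∀ {m} (F : Fam m) → (Ix F → Set) → Fam m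
  restrict F P = record { Ix = Σ (Ix F) P ; ρ = λ (a , _) → ρ F a ; μ = λ (a , _) → μ F a ; small = pb-pull proj₁ (small F) }

  ext₁ : ∀ {m} (F : Fam m) V → PB (μ F) V → (Ix F → D → Set) → Fam (suc m)
  ext₁ F V pV Q = record
    { Ix = Σ (Ix F) λ a → Σ D λ x → ∣ x ∣ ≤ V a × Q a x
    ; ρ = λ (a , x , _) → x ∷ ρ F a
    ; μ = λ (a , _) → μ F a
    ; small = pb-≤ (λ (a , x , le , _) → +-monoˡ-≤ ∣ ρ F a ∣ᵉ le) (pb-pull proj₁ (pb-+ pV (small F))) }

  ext₂ : ∀ {m} (F : Fam m) V → PB (μ F) V → (Ix F → D → D → Set) → Fam (suc (suc m))
  ext₂ F V pV Q = record
    { Ix = Σ (Ix F) λ a → Σ D λ x → Σ D λ y → ∣ x ∣ ≤ V a × ∣ y ∣ ≤ V a × Q a x y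
    ; ρ = λ (a , x , y , _) → y ∷ x ∷ ρ F a
    ; μ = λ (a , _) → μ F a
    ; small = pb-≤ (λ (a , x , y , le , le' , _) → +-mono-≤ le' (+-monoˡ-≤ ∣ ρ F a ∣ᵉ le))
                   (pb-pull proj₁ (pb-+ pV (pb-+ pV (small F)))) }

  opaque
    value-small : ∀ {m} (F : Fam m) e → Cst F e → PB (μ F) (λ a → ∣ eval e (ρ F a) ∣)
    value-small F e ce = pb-≤ (λ a → size≤cost e (ρ F a)) (pb ce)

  bindF : ∀ {m} (F : Fam m) e → Cst F e → Fam (suc m)
  bindF F e ce = record { Ix = Ix F ; ρ = λ a → eval e (ρ F a) ∷ ρ F a ; μ = μ F
                        ; small = pb-+ (value-small F e ce) (small F) }

  -- Branches depend on the label of a node; one bound must serve a whole fold, and for finitely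
  -- many labels it arises by adding coefficients and exponents.
  record Uniform {L : Set} (A : L → Set) (μ f : ∀ l → A l → ℕ) : Set where
    constructor uniform
    field
      c d   : ℕ
      bound : ∀ l a → f l a ≤ c * suc (μ l a) ^ d

  module _ {A : L0 → Set} {μ f : ∀ l → A l → ℕ} where
    opaque
      uniform₀ : (∀ l → PB (μ l) (f l)) → Uniform A μ f
      uniform₀ p = uniform (cs ⊤ᶜ + (cs ⊥ᶜ + cs oᶜ)) (ds ⊤ᶜ + (ds ⊥ᶜ + ds oᶜ)) λ l a →
          ≤-trans (proj₂ (proj₂ (p l)) a) (mono-bound (cs l) (ds l) (μ l a) (≤sum cs l) (≤sum ds l))
        where
        cs ds : L0 → ℕ
        cs l = proj₁ (p l)
        ds l = proj₁ (proj₂ (p l))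
        ≤sum : ∀ (X : L0 → ℕ) l → X l ≤ X ⊤ᶜ + (X ⊥ᶜ + X oᶜ)
        ≤sum X ⊤ᶜ = m≤m+n _ _
        ≤sum X ⊥ᶜ = ≤-trans (m≤m+n _ _) (m≤n+m _ (X ⊤ᶜ))
        ≤sum X oᶜ = ≤-trans (m≤n+m _ (X ⊥ᶜ)) (m≤n+m _ (X ⊤ᶜ))

  module _ {A : L1 → Set} {μ f : ∀ l → A l → ℕ} where
    opaque
      uniform₁ : (∀ l → PB (μ l) (f l)) → Uniform A μ f
      uniform₁ p = uniform (cs ¬ᶜ + (cs ◇ᶜ + (cs 1ᶜ + cs τᶜ))) (ds ¬ᶜ + (ds ◇ᶜ + (ds 1ᶜ + ds τᶜ))) λ l a →
          ≤-trans (proj₂ (proj₂ (p l)) a) (mono-bound (cs l) (ds l) (μ l a) (≤sum cs l) (≤sum ds l))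
        where
        cs ds : L1 → ℕ
        cs l = proj₁ (p l)
        ds l = proj₁ (proj₂ (p l))
        ≤sum : ∀ (X : L1 → ℕ) l → X l ≤ X ¬ᶜ + (X ◇ᶜ + (X 1ᶜ + X τᶜ))
        ≤sum X ¬ᶜ = m≤m+n _ _
        ≤sum X ◇ᶜ = ≤-trans (m≤m+n _ _) (m≤n+m _ (X ¬ᶜ))
        ≤sum X 1ᶜ = ≤-trans (≤-trans (m≤m+n _ _) (m≤n+m _ (X ◇ᶜ))) (m≤n+m _ (X ¬ᶜ))
        ≤sum X τᶜ = ≤-trans (≤-trans (m≤n+m _ (X 1ᶜ)) (m≤n+m _ (X ◇ᶜ))) (m≤n+m _ (X ¬ᶜ))

  module _ {A : L2 → Set} {μ f : ∀ l → A l → ℕ} where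
    opaque
      uniform₂ : (∀ l → PB (μ l) (f l)) → Uniform A μ f
      uniform₂ p = uniform (cs (op and) + (cs (op or) + (cs (op imp) + cs ωᶜ))) (ds (op and) + (ds (op or) + (ds (op imp) + ds ωᶜ)))
          λ l a → ≤-trans (proj₂ (proj₂ (p l)) a) (mono-bound (cs l) (ds l) (μ l a) (≤sum cs l) (≤sum ds l))
        where
        cs ds : L2 → ℕ
        cs l = proj₁ (p l)
        ds l = proj₁ (proj₂ (p l))
        ≤sum : ∀ (X : L2 → ℕ) l → X l ≤ X (op and) + (X (op or) + (X (op imp) + X ωᶜ))
        ≤sum X (op and) = m≤m+n _ _
        ≤sum X (op or)  = ≤-trans (m≤m+n _ _) (m≤n+m _ (X (op and)))
        ≤sum X (op imp) = ≤-trans (≤-trans (m≤m+n _ _) (m≤n+m _ (X (op or)))) (m≤n+m _ (X (op and)))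
        ≤sum X ωᶜ       = ≤-trans (≤-trans (m≤n+m _ (X (op imp))) (m≤n+m _ (X (op or)))) (m≤n+m _ (X (op and)))

  module _ {m} (F : Fam m) where

    opaque
      c-var : ∀ i → Cst F (var i)
      c-var i = cst (pb-* (pb-const 13) (small F))

    opaque
      c-k0 : ∀ l → Cst F (k0 l)
      c-k0 l = cst (pb-const 1)

    opaque
      c-k1 : ∀ {e} l → Cst F e → Cst F (k1 l e)
      c-k1 l p = cst (pb-+ (pb p) (pb-const 1))

    opaque
      c-k2 : ∀ {e e'} l → Cst F e → Cst F e' → Cst F (k2 l e e')
      c-k2 l p q = cst (pb-+ (pb q) (pb-+ (pb p) (pb-const 1)))

    opaque
      c-bind : ∀ {e e'} (p : Cst F e) → Cst (bindF F e p) e' → Cst F (bind e e')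
      c-bind {e} p q = cst (pb-+ (pb p) (pb-+ (pb-* (pb-const 24) (value-small F e p)) (pb q)))

    opaque
      c-restrict : ∀ {e} P → Cst F e → Cst (restrict F P) e
      c-restrict P p = cst (pb-pull proj₁ (pb p))

    -- Both case and cata reduce to bounding one layer whose children have size at most V.
    module Layer {f : L0 → Exp m} {g : L1 → Exp (suc m)} {h : L2 → Exp (suc (suc m))} (V : Ix F → ℕ) (pV : PB (μ F) V)
      (P₀ : Ix F → L0 → Set) (P₁ : Ix F → L1 → D → Set) (P₂ : Ix F → L2 → D → D → Set) where

      Fits : Ix F → D → Set
      Fits a (n0 l)     = P₀ a l
      Fits a (n1 l x)   = ∣ x ∣ ≤ V a × P₁ a l x
      Fits a (n2 l x y) = ∣ x ∣ ≤ V a × ∣ y ∣ ≤ V a × P₂ a l x y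

      -- The condition concerns the values to which the step is really applied, which are the
      -- results at the children and not the subtrees.
      Nodes : Ix F → D → Set
      Nodes a (n0 l)     = Fits a (n0 l)
      Nodes a (n1 l x)   = Fits a (n1 l (foldE f g h (ρ F a) x)) × Nodes a x
      Nodes a (n2 l x y) = Fits a (n2 l (foldE f g h (ρ F a) x) (foldE f g h (ρ F a) y)) × Nodes a x × Nodes a y

      module _ (cf : ∀ l → Cst (restrict F λ a → P₀ a l) (f l)) (cg : ∀ l → Cst (ext₁ F V pV λ a → P₁ a l) (g l))
        (ch : ∀ l → Cst (ext₂ F V pV λ a → P₂ a l) (h l)) where

        private
          u₀ = uniform₀ (λ l → pb (cf l))
          u₁ = uniform₁ (λ l → pb (cg l))
          u₂ = uniform₂ (λ l → pb (ch l))

          term : ∀ {L} {A : L → Set} {ν k : ∀ l → A l → ℕ} → Uniform A ν k → Ix F → ℕ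
          term u a = Uniform.c u * suc (μ F a) ^ Uniform.d u

          pb-term : ∀ {L} {A : L → Set} {ν k : ∀ l → A l → ℕ} (u : Uniform A ν k) → PB (μ F) (term u)
          pb-term u = Uniform.c u , Uniform.d u , λ a → ≤-refl

          K : Ix F → ℕ
          K a = (24 * V a + 24 * V a) + (term u₀ a + (term u₁ a + term u₂ a))

          opaque
            pb-K : PB (μ F) K
            pb-K = pb-+ (pb-+ (pb-* (pb-const 24) pV) (pb-* (pb-const 24) pV))
              (pb-+ (pb-term u₀) (pb-+ (pb-term u₁) (pb-term u₂)))

          layer-bound : ∀ a t → Fits a t → caseCost f g h (ρ F a) t ≤ K a
          layer-bound a (n0 l) p =
            ≤-trans (Uniform.bound u₀ l (a , p)) (≤-trans (m≤m+n (term u₀ a) _) (m≤n+m _ (24 * V a + 24 * V a)))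
          layer-bound a (n1 l x) (le , p) = +-mono-≤
            (≤-trans (*-monoʳ-≤ 24 le) (m≤m+n _ _))
            (≤-trans (Uniform.bound u₁ l (a , x , le , p)) (≤-trans (m≤m+n (term u₁ a) (term u₂ a)) (m≤n+m _ (term u₀ a))))
          layer-bound a (n2 l x y) (le , le' , p) = ≤-trans (≤-reflexive (sym (+-assoc (24 * ∣ x ∣) _ _))) (+-mono-≤
            (+-mono-≤ (*-monoʳ-≤ 24 le) (*-monoʳ-≤ 24 le'))
            (≤-trans (Uniform.bound u₂ l (a , x , y , le , le' , p))
              (≤-trans (m≤n+m (term u₂ a) (term u₁ a)) (m≤n+m _ (term u₀ a)))))

          nodes-bound : ∀ a t → Nodes a t → cataCost f g h (ρ F a) t ≤ ∣ t ∣ * suc (K a)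
          nodes-bound a (n0 l) p = ≤-trans (s≤s (layer-bound a (n0 l) p)) (≤-reflexive (sym (*-identityˡ _)))
          nodes-bound a (n1 l x) (p , q) = ≤-trans
            (+-mono-≤ (nodes-bound a x q) (s≤s (layer-bound a (n1 l (foldE f g h (ρ F a) x)) p)))
            (≤-reflexive (+-comm (∣ x ∣ * suc (K a)) (suc (K a))))
          nodes-bound a (n2 l x y) (p , q , r) = ≤-trans
            (+-mono-≤ (nodes-bound a y r) (+-mono-≤ (nodes-bound a x q)
              (s≤s (layer-bound a (n2 l (foldE f g h (ρ F a) x) (foldE f g h (ρ F a) y)) p))))
            (≤-reflexive (eq ∣ x ∣ ∣ y ∣ (suc (K a))))
            where
            open +-*-Solver
            eq : ∀ x y k → y * k + (x * k + k) ≡ k + (x + y) * k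
            eq = solve 3 (λ x y k → y :* k :+ (x :* k :+ k) := k :+ (x :+ y) :* k) refl

        opaque
          layer-case : ∀ {e} → Cst F e → (∀ a → Fits a (eval e (ρ F a))) → Cst F (case e f g h)
          layer-case {e} p fits = cst (pb-+ (pb p)
            (pb-≤ (λ a → s≤s (layer-bound a (eval e (ρ F a)) (fits a))) (pb-+ (pb-const 1) pb-K)))

          layer-cata : ∀ {e} → Cst F e → (∀ a → Nodes a (eval e (ρ F a))) → Cst F (cata e f g h)
          layer-cata {e} p nodes = cst (pb-+ (pb p) (pb-+ (pb-* (pb-const 10) pe)
            (pb-≤ (λ a → nodes-bound a (eval e (ρ F a)) (nodes a)) (pb-* pe (pb-+ (pb-const 1) pb-K)))))
            where
            pe : PB (μ F) (λ a → ∣ eval e (ρ F a) ∣)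
            pe = value-small F e p

  module _ {m} (F : Fam m) {e : Exp m} {f : L0 → Exp m} {g : L1 → Exp (suc m)} {h : L2 → Exp (suc (suc m))} where

    opaque
      c-case : (p : Cst F e) → (∀ l → Cst (restrict F λ a → eval e (ρ F a) ≡ n0 l) (f l)) →
        (∀ l → Cst (ext₁ F _ (value-small F e p) λ _ _ → ⊤) (g l)) → (∀ l → Cst (ext₂ F _ (value-small F e p) λ _ _ _ → ⊤) (h l)) →
        Cst F (case e f g h)
      c-case p cf cg ch = Ly.layer-case cf cg ch p λ a → fits a (eval e (ρ F a)) refl
        where
        module Ly = Layer F {f} {g} {h} _ (value-small F e p) (λ a l → eval e (ρ F a) ≡ n0 l) (λ _ _ _ → ⊤) (λ _ _ _ _ → ⊤)
        fits : ∀ a t → eval e (ρ F a) ≡ t → Ly.Fits a t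
        fits a (n0 l)     eq = eq
        fits a (n1 l x)   eq = subst (λ t → ∣ x ∣ ≤ ∣ t ∣) (sym eq) (n≤1+n _) , tt
        fits a (n2 l x y) eq = subst (λ t → ∣ x ∣ ≤ ∣ t ∣) (sym eq) (≤-trans (m≤m+n _ _) (n≤1+n _)) ,
          subst (λ t → ∣ y ∣ ≤ ∣ t ∣) (sym eq) (≤-trans (m≤n+m _ _) (n≤1+n _)) , tt

    -- For a cata whose values grow by at most W.
    opaque
      c-cata : (p : Cst F e) (W : Ix F → ℕ) (pW : PB (μ F) W) →
        (∀ a t → ∣ foldE f g h (ρ F a) t ∣ ≤ ∣ t ∣ + W a) →
        (∀ l → Cst F (f l)) →
        (∀ l → Cst (ext₁ F (λ a → ∣ eval e (ρ F a) ∣ + W a) (pb-+ (value-small F e p) pW) λ _ _ → ⊤) (g l)) →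
        (∀ l → Cst (ext₂ F (λ a → ∣ eval e (ρ F a) ∣ + W a) (pb-+ (value-small F e p) pW) λ _ _ _ → ⊤) (h l)) →
        Cst F (cata e f g h)
      c-cata p W pW size cf cg ch =
        Ly.layer-cata (λ l → c-restrict F _ (cf l)) cg ch p λ a → nodes a (eval e (ρ F a)) ≤-refl
        where
        module Ly = Layer F {f} {g} {h} _ (pb-+ (value-small F e p) pW) (λ _ _ → ⊤) (λ _ _ _ → ⊤) (λ _ _ _ _ → ⊤)
        fit : ∀ a t → ∣ t ∣ ≤ ∣ eval e (ρ F a) ∣ → ∣ foldE f g h (ρ F a) t ∣ ≤ ∣ eval e (ρ F a) ∣ + W a
        fit a t le = ≤-trans (size a t) (+-monoˡ-≤ (W a) le)
        nodes : ∀ a t → ∣ t ∣ ≤ ∣ eval e (ρ F a) ∣ → Ly.Nodes a t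
        nodes a (n0 l) le = tt
        nodes a (n1 l x) le = (fit a x le₁ , tt) , nodes a x le₁
          where
            le₁ : ∣ x ∣ ≤ ∣ eval e (ρ F a) ∣
            le₁ = ≤-trans (n≤1+n _) le
        nodes a (n2 l x y) le = (fit a x le₁ , fit a y le₂ , tt) , nodes a x le₁ , nodes a y le₂
          where
          le₁ : ∣ x ∣ ≤ ∣ eval e (ρ F a) ∣
          le₁ = ≤-trans (≤-trans (m≤m+n _ _) (n≤1+n _)) le
          le₂ : ∣ y ∣ ≤ ∣ eval e (ρ F a) ∣
          le₂ = ≤-trans (≤-trans (m≤n+m _ ∣ x ∣) (n≤1+n _)) le

  opaque
    c-no : ∀ {m} (F : Fam m) → Cst F no
    c-no F = cst (pb-const 1)

  opaque
    -- The second branch has to be bounded only where the test fails; `PROC` relies on this to know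
    -- that the body is a formula.
    c-ifelse : ∀ {m} (F : Fam m) {e t f : Exp m} → Cst F e → Cst F t →
      Cst (restrict F λ a → eval e (ρ F a) ≢ n0 ⊤ᶜ) f → Cst F (ifE e t f)
    c-ifelse F {e} {t} {f} p q r = c-case F p branch (λ l → c-no _) (λ l → c-no _)
      where
      other : ∀ {l} → l ≢ ⊤ᶜ → Cst (restrict F λ a → eval e (ρ F a) ≡ n0 l) f
      other ne = cst (pb-pull (λ (a , eq) → a , λ eq' → ne (inj (trans (sym eq) eq'))) (pb r))
        where
        inj : ∀ {l l'} → n0 l ≡ n0 l' → l ≡ l'
        inj refl = refl
      branch : ∀ l → Cst (restrict F λ a → eval e (ρ F a) ≡ n0 l) (onTrue t f l)
      branch ⊤ᶜ = c-restrict F _ q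
      branch ⊥ᶜ = other λ ()
      branch oᶜ = other λ ()

  opaque
    c-if : ∀ {m} (F : Fam m) {e t f : Exp m} → Cst F e → Cst F t → Cst F f → Cst F (ifE e t f)
    c-if F p q r = c-ifelse F p q (c-restrict F _ r)

  opaque
    isNone-c : ∀ {m} (F : Fam m) i → Cst F (isNone i)
    isNone-c F i = c-case F (c-var F i) (λ { ⊤ᶜ → c-no _ ; ⊥ᶜ → c-k0 _ ⊤ᶜ ; oᶜ → c-no _ }) (λ _ → c-no _) (λ _ → c-no _)

  opaque
    isOne-c : ∀ {m} (F : Fam m) i → Cst F (isOne i)
    isOne-c F i = c-case F (c-var F i) (λ _ → c-no _)
      (λ { ¬ᶜ → c-no _ ; ◇ᶜ → c-no _ ; 1ᶜ → c-k0 _ ⊤ᶜ ; τᶜ → c-no _ }) (λ _ → c-no _)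

  opaque
    lit-c : ∀ {m} (F : Fam m) b → Cst F (lit b)
    lit-c F true  = cst (pb-const 1)
    lit-c F false = cst (pb-const 1)

  if-size : ∀ {m} (e t f : Exp m) ρ {M} → ∣ eval t ρ ∣ ≤ M → ∣ eval f ρ ∣ ≤ M → ∣ eval (ifE e t f) ρ ∣ ≤ M
  if-size e t f ρ {M} p q with eval e ρ
  ... | n0 ⊤ᶜ     = p
  ... | n0 ⊥ᶜ     = q
  ... | n0 oᶜ     = q
  ... | n1 _ _    = ≤-trans (∣∣-pos _) p
  ... | n2 _ _ _  = ≤-trans (∣∣-pos _) p

  lit-size : ∀ {m} b (ρ : Vec D m) {M} → 1 ≤ M → ∣ eval (lit b) ρ ∣ ≤ M
  lit-size true  ρ p = p
  lit-size false ρ p = p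

  -- An unfinished comparison keeps one threshold and shortens the other, so iteration does not
  -- enlarge the state.
  compare-size : ∀ {m} h b (ρ : Vec D m) U W → ∣ eval (compare h b) (W ∷ U ∷ ρ) ∣ ≤ suc (∣ U ∣ + ∣ W ∣)
  compare-size h b ρ (n0 _) W = lit-size (not b) (W ∷ n0 _ ∷ ρ) (s≤s z≤n)
  compare-size h b ρ (n1 _ _) W = s≤s z≤n
  compare-size h b ρ (n2 l o x) (n0 _) = lit-size b (x ∷ o ∷ n0 _ ∷ n2 l o x ∷ ρ) (s≤s z≤n)
  compare-size h b ρ (n2 _ _ _) (n1 _ _) = s≤s z≤n
  compare-size h b ρ U@(n2 l o x) W@(n2 l' p y) = if-size (LE h (suc (suc v0)) v0) _ _ (y ∷ p ∷ x ∷ o ∷ W ∷ U ∷ ρ)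
    (s≤s (≤-trans (≤-reflexive (+-comm ∣ W ∣ ∣ o ∣)) (+-monoˡ-≤ ∣ W ∣ (≤-trans (m≤m+n ∣ o ∣ ∣ x ∣) (n≤1+n _)))))
    (s≤s (+-monoʳ-≤ ∣ U ∣ (≤-trans (m≤m+n ∣ p ∣ ∣ y ∣) (n≤1+n _))))

  stepE-size : ∀ {m} h i (ρ : Vec D m) → ∣ eval (stepE h i) ρ ∣ ≤ ∣ lookup ρ i ∣
  stepE-size h i ρ with lookup ρ i
  ... | n0 _ = ≤-refl
  ... | n1 _ _ = s≤s z≤n
  ... | n2 (op and) U W = compare-size h false ρ U W
  ... | n2 (op or) U W  = compare-size h true ρ U W
  ... | n2 (op imp) U W = s≤s z≤n
  ... | n2 ωᶜ U W       = s≤s z≤n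

  module _ {m} (h : ℕ) (i j : Fin m) (ρ : Vec D m) where

    STEP-size : ∀ t → ∣ foldE-of (STEP h i j) ρ t ∣ ≤ suc (∣ lookup ρ i ∣ + ∣ lookup ρ j ∣)
    STEP-size (n0 l) = ≤-refl
    STEP-size (n1 l x) = s≤s z≤n
    STEP-size (n2 l x y) =
      ≤-trans (stepE-size h v1 (foldE-of (STEP h i j) ρ y ∷ foldE-of (STEP h i j) ρ x ∷ ρ)) (STEP-size x)

    LE-size : ∀ t → ∣ foldE-of (LE (suc h) i j) ρ t ∣ ≤ suc (∣ lookup ρ i ∣ + ∣ lookup ρ j ∣)
    LE-size (n0 l) = ≤-trans (stepE-size h v0 (eval (STEP h i j) ρ ∷ ρ)) (STEP-size (lookup ρ j))
    LE-size (n1 l x) = s≤s z≤n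
    LE-size (n2 l x y) =
      ≤-trans (stepE-size h v1 (foldE-of (LE (suc h) i j) ρ y ∷ foldE-of (LE (suc h) i j) ρ x ∷ ρ)) (LE-size x)

  opaque
    LE-c : ∀ h {m} (F : Fam m) i j → Cst F (LE h i j)
    compare-c : ∀ h b {m} (F : Fam (suc (suc m))) → Cst F (compare {m} h b)
    stepE-c : ∀ h {m} (F : Fam m) i → Cst F (stepE h i)
    compare-c h b F = c-case F (c-var F _) (λ _ → lit-c _ (not b)) (λ _ → c-no _)
      (λ _ → c-case _ (c-var _ _) (λ _ → lit-c _ b) (λ _ → c-no _)
        (λ _ → c-if _ (LE-c h _ _ _) (c-k2 _ _ (c-var _ _) (c-var _ _)) (c-k2 _ _ (c-var _ _) (c-var _ _))))
    stepE-c h F i = c-case F (c-var F i) (λ l → c-k0 _ l) (λ _ → c-no _) λ where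
      (op and) → compare-c h false _
      (op or)  → compare-c h true _
      (op imp) → c-no _
      ωᶜ       → c-no _
    LE-c zero F i j = c-k0 F ⊤ᶜ
    LE-c (suc h) F i j = c-cata F (c-var F i) W pW (λ a t → ≤-trans (LE-size h i j (ρ F a) t) (m≤n+m _ ∣ t ∣))
        (λ _ → c-bind F STEP-c (stepE-c h _ v0)) (λ _ → c-no _) (λ _ → stepE-c h _ v1)
      where
      W : Ix F → ℕ
      W a = suc (∣ lookup (ρ F a) i ∣ + ∣ lookup (ρ F a) j ∣)
      pW : PB (μ F) W
      pW = pb-+ (pb-const 1) (pb-+ (value-small F (var i) (c-var F i)) (value-small F (var j) (c-var F j)))
      STEP-c : Cst F (STEP h i j)
      STEP-c = c-cata F (c-var F j) W pW (λ a t → ≤-trans (STEP-size h i j (ρ F a) t) (m≤n+m _ ∣ t ∣))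
        (λ _ → c-k2 F (op and) (c-var F i) (c-var F j)) (λ _ → c-no _) (λ _ → stepE-c h _ v1)

  pb-0 : ∀ {A : Set} {μ : A → ℕ} → PB μ (λ _ → 0)
  pb-0 = pb-const 0

  ≤-+0 : ∀ {x y} → x ≤ y → x ≤ y + 0
  ≤-+0 {y = y} p = ≤-trans p (≤-reflexive (sym (+-identityʳ y)))

  opaque
    EVALB-c : ∀ {m} (F : Fam m) i → Cst F (EVALB i)
    EVALB-c {m} F i = c-cata F (c-var F i) (λ _ → 0) pb-0 (λ a t → ≤-+0 (≤-trans (value-size (ρ F a) t) (∣∣-pos t)))
      (λ { ⊤ᶜ → c-k0 F ⊤ᶜ ; ⊥ᶜ → c-no F ; oᶜ → c-no F })
      (λ { ¬ᶜ → c-if _ (c-var _ v0) (c-no _) (c-k0 _ ⊤ᶜ) ; ◇ᶜ → c-no _ ; 1ᶜ → c-no _ ; τᶜ → c-no _ })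
      (λ { (op and) → c-if _ (c-var _ v1) (c-var _ v0) (c-no _) ; (op or) → c-if _ (c-var _ v1) (c-k0 _ ⊤ᶜ) (c-var _ v0)
         ; (op imp) → c-if _ (c-var _ v1) (c-var _ v0) (c-k0 _ ⊤ᶜ) ; ωᶜ → c-no _ })
      where
      value-size : ∀ ρ t → ∣ foldE-of (EVALB i) ρ t ∣ ≤ 1
      value-size ρ (n0 ⊤ᶜ) = ≤-refl
      value-size ρ (n0 ⊥ᶜ) = ≤-refl
      value-size ρ (n0 oᶜ) = ≤-refl
      value-size ρ (n1 ¬ᶜ x) = if-size (var v0) no (k0 ⊤ᶜ) (foldE-of (EVALB i) ρ x ∷ ρ) ≤-refl ≤-refl
      value-size ρ (n1 ◇ᶜ x) = ≤-refl
      value-size ρ (n1 1ᶜ x) = ≤-refl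
      value-size ρ (n1 τᶜ x) = ≤-refl
      value-size ρ (n2 (op and) x y) =
        if-size (var v1) (var v0) no (foldE-of (EVALB i) ρ y ∷ foldE-of (EVALB i) ρ x ∷ ρ) (value-size ρ y) ≤-refl
      value-size ρ (n2 (op or) x y) =
        if-size (var v1) (k0 ⊤ᶜ) (var v0) (foldE-of (EVALB i) ρ y ∷ foldE-of (EVALB i) ρ x ∷ ρ) ≤-refl (value-size ρ y)
      value-size ρ (n2 (op imp) x y) =
        if-size (var v1) (var v0) (k0 ⊤ᶜ) (foldE-of (EVALB i) ρ y ∷ foldE-of (EVALB i) ρ x ∷ ρ) (value-size ρ y) ≤-refl
      value-size ρ (n2 ωᶜ x y) = ≤-refl

-- Polynomial bounds for the programs of the algorithm.

module ProgramCosts where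

  open Thresholds
  open Completeness
  open TreeLanguage
  open Programs
  open CostBounds
  open import Data.Nat using (ℕ; zero; suc; _+_; _*_; _^_; _≤_; z≤n; s≤s)
  open import Data.Nat.Properties
  open import Data.Nat.Solver using (module +-*-Solver)
  open import Data.Fin using (Fin; zero; suc)
  open import Data.Vec using (Vec; _∷_; lookup; [])
  open import Data.List using (_∷_; [])
  open Fam
  open Cst

  opaque
    SUB-c : ∀ h {m} (F : Fam m) i w → Cst F (SUB h i w)
    SUB-c h {m} F i w = c-cata F (c-var F i) (λ _ → 0) pb-0 (λ a t → ≤-+0 (value-size (ρ F a) t))
      (λ l → c-k0 F l)
      (λ { τᶜ → c-if _ (LE-c h _ _ _) (c-k0 _ ⊤ᶜ) (c-no _)
         ; ◇ᶜ → c-case _ (c-var _ v0) (λ _ → c-no _)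
                  (λ { 1ᶜ → c-k1 _ ◇ᶜ (c-var _ v0) ; ¬ᶜ → c-no _ ; ◇ᶜ → c-no _ ; τᶜ → c-no _ }) (λ _ → c-no _)
         ; ¬ᶜ → c-k1 _ ¬ᶜ (c-var _ v0) ; 1ᶜ → c-k1 _ 1ᶜ (c-var _ v0) })
      (λ l → c-k2 _ l (c-var _ v1) (c-var _ v0))
      where
      strip-size : ∀ ρ x → ∣ layer (SUB h i w) ρ (n1 ◇ᶜ x) ∣ ≤ suc ∣ x ∣
      strip-size ρ (n0 _)     = s≤s z≤n
      strip-size ρ (n1 1ᶜ x)  = n≤1+n _
      strip-size ρ (n1 ¬ᶜ x)  = s≤s z≤n
      strip-size ρ (n1 ◇ᶜ x)  = s≤s z≤n
      strip-size ρ (n1 τᶜ x)  = s≤s z≤n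
      strip-size ρ (n2 _ _ _) = s≤s z≤n
      value-size : ∀ ρ t → ∣ foldE-of (SUB h i w) ρ t ∣ ≤ ∣ t ∣
      value-size ρ (n0 l)     = ≤-refl
      value-size ρ (n1 τᶜ x)  =
        if-size (LE h v0 (suc w)) (k0 ⊤ᶜ) no (foldE-of (SUB h i w) ρ x ∷ ρ) (s≤s z≤n) (s≤s z≤n)
      value-size ρ (n1 ◇ᶜ x)  = ≤-trans (strip-size ρ (foldE-of (SUB h i w) ρ x)) (s≤s (value-size ρ x))
      value-size ρ (n1 ¬ᶜ x)  = s≤s (value-size ρ x)
      value-size ρ (n1 1ᶜ x)  = s≤s (value-size ρ x)
      value-size ρ (n2 l x y) = s≤s (+-mono-≤ (value-size ρ x) (value-size ρ y))

  opaque
    OK-c : ∀ h {m} (F : Fam m) i w u → Cst F (OK h i w u)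
    OK-c h {m} F i w u = c-cata F (c-var F i) (λ _ → 0) pb-0 (λ a t → ≤-+0 (value-size (ρ F a) t))
      (λ { oᶜ → c-k0 _ oᶜ ; ⊤ᶜ → c-k0 _ ⊤ᶜ ; ⊥ᶜ → c-k0 _ ⊤ᶜ })
      (λ { τᶜ → c-if _ (LE-c h _ _ _) (c-k0 _ ⊤ᶜ) (c-if _ (LE-c h _ _ _) (c-k0 _ ⊤ᶜ) (c-no _)) ; ¬ᶜ → c-var _ v0 ; ◇ᶜ → c-var _ v0 ; 1ᶜ → c-var _ v0 })
      (λ { (op _) → c-if _ (c-var _ v1) (c-var _ v0) (c-no _) ; ωᶜ → c-k2 _ ωᶜ (c-var _ v1) (c-var _ v0) })
      where
      value-size : ∀ ρ t → ∣ foldE-of (OK h i w u) ρ t ∣ ≤ ∣ t ∣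
      value-size ρ (n0 ⊤ᶜ)    = ≤-refl
      value-size ρ (n0 ⊥ᶜ)    = ≤-refl
      value-size ρ (n0 oᶜ)    = ≤-refl
      value-size ρ (n1 τᶜ x)  = if-size (LE h v0 (suc w)) (k0 ⊤ᶜ) (ifE (LE h (suc u) v0) (k0 ⊤ᶜ) no) ρ₁ (s≤s z≤n)
        (if-size (LE h (suc u) v0) (k0 ⊤ᶜ) no ρ₁ (s≤s z≤n) (s≤s z≤n))
        where
        ρ₁ : Vec D (suc m)
        ρ₁ = foldE-of (OK h i w u) ρ x ∷ ρ
      value-size ρ (n1 ◇ᶜ x)  = ≤-trans (value-size ρ x) (n≤1+n _)
      value-size ρ (n1 ¬ᶜ x)  = ≤-trans (value-size ρ x) (n≤1+n _)
      value-size ρ (n1 1ᶜ x)  = ≤-trans (value-size ρ x) (n≤1+n _)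
      value-size ρ (n2 (op _) x y) =
        if-size (var v1) (var v0) no (foldE-of (OK h i w u) ρ y ∷ foldE-of (OK h i w u) ρ x ∷ ρ)
          (≤-trans (value-size ρ y) (≤-trans (m≤n+m _ ∣ x ∣) (n≤1+n _))) (s≤s z≤n)
      value-size ρ (n2 ωᶜ x y) = s≤s (+-mono-≤ (value-size ρ x) (value-size ρ y))

  opaque
    SMALLER-c : ∀ h {m} (F : Fam m) i j → Cst F (SMALLER h i j)
    SMALLER-c h F i j = c-if F (isNone-c F i) (c-var F j)
      (c-if F (isNone-c F j) (c-var F i) (c-if F (LE-c h F i j) (c-var F i) (c-var F j)))

  record Holds {m} (F : Fam m) (P : G → Set) (i : Fin m) : Set where
    constructor holds
    field
      fm   : Ix F → G
      good : ∀ a → P (fm a)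
      at-i : ∀ a → lookup (ρ F a) i ≡ encG (fm a)

  Bounded : ℕ → (∀ {m} → Fin m → Exp m) → Set₁
  Bounded h rec = ∀ {m} (F : Fam m) i → Holds F (Pure h) i → Cst F (rec i)

  encT-size : ∀ {W B} → W ∈ toks B → ∣ encT W ∣ ≤ ∣ encG B ∣
  encT-size {B = tok W} (here refl) = n≤1+n _
  encT-size {B = bin c A B} m with ∈-++⁻ (toks A) m
  ... | inj₁ m' = ≤-trans (encT-size {B = A} m') (≤-trans (m≤m+n _ _) (n≤1+n _))
  ... | inj₂ m' = ≤-trans (encT-size {B = B} m') (≤-trans (m≤n+m _ ∣ encG A ∣) (n≤1+n _))
  encT-size {B = neg A} m = ≤-trans (encT-size {B = A} m) (n≤1+n _)
  encT-size {B = dia j A} m = ≤-trans (encT-size {B = A} m) (≤-trans (ones-size j) (n≤1+n _))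
    where
    ones-size : ∀ j → ∣ encG A ∣ ≤ ∣ ones j (encG A) ∣
    ones-size zero    = ≤-refl
    ones-size (suc j) = ≤-trans (ones-size j) (n≤1+n _)

  module _ {h} {rec : ∀ {m} → Fin m → Exp m} (cr : Computes h rec) (br : Bounded h rec) where

    opaque
      CAND-c : ∀ {m} (F : Fam m) i w (H : Holds F (Processed h) i) (t : Ix F → T) →
        (∀ a → lookup (ρ F a) w ≡ encT (t a)) → (∀ a → t a ∈ leaf ∷ toks (Holds.fm H a)) → Cst F (CAND rec (suc h) i w)
      CAND-c F i w (holds B pB eB) t et mt = c-bind F sc (c-bind _ (br _ v0 (holds (λ a → sub (t a) (B a))
          (λ a → sub-pure (t a) (pB a))
          (λ a → SUB-eval (suc h) i w (ρ F a) (eB a) (et a) (cell-thr {rec = rec} cr (pB a) (mt a)) (thr-tok (pB a)))))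
        (c-if _ (isNone-c _ v0) (c-no _) (c-bind _ (c-k2 _ ωᶜ (c-var _ _) (c-var _ _))
          (c-if _ (OK-c (suc h) _ _ _ _) (c-var _ v0) (c-no _)))))
        where
        sc : Cst F (SUB (suc h) i w)
        sc = SUB-c (suc h) F i w

    module BestBound {m} (F : Fam m) (i : Fin m) (H : Holds F (Processed h) i) where

      open Holds H renaming (fm to B; good to pB; at-i to eB)

      Cell∈ : Ix F → L1 → D → Set
      Cell∈ a τᶜ x = ∃[ w ] (w ∈ leaf ∷ toks (B a) × x ≡ encT w)
      Cell∈ a _  x = ⊤

      opaque
        -- Used twice to avoid a circle: with `V₀`, which bounds the tokens, it bounds every
        -- candidate by the cost `K` of computing it; then with `V₀ a + K a`, which bounds all
        -- values occurring in the fold.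
        tok-cost : ∀ V pV → Cst (ext₁ F V pV λ a → Cell∈ a τᶜ) (CAND rec (suc h) (suc i) v0)
        tok-cost V pV = CAND-c _ (suc i) v0 (holds (λ (a , _) → B a) (λ (a , _) → pB a) (λ (a , _) → eB a))
          (λ (_ , _ , _ , w , _) → w) (λ (_ , _ , _ , _ , _ , e) → e) (λ (_ , _ , _ , _ , mw , _) → mw)

      V₀ : Ix F → ℕ
      V₀ a = suc ∣ lookup (ρ F a) i ∣

      pV₀ : PB (μ F) V₀
      pV₀ = pb-+ (pb-const 1) (value-small F (var i) (c-var F i))

      K : Ix F → ℕ
      K a = proj₁ (pb (tok-cost V₀ pV₀)) * suc (μ F a) ^ proj₁ (proj₂ (pb (tok-cost V₀ pV₀)))

      V : Ix F → ℕ
      V a = V₀ a + K a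

      pV : PB (μ F) V
      pV = pb-+ pV₀ (proj₁ (pb (tok-cost V₀ pV₀)) , proj₁ (proj₂ (pb (tok-cost V₀ pV₀))) , λ a → ≤-refl)

      cell-size : ∀ a {w} → w ∈ leaf ∷ toks (B a) → ∣ encT w ∣ ≤ V₀ a
      cell-size a (here refl) = s≤s z≤n
      cell-size a (there m) = ≤-trans (encT-size {B = B a} m) (≤-trans (≤-reflexive (cong ∣_∣ (sym (eB a)))) (n≤1+n _))

      cand-size : ∀ a {w} → w ∈ leaf ∷ toks (B a) → ∣ encM (cand (minimum h) (B a) w) ∣ ≤ K a
      cand-size a {w} mw = ≤-trans (≤-reflexive (cong ∣_∣ (sym
          (CAND-eval {rec = rec} cr (pB a) (suc i) v0 (encT w ∷ ρ F a) (eB a) refl mw))))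
        (≤-trans (size≤cost (CAND rec (suc h) (suc i) v0) (encT w ∷ ρ F a))
          (proj₂ (proj₂ (pb (tok-cost V₀ pV₀))) (a , encT w , cell-size a mw , w , mw , refl)))

      best-size : ∀ a B' → (∀ {W} → W ∈ toks B' → W ∈ toks (B a)) → ∣ encM (best (cand (minimum h) (B a)) B') ∣ ≤ V a
      best-size a tt sb = s≤s z≤n
      best-size a ff sb = s≤s z≤n
      best-size a (tok W) sb = ≤-trans (cand-size a (there (sb (here refl)))) (m≤n+m _ (V₀ a))
      best-size a (bin c A A') sb = pick-size (best f A) (best f A')
          (best-size a A (λ m → sb (∈-++⁺ˡ m))) (best-size a A' (λ m → sb (∈-++⁺ʳ (toks A) m)))
        where
        f : T → Maybe T
        f = cand (minimum h) (B a)
        pick-size : ∀ r s {M} → ∣ encM r ∣ ≤ M → ∣ encM s ∣ ≤ M → ∣ encM (smaller r s) ∣ ≤ M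
        pick-size nothing s p q = q
        pick-size (just U) nothing p q = p
        pick-size (just U) (just W) p q with le U W
        ... | true  = p
        ... | false = q
      best-size a (neg A) sb = best-size a A sb
      best-size a (dia j A) sb = best-size a A sb

      opaque
        BEST-c : Cst F (BEST rec (suc h) i)
        BEST-c = Ly.layer-cata
            (λ { ⊤ᶜ → c-no _ ; ⊥ᶜ → c-no _ ; oᶜ → c-k0 _ oᶜ })
            (λ { τᶜ → tok-cost V pV ; ¬ᶜ → c-var _ v0 ; ◇ᶜ → c-var _ v0 ; 1ᶜ → c-var _ v0 })
            (λ { (op _) → SMALLER-c (suc h) _ v1 v0 ; ωᶜ → c-k2 _ ωᶜ (c-var _ v1) (c-var _ v0) })
            (c-var F i) (λ a → subst (Ly.Nodes a) (sym (eB a)) (nodes a (B a) (λ m → m)))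
          where
          module Ly = Layer F {bestAtom} {bestUnary rec (suc h) i} {bestBinary (suc h)} V pV (λ _ _ → ⊤) Cell∈ (λ _ _ _ _ → ⊤)
          T-fit : ∀ a {W} → ∣ encT W ∣ ≤ V a → ∣ foldE-of (BEST rec (suc h) i) (ρ F a) (encT W) ∣ ≤ V a
          T-fit a {W} le = ≤-trans (≤-reflexive (cong ∣_∣ (BEST-T {rec = rec} cr (pB a) i (ρ F a) W))) le
          T-nodes : ∀ a W → ∣ encT W ∣ ≤ V a → Ly.Nodes a (encT W)
          T-nodes a leaf le = tt
          T-nodes a (o ⊹ x) le = (T-fit a le₁ , T-fit a le₂ , tt) , T-nodes a o le₁ , T-nodes a x le₂
            where
            le₁ : ∣ encT o ∣ ≤ V a
            le₁ = ≤-trans (≤-trans (m≤m+n _ _) (n≤1+n _)) le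
            le₂ : ∣ encT x ∣ ≤ V a
            le₂ = ≤-trans (≤-trans (m≤n+m _ ∣ encT o ∣) (n≤1+n _)) le
          fit : ∀ a B' → (∀ {W} → W ∈ toks B' → W ∈ toks (B a)) →
            ∣ foldE-of (BEST rec (suc h) i) (ρ F a) (encG B') ∣ ≤ V a
          fit a B' sb = ≤-trans (≤-reflexive (cong ∣_∣ (BEST-fold {rec = rec} cr (pB a) i (ρ F a) (eB a) B' sb))) (best-size a B' sb)
          nodes : ∀ a B' → (∀ {W} → W ∈ toks B' → W ∈ toks (B a)) → Ly.Nodes a (encG B')
          nodes a tt sb = tt
          nodes a ff sb = tt
          nodes a (tok W) sb = (T-fit a fitsW , W , there mW , BEST-T {rec = rec} cr (pB a) i (ρ F a) W) , T-nodes a W fitsW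
            where
            mW : W ∈ toks (B a)
            mW = sb (here refl)
            fitsW : ∣ encT W ∣ ≤ V a
            fitsW = ≤-trans (cell-size a (there mW)) (m≤m+n _ _)
          nodes a (bin c A A') sb = (fit a A sbˡ , fit a A' sbʳ , tt) , nodes a A sbˡ , nodes a A' sbʳ
            where
            sbˡ : ∀ {W} → W ∈ toks A → W ∈ toks (B a)
            sbˡ m = sb (∈-++⁺ˡ m)
            sbʳ : ∀ {W} → W ∈ toks A' → W ∈ toks (B a)
            sbʳ m = sb (∈-++⁺ʳ (toks A) m)
          nodes a (neg A) sb = (fit a A sb , tt) , nodes a A sb
          nodes a (dia j A) sb = (proj₁ (under j) , tt) , proj₂ (under j)
            where
            under : ∀ j → ∣ foldE-of (BEST rec (suc h) i) (ρ F a) (ones j (encG A)) ∣ ≤ V a × Ly.Nodes a (ones j (encG A))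
            under zero    = fit a A sb , nodes a A sb
            under (suc j) = proj₁ (under j) , (proj₁ (under j) , tt) , proj₂ (under j)

    opaque
      THRESH-c : ∀ {m} (F : Fam m) i → Holds F (Processed h) i → Cst F (THRESH rec (suc h) i)
      THRESH-c F i (holds B pB eB) = c-bind F (c-k0 F oᶜ) (c-bind _
        (CAND-c _ (suc i) v0 (holds B pB eB) (λ _ → leaf) (λ _ → refl) (λ _ → here refl))
        (c-bind _ (BestBound.BEST-c _ (suc (suc i)) (holds B pB eB)) (SMALLER-c (suc h) _ v1 v0)))

  ones-∣∣ : ∀ j a → ∣ ones j a ∣ ≡ j + ∣ a ∣
  ones-∣∣ zero    a = refl
  ones-∣∣ (suc j) a = cong suc (ones-∣∣ j a)

  dia-≤ : ∀ j A → suc ∣ encG A ∣ ≤ ∣ encG (dia j A) ∣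
  dia-≤ j A = s≤s (≤-trans (m≤n+m ∣ encG A ∣ j) (≤-reflexive (sym (ones-∣∣ j (encG A)))))

  module _ {h} {rec : G → Maybe T} (sol : Solves h rec) where

    -- The tokens inserted by `proc` may be large, but `sub` turns each of them into a constant.
    -- Recursive calls therefore stay within the size of the original formula.
    sub-proc-size : ∀ w A → ∣ encG (sub w (proc rec A)) ∣ ≤ ∣ encG A ∣
    sub-proc-size w tt = ≤-refl
    sub-proc-size w ff = ≤-refl
    sub-proc-size w (tok W) with le W w
    ... | true  = s≤s z≤n
    ... | false = s≤s z≤n
    sub-proc-size w (bin c A B) = s≤s (+-mono-≤ (sub-proc-size w A) (sub-proc-size w B))
    sub-proc-size w (neg A) = s≤s (sub-proc-size w A)
    sub-proc-size w (dia zero A) with threshold rec (proc rec A)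
    ... | nothing = s≤s z≤n
    ... | just W with le W w
    ...   | true  = s≤s z≤n
    ...   | false = s≤s z≤n
    sub-proc-size w (dia (suc j) A) = s≤s (≤-trans (≤-reflexive (ones-∣∣ j _)) (≤-trans
      (+-mono-≤ (n≤1+n j) (sub-proc-size w A)) (≤-reflexive (sym (ones-∣∣ (suc j) (encG A))))))

    threshold-shape : ∀ {B} → Processed h B → ∀ {U} → threshold rec B ≡ just U →
      ∃[ w ] ∃[ V ] (w ∈ leaf ∷ toks B × rec (sub w B) ≡ just V × U ≡ w ⊹ V)
    threshold-shape {B} pB e with threshold rec B | threshold-least sol 0 B pB
    threshold-shape {B} pB refl | .(just _) | (w , mw , c) , _ = w , shape (rec (sub w B)) refl c
      where
      shape : ∀ r → rec (sub w B) ≡ r → ∀ {U} → candidate B w r ≡ just U →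
        ∃[ V ] (w ∈ leaf ∷ toks B × rec (sub w B) ≡ just V × U ≡ w ⊹ V)
      shape (just V) eq c with ok w (w ⊹ V) B
      shape (just V) eq refl | true = V , mw , eq , refl

    module _ {s S : ℕ} (small-rec : ∀ {X V} → Pure h X → ∣ encG X ∣ ≤ s → rec X ≡ just V → ∣ encT V ∣ ≤ S) where

      -- A new token extends `leaf` or a token of the body by one exponent of size at most `S`. Each
      -- `◇` thus adds at most `suc S`, and nesting adds up instead of multiplying.
      proc-tok-size : ∀ A → Pure (suc h) A → ∣ encG A ∣ ≤ s → ∀ {W} → W ∈ toks (proc rec A) →
        ∣ encT W ∣ ≤ suc (∣ encG A ∣ * suc S)
      proc-tok-size (tok W) (tok ()) fits m
      proc-tok-size (bin c A B) (bin p q) fits m with ∈-++⁻ (toks (proc rec A)) m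
      ... | inj₁ m' = ≤-trans (proc-tok-size A p (≤-trans (≤-trans (m≤m+n _ _) (n≤1+n _)) fits) m')
        (s≤s (*-monoˡ-≤ (suc S) (≤-trans (m≤m+n ∣ encG A ∣ _) (n≤1+n _))))
      ... | inj₂ m' = ≤-trans (proc-tok-size B q (≤-trans (≤-trans (m≤n+m _ ∣ encG A ∣) (n≤1+n _)) fits) m')
        (s≤s (*-monoˡ-≤ (suc S) (≤-trans (m≤n+m _ ∣ encG A ∣) (n≤1+n _))))
      proc-tok-size (neg A) (neg p) fits m = ≤-trans (proc-tok-size A p (≤-trans (n≤1+n _) fits) m)
        (s≤s (*-monoˡ-≤ (suc S) (n≤1+n ∣ encG A ∣)))
      proc-tok-size (dia (suc j) A) (dia _ p) fits m =
        ≤-trans (proc-tok-size A p (≤-trans (n≤1+n _) (≤-trans (dia-≤ (suc j) A) fits)) m)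
          (s≤s (*-monoˡ-≤ (suc S) (≤-trans (n≤1+n _) (dia-≤ (suc j) A))))
      proc-tok-size (dia zero A) (dia _ p) fits {W} m with threshold rec (proc rec A) in eq
      proc-tok-size (dia zero A) (dia _ p) fits {W} (here refl) | just .W
        with threshold-shape (proj₁ (proc-≈ sol 0 A p)) eq
      ... | w , V , mw , eV , refl = s≤s (≤-trans (≤-reflexive (+-comm ∣ encT w ∣ ∣ encT V ∣))
          (≤-trans (+-mono-≤ (small-rec (sub-pure w (proj₁ (proc-≈ sol 0 A p))) (≤-trans (sub-proc-size w A) fitsA) eV) (cell-size mw))
            (≤-reflexive (+-suc S (∣ encG A ∣ * suc S)))))
        where
        fitsA : ∣ encG A ∣ ≤ s
        fitsA = ≤-trans (n≤1+n _) fits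
        cell-size : ∀ {w} → w ∈ leaf ∷ toks (proc rec A) → ∣ encT w ∣ ≤ suc (∣ encG A ∣ * suc S)
        cell-size (here refl) = s≤s z≤n
        cell-size (there m)   = proc-tok-size A p fitsA m

      -- The factor `2 + s * suc S` bounds a token together with its `τᶜ`.
      proc-size : ∀ A → Pure (suc h) A → ∣ encG A ∣ ≤ s → ∣ encG (proc rec A) ∣ ≤ ∣ encG A ∣ * (2 + s * suc S)
      proc-size tt p fits = s≤s z≤n
      proc-size ff p fits = s≤s z≤n
      proc-size (tok W) (tok ()) fits
      proc-size (bin c A B) (bin p q) fits = ≤-trans (s≤s (+-mono-≤
          (proc-size A p (≤-trans (≤-trans (m≤m+n _ _) (n≤1+n _)) fits))
          (proc-size B q (≤-trans (≤-trans (m≤n+m _ ∣ encG A ∣) (n≤1+n _)) fits))))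
        (≤-trans (≤-reflexive (cong suc (sym (*-distribʳ-+ (2 + s * suc S) ∣ encG A ∣ ∣ encG B ∣))))
          (+-monoˡ-≤ _ (s≤s z≤n)))
      proc-size (neg A) (neg p) fits =
        ≤-trans (s≤s (proc-size A p (≤-trans (n≤1+n _) fits))) (+-monoˡ-≤ _ (s≤s z≤n))
      proc-size (dia (suc j) A) (dia _ p) fits = ≤-trans
        (s≤s (≤-trans (≤-reflexive (ones-∣∣ (suc j) _))
          (+-monoʳ-≤ (suc j) (proc-size A p (≤-trans (n≤1+n _) (≤-trans (dia-≤ (suc j) A) fits))))))
        (≤-trans (grow (suc (suc j)) ∣ encG A ∣)
          (≤-reflexive (cong (_* (2 + s * suc S)) (cong suc (sym (ones-∣∣ (suc j) (encG A)))))))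
        where
        grow : ∀ j a → j + a * (2 + s * suc S) ≤ (j + a) * (2 + s * suc S)
        grow j a = ≤-trans (+-monoˡ-≤ _ (m≤m*n j (2 + s * suc S)))
          (≤-reflexive (sym (*-distribʳ-+ (2 + s * suc S) j a)))
      proc-size (dia zero A) (dia _ p) fits with threshold rec (proc rec A) in eq
      ... | nothing = s≤s z≤n
      ... | just W  = ≤-trans (s≤s (proc-tok-size (dia zero A) (dia (s≤s z≤n) p) fits (token eq)))
        (≤-trans (s≤s (s≤s (*-monoˡ-≤ (suc S) fits))) (m≤m+n (2 + s * suc S) _))
        where
        token : ∀ {r} → r ≡ just W → W ∈ toks (close r)
        token refl = here refl

  formulas : ℕ → Fam 1
  formulas n = record { Ix = Σ G (Pure n) ; ρ = λ (X , _) → encG X ∷ [] ; μ = λ (X , _) → ∣ encG X ∣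
                      ; small = pb-≤ (λ _ → ≤-reflexive (+-identityʳ _)) pb-μ }

  module _ {h} {rec : ∀ {m} → Fin m → Exp m} (cr : Computes h rec) (br : Bounded h rec)
           {m} (F : Fam m) (i : Fin m) (H : Holds F (Pure (suc h)) i) where

    open Holds H renaming (fm to A; good to pA; at-i to eA)

    private
      mn : G → Maybe T
      mn = minimum h

      s : Ix F → ℕ
      s a = ∣ lookup (ρ F a) i ∣

      ps : PB (μ F) s
      ps = value-small F (var i) (c-var F i)

    -- The values of minimum h are polynomially bounded because rec computes them.
    opaque
      rec-bound : Cst (formulas h) (rec zero)
      rec-bound = br (formulas h) zero (holds proj₁ proj₂ (λ _ → refl))

    S : Ix F → ℕ
    S a = proj₁ (pb rec-bound) * suc (s a) ^ proj₁ (proj₂ (pb rec-bound))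

    opaque
      pS : PB (μ F) S
      pS = pb-* (pb-const (proj₁ (pb rec-bound))) (pb-^ (proj₁ (proj₂ (pb rec-bound))) (pb-+ (pb-const 1) ps))

    small-rec : ∀ a {X V} → Pure h X → ∣ encG X ∣ ≤ s a → mn X ≡ just V → ∣ encT V ∣ ≤ S a
    small-rec a {X} {V} pX le e = ≤-trans (≤-reflexive (cong ∣_∣ (sym
        (trans (cr zero (encG X ∷ []) {X} refl pX) (cong encM e)))))
      (≤-trans (size≤cost (rec zero) (encG X ∷ []))
        (≤-trans (proj₂ (proj₂ (pb rec-bound)) (X , pX))
          (*-monoʳ-≤ (proj₁ (pb rec-bound)) (^-monoˡ-≤ (proj₁ (proj₂ (pb rec-bound))) (s≤s le)))))

    -- The first summand allows for the unary index of a modality, the second for a processed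
    -- subformula.
    V : Ix F → ℕ
    V a = s a + s a * (2 + s a * suc (S a))

    opaque
      pV : PB (μ F) V
      pV = pb-+ ps (pb-* ps (pb-+ (pb-const 2) (pb-* ps (pb-+ (pb-const 1) pS))))

    -- Below `◇ᶜ` stands a formula if the index is 0 and a tree with root `1ᶜ` otherwise; only
    -- formulas are passed to `THRESH`.
    Child : Ix F → L1 → D → Set
    Child a ◇ᶜ x = (∃[ A' ] (Processed h A' × x ≡ encG A')) ⊎ (∃[ y ] x ≡ n1 1ᶜ y)
    Child a _  x = ⊤

    ◇F : Fam (suc m)
    ◇F = ext₁ F V pV λ a → Child a ◇ᶜ

    opaque
      ◇-c : Cst ◇F (ifE (isOne zero) (k1 ◇ᶜ (var zero)) (bind (THRESH rec (suc h) zero) (ifE (isNone zero) no (k1 τᶜ (var zero)))))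
      ◇-c = c-ifelse ◇F (isOne-c ◇F zero) (c-k1 _ ◇ᶜ (c-var _ zero))
        (c-bind _ (THRESH-c {rec = rec} cr br _ zero (holds (λ (a , g) → proj₁ (formula a g)) (λ (a , g) → proj₁ (proj₂ (formula a g)))
            (λ (a , g) → proj₂ (proj₂ (formula a g)))))
          (c-if _ (isNone-c _ zero) (c-no _) (c-k1 _ τᶜ (c-var _ zero))))
        where
        formula : ∀ a → eval (isOne zero) (ρ ◇F a) ≢ n0 ⊤ᶜ → ∃[ A' ] (Processed h A' × proj₁ (proj₂ a) ≡ encG A')
        formula (a , x , _ , inj₁ q) g = q
        formula (a , x , _ , inj₂ (y , refl)) g = ⊥-elim (g refl)

    opaque
      PROC-c : Cst F (PROC rec (suc h) i)
      PROC-c = Ly.layer-cata (λ l → c-k0 _ l)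
          (λ { ◇ᶜ → ◇-c ; ¬ᶜ → c-k1 _ ¬ᶜ (c-var _ zero) ; 1ᶜ → c-k1 _ 1ᶜ (c-var _ zero) ; τᶜ → c-k1 _ τᶜ (c-var _ zero) })
          (λ l → c-k2 _ l (c-var _ (suc zero)) (c-var _ zero))
          (c-var F i) (λ a → subst (Ly.Nodes a) (sym (eA a)) (proj₂ (nodes a (A a) (pA a) (root a))))
        where
        module Ly = Layer F {k0} {procUnary rec (suc h)} {rebuild} V pV (λ _ _ → ⊤) Child (λ _ _ _ _ → ⊤)
        f : Ix F → D → D
        f a = foldE-of (PROC rec (suc h) i) (ρ F a)
        root : ∀ a → ∣ encG (A a) ∣ ≤ s a
        root a = ≤-reflexive (cong ∣_∣ (sym (eA a)))
        fit : ∀ a A' → Pure (suc h) A' → ∣ encG A' ∣ ≤ s a → ∣ f a (encG A') ∣ ≤ s a * (2 + s a * suc (S a))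
        fit a A' p le = ≤-trans (≤-reflexive (cong ∣_∣ (PROC-fold {rec = rec} cr i (ρ F a) A' p)))
          (≤-trans (proc-size (minimum-solves h) (small-rec a) A' p le) (*-monoˡ-≤ (2 + s a * suc (S a)) le))
        nodes : ∀ a A' → Pure (suc h) A' → ∣ encG A' ∣ ≤ s a → ∣ f a (encG A') ∣ ≤ V a × Ly.Nodes a (encG A')
        nodes a A' p le = ≤-trans (fit a A' p le) (m≤n+m _ (s a)) , inner A' p le
          where
          inner : ∀ A' → Pure (suc h) A' → ∣ encG A' ∣ ≤ s a → Ly.Nodes a (encG A')
          inner tt p le = tt
          inner ff p le = tt
          inner (tok W) (tok ()) le
          inner (bin c B C) (bin p q) le =
            (proj₁ (nodes a B p le₁) , proj₁ (nodes a C q le₂) , tt) , proj₂ (nodes a B p le₁) , proj₂ (nodes a C q le₂)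
            where
            le₁ : ∣ encG B ∣ ≤ s a
            le₁ = ≤-trans (≤-trans (m≤m+n _ _) (n≤1+n _)) le
            le₂ : ∣ encG C ∣ ≤ s a
            le₂ = ≤-trans (≤-trans (m≤n+m _ ∣ encG B ∣) (n≤1+n _)) le
          inner (neg B) (neg p) le = (proj₁ (nodes a B p le₁) , tt) , proj₂ (nodes a B p le₁)
            where
            le₁ : ∣ encG B ∣ ≤ s a
            le₁ = ≤-trans (n≤1+n _) le
          inner (dia zero B) (dia _ p) le =
            (proj₁ (nodes a B p le₁) , inj₁ (proc mn B , proj₁ (proc-≈ (minimum-solves h) 0 B p) ,
              PROC-fold {rec = rec} cr i (ρ F a) B p)) , proj₂ (nodes a B p le₁)
            where
            le₁ : ∣ encG B ∣ ≤ s a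
            le₁ = ≤-trans (n≤1+n _) le
          inner (dia (suc j) B) (dia _ p) le =
            (proj₁ (under (suc j) (≤-trans (≤-reflexive (sym (ones-∣∣ (suc j) (encG B)))) le')) , inj₂ (f a (ones j (encG B)) , refl)) ,
            proj₂ (under (suc j) (≤-trans (≤-reflexive (sym (ones-∣∣ (suc j) (encG B)))) le'))
            where
            le' : ∣ ones (suc j) (encG B) ∣ ≤ s a
            le' = ≤-trans (n≤1+n _) le
            leB : ∣ encG B ∣ ≤ s a
            leB = ≤-trans (n≤1+n _) (≤-trans (dia-≤ (suc j) B) le)
            value : ∀ k → ∣ f a (ones k (encG B)) ∣ ≡ k + ∣ f a (encG B) ∣
            value zero    = refl
            value (suc k) = cong suc (value k)
            under : ∀ k → k + ∣ encG B ∣ ≤ s a → ∣ f a (ones k (encG B)) ∣ ≤ V a × Ly.Nodes a (ones k (encG B))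
            under zero    lt = nodes a B p leB
            under (suc k) lt = ≤-trans (≤-reflexive (value (suc k))) (+-mono-≤ (≤-trans (m≤m+n (suc k) _) lt) (fit a B p leB)) ,
              (proj₁ (under k (≤-trans (n≤1+n _) lt)) , tt) , proj₂ (under k (≤-trans (n≤1+n _) lt))

  opaque
    -- The induction may raise the degree at each level, which is harmless because `h` is fixed by
    -- the number of modalities.
    MIN-c : ∀ h → Bounded h (MIN h)
    MIN-c zero F i H = c-if F (EVALB-c F i) (c-k0 F oᶜ) (c-no F)
    MIN-c (suc h) F i H@(holds A pA eA) = c-bind F pc
        (THRESH-c {rec = MIN h} (MIN-computes h) (MIN-c h) _ zero (holds (λ a → proc (minimum h) (A a))
          (λ a → proj₁ (proc-≈ (minimum-solves h) 0 (A a) (pA a)))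
          (λ a → PROC-eval {rec = MIN h} (MIN-computes h) i (ρ F a) (eA a) (pA a))))
      where
      pc : Cst F (PROC (MIN h) (suc h) i)
      pc = PROC-c {rec = MIN h} (MIN-computes h) (MIN-c h) F i H

  opaque
    DECIDE-c : ∀ n → Cst (formulas n) (DECIDE n)
    DECIDE-c n = c-bind _ (c-k1 _ ¬ᶜ (c-var _ zero)) (c-bind _
      (MIN-c n _ zero (holds (λ (X , _) → neg X) (λ (X , p) → neg p) (λ _ → refl))) (isNone-c _ zero))

-- Assembling the machine and its time bound.

open import Defs hiding (eval)
open import Data.Nat using (ℕ)
open Thresholds
open Completeness
open TreeLanguage
open IdealTape
open TuringMachine
open Programs
open CostBounds
open ProgramCosts
open import Data.Nat using (zero; suc; _+_; _*_; _^_)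
open import Data.Nat.Properties
open import Data.Vec using ([]; _∷_)
open import Data.List using ([]; _∷_; _++_; length; map; replicate; _ʳ++_)
open import Data.List.Properties using (++-assoc; ++-identityʳ; map-++; length-map)
open import Function.Bundles using (mk⇔)

label-code : ∀ {n A} → InL n A → ∀ r → map label (encode A) ++ r ≡ code (encG (toG A)) r
label-code₂ : ∀ {n A B} → InL n A → InL n B → ∀ r →
  map label (encode A ++ encode B) ++ r ≡ code (encG (toG A)) (code (encG (toG B)) r)
label-code ⊤ᴸ r = refl
label-code ⊥ᴸ r = refl
label-code (∧ᴸ a b) r = cong (y2 (op and) ∷_) (label-code₂ a b r)
label-code (∨ᴸ a b) r = cong (y2 (op or) ∷_) (label-code₂ a b r)
label-code (⇒ᴸ a b) r = cong (y2 (op imp) ∷_) (label-code₂ a b r)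
label-code (¬ᴸ a) r = cong (y1 ¬ᶜ ∷_) (label-code a r)
label-code (◇ᴸ {k} {A} _ a) r = cong (y1 ◇ᶜ ∷_) (index k)
  where
  index : ∀ k → map label (replicate k s1 ++ encode A) ++ r ≡ code (ones k (encG (toG A))) r
  index zero    = label-code a r
  index (suc k) = cong (y1 1ᶜ ∷_) (index k)
label-code₂ {A = A} {B} a b r = trans (cong (_++ r) (map-++ label (encode A) (encode B)))
  (trans (++-assoc (map label (encode A)) (map label (encode B)) r)
    (trans (cong (map label (encode A) ++_) (label-code b r)) (label-code a (code (encG (toG B)) r))))

code-length : ∀ t r → length (code t r) ≡ ∣ t ∣ + length r
code-length (n0 l) r = refl
code-length (n1 l a) r = cong suc (code-length a r)
code-length (n2 l a b) r = cong suc (trans (code-length a (code b r))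
  (trans (cong (∣ a ∣ +_) (code-length b r)) (sym (+-assoc ∣ a ∣ ∣ b ∣ (length r)))))

code-reverse : ∀ t r x → code t r ʳ++ x ≡ r ʳ++ rcode t x
code-reverse (n0 l) r x = refl
code-reverse (n1 l a) r x = code-reverse a r (y1 l ∷ x)
code-reverse (n2 l a b) r x = trans (code-reverse a (code b r) (y2 l ∷ x)) (code-reverse b r (rcode a (y2 l ∷ x)))

-- Loading leaves the reversed input on stack `X`; `toE` turns it into an environment with one
-- variable.
decider : ℕ → Cmd
decider n = toE ∙ comp (DECIDE n)

decider-cost : ∀ {n} → Fam.Ix (formulas n) → ℕ
decider-cost {n} (X , _) = (2 * ∣ encG X ∣ + 1) + cost (DECIDE n) (encG X ∷ [])

opaque
  decider-run : ∀ n X (p : Pure n X) →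
    Run (decider n) ⟨ [] , [] , rcode (encG X) [] , [] ⟩ (decider-cost (X , p))
        ⟨ code (encB (refuted (minimum n (neg X)))) [] , code (encG X) [] , [] , [] ⟩
  decider-run n X p = r-seq (toE-run (encG X) (r-end refl))
    (subst (λ v → Run (comp (DECIDE n)) ⟨ [] , code (encG X) [] , [] , [] ⟩ (cost (DECIDE n) (encG X ∷ [])) ⟨ code v [] , code (encG X) [] , [] , [] ⟩)
      (DECIDE-eval n X p) (comp-run (DECIDE n) (encG X ∷ [])))

opaque
  -- The expression is the time demanded by `accepts` when `N` is the size of the tree, which equals
  -- the length of the input.
  total-time : ∀ n → PB (λ (X , p) → ∣ encG X ∣)
    (λ ((X , p) : Σ G (Pure n)) → 2 * ∣ encG X ∣ + 2 + decider-cost (X , p) * opCost (decider-cost (X , p) + ∣ encG X ∣))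
  total-time n = pb-+ (pb-+ (pb-* (pb-const 2) pb-μ) (pb-const 2)) (pb-* ops (pb-+ (pb-const 3) (pb-+ space space)))
    where
    ops : PB (λ (X , p) → ∣ encG X ∣) (decider-cost {n})
    ops = pb-+ (pb-+ (pb-* (pb-const 2) pb-μ) (pb-const 1)) (Cst.pb (DECIDE-c n))
    space : PB (λ (X , p) → ∣ encG X ∣) (λ ((X , p) : Σ G (Pure n)) → decider-cost (X , p) + ∣ encG X ∣)
    space = pb-+ ops pb-μ

answer-code : ∀ b → answer (at (code (encB b) []) 0) ≡ b
answer-code true  = refl
answer-code false = refl

theorem2 : (n : ℕ) → PolyTimeDecidesGLP n
theorem2 n = machine , c , d , λ A l →
    decide n A , accepted A l (encode A) refl , mk⇔ (proj₁ (decide-correct l)) (proj₂ (decide-correct l))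
  where
  open Machine (decider n) fin-Cell (fin-RealQ (fin-QC (decider n)))
  c d : ℕ
  c = proj₁ (total-time n)
  d = proj₁ (proj₂ (total-time n))
  -- The word is generalised so that its first symbol can be split off, as `accepts` requires.
  accepted : ∀ A → InL n A → ∀ w → encode A ≡ w → Accepts? machine w (c * suc (length w) ^ d) ≡ just (decide n A)
  accepted A l w e = go w labels len
    where
    t : D
    t = encG (toG A)
    labels : map label w ≡ code t []
    labels = trans (sym (++-identityʳ _)) (trans (cong (λ w → map label w ++ []) (sym e)) (label-code l []))
    len : length w ≡ ∣ t ∣
    len = trans (sym (length-map label w)) (trans (cong length labels) (trans (code-length t []) (+-identityʳ ∣ t ∣)))
    go : ∀ w → map label w ≡ code t [] → length w ≡ ∣ t ∣ →
      Accepts? machine w (c * suc (length w) ^ d) ≡ just (decide n A)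
    go [] _ len with ∣ t ∣ | ∣∣-pos t
    go [] _ () | suc _ | _
    go (b ∷ w) labels len = trans
      (accepts b w (subst (λ x → Run (decider n) ⟨ [] , [] , x , [] ⟩ (decider-cost (toG A , toG-pure l))
            ⟨ code (encB (decide n A)) [] , code t [] , [] , [] ⟩)
          (sym (trans (cong (_ʳ++ []) labels) (code-reverse t [] []))) (decider-run n (toG A) (toG-pure l)))
        ∣ t ∣ (≤-reflexive len) _
        (≤-trans (proj₂ (proj₂ (total-time n)) (toG A , toG-pure l))
          (≤-reflexive (cong (λ k → c * suc k ^ d) (sym len)))))
      (cong just (answer-code (decide n A)))
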